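{- For every $\ell \geqslant 2$, there exist constants $C > 0$, $\delta > 0$ and $k_0 \in \mathbb{N}$ such that the following holds for every $k \geqslant k_0$ and every $n \in \mathbb{N}$. Given a graph $G$ with $n$ vertices and $k n^{1+1/\ell}$ edges, there exists a $2\ell$-uniform hypergraph $\mathcal{H}$ on vertex set $E(G)$ such that each edge of $\mathcal{H}$ is the edge set of a copy of $C_{2\ell}$ in $G$, and (a) $\mathcal{H}$ has at least $\delta k^{2\ell} n^2$ edges, and (b) $d_{\mathcal{H}}(\sigma) \leqslant C \cdot k^{2\ell - |\sigma| - \frac{|\sigma|-1}{\ell-1}}\, n^{1-1/\ell}$ for every $\sigma \subset V(\mathcal{H})$ with $1 \leqslant |\sigma| \leqslant 2\ell - 1$.
   Context: For a hypergraph $\mathcal{H}$ and a set $\sigma$ of its vertices, $d_{\mathcal{H}}(\sigma)$ denotes the number of edges of $\mathcal{H}$ containing $\sigma$. $C_{2\ell}$ is the cycle of length $2\ell$. -}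

module Defs where

open import Data.Nat as ℕ using (ℕ; zero; suc; _∸_)
open import Data.Integer as ℤ using (ℤ; +_; -[1+_])
open import Data.Rational using (ℚ; _/_; _*_; _+_; _-_; -_; _≤_; 0ℚ; 1ℚ; ↥_; ↧ₙ_)
open import Data.Fin as Fin using (Fin; toℕ)
open import Data.Fin.Subset using (Subset; _∈_; _⊆_)
open import Data.Fin.Subset.Properties using (_⊆?_)
open import Data.List using (List; []; _∷_; _++_; map; foldr; length; lookup; filter)
open import Data.List.Relation.Unary.All using (All)
open import Data.List.Relation.Unary.Unique.Propositional using (Unique)
open import Data.Product using (Σ; _×_; _,_; proj₁; proj₂; ∃; ∃₂)
open import Data.Sum using (_⊎_)
open import Relation.Binary.PropositionalEquality using (_≡_)
open import Function.Definitions using (Injective)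

ℕ→ℚ : ℕ → ℚ
ℕ→ℚ n = + n / 1

-- p / d as a rational; only used with d ≥ 1 (the d = 0 clause is a dummy).
ratio : ℕ → ℕ → ℚ
ratio p zero    = 0ℚ
ratio p (suc d) = + p / suc d

_^ℚ_ : ℚ → ℕ → ℚ
q ^ℚ zero  = 1ℚ
q ^ℚ suc m = q * (q ^ℚ m)

prodℚ : List ℚ → ℚ
prodℚ = foldr _*_ 1ℚ

-- Comparing products of real powers with rational exponents of positive
-- rational bases, without real numbers.
--
-- A Factor (b , r) stands for the positive real b ^ r (b > 0, r ∈ ℚ).
-- PowLe xs ys  means   ∏_{(b,r) ∈ xs} b^r  ≤  ∏_{(c,s) ∈ ys} c^s.
-- It is decided by raising both sides to the power D = product of all
-- exponent denominators (x ↦ x^D is monotone on positive reals), which makes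
-- every exponent an integer, and then moving factors with negative integer
-- exponent to the other side.

Factor : Set
Factor = ℚ × ℚ

denomProd : List Factor → ℕ
denomProd fs = foldr ℕ._*_ 1 (map (λ f → ↧ₙ (proj₂ f)) fs)

-- the (integral) exponent r * D
scaledExp : ℕ → ℚ → ℤ
scaledExp D r = ↥ (r * ℕ→ℚ D)

posPart : ℤ → ℕ
posPart (+ m)    = m
posPart -[1+ m ] = 0

negPart : ℤ → ℕ
negPart (+ m)    = 0
negPart -[1+ m ] = suc m

posPow : ℕ → Factor → ℚ
posPow D (b , r) = b ^ℚ posPart (scaledExp D r)

negPow : ℕ → Factor → ℚ
negPow D (b , r) = b ^ℚ negPart (scaledExp D r)

PowLe : List Factor → List Factor → Set
PowLe xs ys =
  prodℚ (map (posPow D) xs) * prodℚ (map (negPow D) ys)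
    ≤ prodℚ (map (posPow D) ys) * prodℚ (map (negPow D) xs)
  where D = denomProd (xs ++ ys)

-- Simple graphs on vertex set Fin n, given by their edge set.
-- An edge {u,v} is stored once, as the ordered pair (u , v) with u < v.

record Graph (n : ℕ) : Set where
  field
    edges    : List (Fin n × Fin n)
    ordered  : All (λ p → proj₁ p Fin.< proj₂ p) edges
    distinct : Unique edges
open Graph public

nEdges : ∀ {n} → Graph n → ℕ
nEdges G = length (edges G)

-- the edges of G, indexed by Fin (e(G)); this index set is E(G) = V(ℋ)
edgeAt : ∀ {n} (G : Graph n) → Fin (nEdges G) → Fin n × Fin n
edgeAt G x = lookup (edges G) x

Joins : ∀ {n} → Fin n × Fin n → Fin n → Fin n → Set
Joins (a , b) u v = (a ≡ u × b ≡ v) ⊎ (a ≡ v × b ≡ u)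

CycAdj : (N : ℕ) → Fin N → Fin N → Set
CycAdj N i j = (suc (toℕ i) ≡ toℕ j) ⊎ (suc (toℕ i) ≡ N × toℕ j ≡ 0)

IsCycleCopy : ∀ {n} (G : Graph n) (N : ℕ) → Subset (nEdges G) → Set
IsCycleCopy {n} G N h =
  Σ (Fin N → Fin n) λ f →
    Injective _≡_ _≡_ f
    × (∀ i j → CycAdj N i j → ∃ λ x → Joins (edgeAt G x) (f i) (f j))
    × (∀ x → x ∈ h → ∃₂ λ i j → CycAdj N i j × Joins (edgeAt G x) (f i) (f j))
    × (∀ x i j → CycAdj N i j → Joins (edgeAt G x) (f i) (f j) → x ∈ h)

record Hypergraph (m r : ℕ) : Set where
  field
    hedges   : List (Subset m)
    hdistinct : Unique hedges
    uniform  : All (λ h → Data.Fin.Subset.∣ h ∣ ≡ r) hedges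
open Hypergraph public

nHedges : ∀ {m r} → Hypergraph m r → ℕ
nHedges H = length (hedges H)

degree : ∀ {m r} → Hypergraph m r → Subset m → ℕ
degree H σ = length (filter (σ ⊆?_) (hedges H))

-- The quantities of Theorem 1.5.
-- The density k is defined by e(G) = k n^{1+1/ℓ}, i.e. k = e · n^{-(1+1/ℓ)};
-- kPow ℓ n e a is the factor list representing k^a.

kPow : ℕ → ℕ → ℕ → ℚ → List Factor
kPow ℓ n e a = (ℕ→ℚ e , a) ∷ (ℕ→ℚ n , - ((1ℚ + ratio 1 ℓ) * a)) ∷ []

degExp : ℕ → ℕ → ℚ
degExp ℓ s = ℕ→ℚ (2 ℕ.* ℓ) - ℕ→ℚ s - ratio (s ∸ 1) (ℓ ∸ 1)

{-# OPTIONS --safe #-}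
module Submission where

-- ℋ is built greedily: as long as Λ |ℋ| ≤ D^{2ℓ}, where D ≈ k n^{1/ℓ}, another cycle is added.
-- Delete the saturated edges of G, trim to minimum degree D, and give a closed walk x₀ … x_{2ℓ-1}
-- the weight ∏ 1/d(xᵢ).  With M = d^{-1/2} A d^{-1/2}, the numbers T_m = tr M^{2m} form a log-convex
-- sequence with T_1 ≤ n/D and T_ℓ ≥ 1, hence T_m ≤ (D/S)^{2(ℓ-m)} T_ℓ for 1 ≤ m ≤ ℓ, where S is
-- given by (S/D)^{2(ℓ-1)} ≈ D/n, i.e. S²/D ≈ k^{ℓ/(ℓ-1)}.  Three kinds of closed walks are bad.
--  (1) Those visiting a vertex twice: M^i(x,x) M^{2ℓ-i}(x,x) ≤ M²(x,x) M^{2ℓ-2}(x,x) by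
--      log-convexity, so their weight is O(T_{ℓ-1}/D) = O(T_ℓ D/S²).
--  (2) Those traversing a saturated set of j edges, 2 ≤ j ≤ 2ℓ-2.  For h ∈ ℋ let K_m be the sum of
--      M^{2m}(z,z)/d(z) over the vertices z of h.  Each of the j gaps, of length a, between
--      consecutive steps inside h contributes at most (K_⌊a/2⌋ K_⌈a/2⌉)^{1/2}, and as K is
--      log-convex with K_0 = O(1/D), the gaps together contribute at most
--      O(D^{-(j-1)}) (K_⌊b/2⌋ K_⌈b/2⌉)^{1/2}, where b = 2ℓ-j.  Summed over h ∈ ℋ, K_m turns into
--      at most the maximal edge degree of ℋ times T_m.
--  (3) Those with all their vertices in some h ∈ ℋ: their weight is O(|ℋ| D^{-2ℓ}).
-- Together they weigh less than T_ℓ, so a closed walk of none of these kinds exists.  It is a cycle,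
-- and by (3) it shares at most 2ℓ-2 edges with every h ∈ ℋ.
-- To stay within ℕ, the weights 1/d(x) are multiplied by L = n!.

open import Defs

-- Trimming bounds the degrees from below only, so plain counts of closed walks through a vertex or
-- an edge are out of control in an irregular graph. With the weights 1/d the estimates on walks
-- need no upper bound on the degrees. In terms of D and S, bound (b) at |σ| = j reads d(σ) =
-- O(S^(2(ℓ-j)) D^(j-1)). This is the threshold for saturation, and at j = 1 it is the maximal edge
-- degree S^(2(ℓ-1)). Dividing the estimate for (2) by the threshold leaves O((S/D)^(j-2)) T_ℓ, so S
-- ≤ D is what has to hold, and at j = 2 nothing is to spare. At j = 2ℓ-1 bound (b) is about
-- n²/e(G), which can be as small as a constant. There the weighing of walks gives way to an
-- exclusion: no two hyperedges share 2ℓ-1 edges. This is the purpose of kind (3): a vertex of the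
-- new cycle that lies on no edge of h takes two edges of the cycle out of the overlap at once. The
-- square roots that odd gaps would bring in are avoided by bounding squares throughout.

module Counting where

  open import Data.Bool using (Bool; true; false; _∧_; _∨_; not)
  open import Data.Bool.Properties using (∨-zeroʳ)
  open import Data.Empty using (⊥)
  open import Data.Fin using (Fin; zero; suc; toℕ; fromℕ; inject₁)
  import Data.Fin as Fin
  import Data.Fin.Properties as Finₚ
  import Data.Fin.Subset
  open import Data.Fin.Subset using (Subset; _⊆_; ∣_∣)
  open import Data.Fin.Subset.Properties using (_⊆?_)
  import Data.List as List
  open import Data.List using (List; []; _∷_; map; length; allFin; concatMap; _++_; tabulate; filter; concat)
  open import Data.List.Membership.Propositional using (_∈_)
  open import Data.List.Membership.Propositional.Properties using (∈-allFin; ∈-lookup; ∈-map⁺; ∈-concatMap⁺)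
  open import Data.List.Properties using (length-tabulate)
  open import Data.List.Relation.Unary.All as All using (All; []; _∷_)
  open import Data.List.Relation.Unary.AllPairs using ([]; _∷_)
  open import Data.List.Relation.Unary.Any as Any using (here; there)
  open import Data.List.Relation.Unary.Unique.Propositional using (Unique)
  open import Data.Nat
  open import Data.Nat.DivMod using (m/n*n≡m; m/n*n≤m; m≡m%n+[m/n]*n; m%n<n)
  open import Data.Nat.Divisibility using (m≤n⇒m!∣n!; ∣-trans; m∣m*n)
  open import Data.Nat.Properties
  open import Data.Nat.Tactic.RingSolver using (solve-∀)
  open import Data.Product using (_×_; _,_; proj₁; proj₂; ∃₂; ∃-syntax)
  open import Data.Sum using (_⊎_; inj₁; inj₂)
  open import Data.Vec as Vec using (Vec; []; _∷_; toList; lookup)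
  open import Data.Vec.Properties using ([]=⇒lookup; lookup⇒[]=; lookup∘tabulate)
  open import Function using (_∘_; id)
  open import Function.Definitions using (Injective)
  open import Relation.Binary.PropositionalEquality hiding (J)
  open import Relation.Nullary using (¬_; Dec; yes; no; contradiction; does)
  open import Relation.Nullary.Decidable using (dec-true; _×-dec_)

  private variable
    Ix Iy : Set

  -- Finite sums of natural numbers and the Cauchy-Schwarz inequality

  sq-cancel-≤ : ∀ {a b} → a * a ≤ b * b → a ≤ b
  sq-cancel-≤ {a} {b} h with a ≤? b
  ... | yes p = p
  ... | no ¬p = contradiction h (<⇒≱ (*-mono-< (≰⇒> ¬p) (≰⇒> ¬p)))

  -- AM-GM without subtraction: when the larger number is the smaller one plus `c`, the defect is
  -- `c * c`.
  four-mul-le : ∀ a b → 4 * (a * b) ≤ (a + b) * (a + b)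
  four-mul-le a b with ≤-total a b
  ... | inj₁ h = subst (λ u → 4 * (a * u) ≤ (a + u) * (a + u)) (m+[n∸m]≡n h)
                   (subst (4 * (a * (a + (b ∸ a))) ≤_) (lem a (b ∸ a)) (m≤m+n _ ((b ∸ a) * (b ∸ a))))
    where lem : ∀ a c → 4 * (a * (a + c)) + c * c ≡ (a + (a + c)) * (a + (a + c))
          lem = solve-∀
  ... | inj₂ h = subst (λ u → 4 * (u * b) ≤ (u + b) * (u + b)) (m+[n∸m]≡n h)
                   (subst (4 * ((b + (a ∸ b)) * b) ≤_) (lem b (a ∸ b)) (m≤m+n _ ((a ∸ b) * (a ∸ b))))
    where lem : ∀ b c → 4 * ((b + c) * b) + c * c ≡ ((b + c) + b) * ((b + c) + b)
          lem = solve-∀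

  ∑ : List Ix → (Ix → ℕ) → ℕ
  ∑ []       f = 0
  ∑ (x ∷ xs) f = f x + ∑ xs f

  ∑-cong : ∀ (xs : List Ix) {f g : Ix → ℕ} → (∀ x → f x ≡ g x) → ∑ xs f ≡ ∑ xs g
  ∑-cong []       h = refl
  ∑-cong (x ∷ xs) h = cong₂ _+_ (h x) (∑-cong xs h)

  ∑-mono-∈ : ∀ (xs : List Ix) {f g : Ix → ℕ} → (∀ x → x ∈ xs → f x ≤ g x) → ∑ xs f ≤ ∑ xs g
  ∑-mono-∈ []       h = z≤n
  ∑-mono-∈ (x ∷ xs) h = +-mono-≤ (h x (here refl)) (∑-mono-∈ xs (λ y m → h y (there m)))

  ∑-mono : ∀ (xs : List Ix) {f g : Ix → ℕ} → (∀ x → f x ≤ g x) → ∑ xs f ≤ ∑ xs g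
  ∑-mono xs h = ∑-mono-∈ xs (λ x _ → h x)

  ∑-zero : ∀ (xs : List Ix) → ∑ xs (λ _ → 0) ≡ 0
  ∑-zero []       = refl
  ∑-zero (_ ∷ xs) = ∑-zero xs

  ∑-const : ∀ (xs : List Ix) c → ∑ xs (λ _ → c) ≡ length xs * c
  ∑-const []       c = refl
  ∑-const (_ ∷ xs) c = cong (c +_) (∑-const xs c)

  ∑-+ : ∀ (xs : List Ix) (f g : Ix → ℕ) → ∑ xs (λ x → f x + g x) ≡ ∑ xs f + ∑ xs g
  ∑-+ []       f g = refl
  ∑-+ (x ∷ xs) f g = trans (cong (f x + g x +_) (∑-+ xs f g)) (lem (f x) (g x) (∑ xs f) (∑ xs g))
    where lem : ∀ a b c d → a + b + (c + d) ≡ a + c + (b + d)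
          lem = solve-∀

  ∑-*ˡ : ∀ (xs : List Ix) c (f : Ix → ℕ) → ∑ xs (λ x → c * f x) ≡ c * ∑ xs f
  ∑-*ˡ []       c f = sym (*-zeroʳ c)
  ∑-*ˡ (x ∷ xs) c f = trans (cong (c * f x +_) (∑-*ˡ xs c f)) (sym (*-distribˡ-+ c (f x) (∑ xs f)))

  ∑-*ʳ : ∀ (xs : List Ix) c (f : Ix → ℕ) → ∑ xs (λ x → f x * c) ≡ ∑ xs f * c
  ∑-*ʳ xs c f = trans (∑-cong xs (λ x → *-comm (f x) c)) (trans (∑-*ˡ xs c f) (*-comm c _))

  ∑-swap : ∀ (xs : List Ix) (ys : List Iy) (f : Ix → Iy → ℕ) →
    ∑ xs (λ x → ∑ ys (f x)) ≡ ∑ ys (λ y → ∑ xs (λ x → f x y))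
  ∑-swap []       ys f = sym (∑-zero ys)
  ∑-swap (x ∷ xs) ys f = trans (cong (∑ ys (f x) +_) (∑-swap xs ys f)) (sym (∑-+ ys (f x) _))

  ∑-++ : ∀ (xs ys : List Ix) (f : Ix → ℕ) → ∑ (xs ++ ys) f ≡ ∑ xs f + ∑ ys f
  ∑-++ []       ys f = refl
  ∑-++ (x ∷ xs) ys f = trans (cong (f x +_) (∑-++ xs ys f)) (sym (+-assoc (f x) _ _))

  ∑-map : ∀ (g : Ix → Iy) (xs : List Ix) (f : Iy → ℕ) → ∑ (map g xs) f ≡ ∑ xs (f ∘ g)
  ∑-map g []       f = refl
  ∑-map g (x ∷ xs) f = cong (f (g x) +_) (∑-map g xs f)

  ∑-concatMap : ∀ (g : Ix → List Iy) (xs : List Ix) (f : Iy → ℕ) →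
    ∑ (concatMap g xs) f ≡ ∑ xs (λ x → ∑ (g x) f)
  ∑-concatMap g []       f = refl
  ∑-concatMap g (x ∷ xs) f =
    trans (∑-++ (g x) (concat (map g xs)) f) (cong (∑ (g x) f +_) (∑-concatMap g xs f))

  term≤∑ : ∀ {xs : List Ix} {x} (f : Ix → ℕ) → x ∈ xs → f x ≤ ∑ xs f
  term≤∑ f (here refl) = m≤m+n _ _
  term≤∑ {xs = y ∷ _} f (there m) = ≤-trans (term≤∑ f m) (m≤n+m _ (f y))

  ∑-<⇒∃ : ∀ (xs : List Ix) (f g : Ix → ℕ) → ∑ xs f < ∑ xs g → ∃[ x ] (x ∈ xs × f x < g x)
  ∑-<⇒∃ (x ∷ xs) f g h with f x <? g x
  ... | yes p = x , here refl , p
  ... | no ¬p with ∑-<⇒∃ xs f g (+-cancelˡ-< (f x) _ _ (<-≤-trans h (+-monoˡ-≤ _ (≮⇒≥ ¬p))))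
  ...   | y , m , q = y , there m , q

  ∑->0⇒∃ : ∀ (xs : List Ix) (f : Ix → ℕ) → 0 < ∑ xs f → ∃[ x ] (x ∈ xs × 0 < f x)
  ∑->0⇒∃ xs f h = ∑-<⇒∃ xs (λ _ → 0) f (subst (_< ∑ xs f) (sym (∑-zero xs)) h)

  -- Here `c` plays the part of √(ab); asking only for `c x * c x ≤ a x * b x` keeps roots out of ℕ
  -- and admits termwise upper bounds. In the induction the cross term `2 * (p * P)` is squared and
  -- compared by AM-GM with `q * R + Q * r`.
  cauchy-schwarz-∈ : ∀ (xs : List Ix) (a b c : Ix → ℕ) → (∀ x → x ∈ xs → c x * c x ≤ a x * b x) →
    ∑ xs c * ∑ xs c ≤ ∑ xs a * ∑ xs b
  cauchy-schwarz-∈ []       a b c h = z≤n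
  cauchy-schwarz-∈ (x ∷ xs) a b c h = begin
    (p + P) * (p + P) ≡⟨ lem₁ p P ⟩
    p * p + P * P + 2 * (p * P) ≤⟨ +-mono-≤ (+-mono-≤ (h x (here refl)) IH) cross ⟩
    q * r + Q * R + (q * R + Q * r) ≡⟨ lem₂ q r Q R ⟩
    (q + Q) * (r + R) ∎
    where
    open ≤-Reasoning
    p = c x ; P = ∑ xs c ; q = a x ; Q = ∑ xs a ; r = b x ; R = ∑ xs b
    IH : P * P ≤ Q * R
    IH = cauchy-schwarz-∈ xs a b c (λ y m → h y (there m))
    lem₁ : ∀ p P → (p + P) * (p + P) ≡ p * p + P * P + 2 * (p * P)
    lem₁ = solve-∀
    lem₂ : ∀ q r Q R → q * r + Q * R + (q * R + Q * r) ≡ (q + Q) * (r + R)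
    lem₂ = solve-∀
    lem₃ : ∀ p P → 2 * (p * P) * (2 * (p * P)) ≡ 4 * (p * p * (P * P))
    lem₃ = solve-∀
    lem₄ : ∀ q r Q R → 4 * (q * r * (Q * R)) ≡ 4 * (q * R * (Q * r))
    lem₄ = solve-∀
    cross : 2 * (p * P) ≤ q * R + Q * r
    cross = sq-cancel-≤ (begin
      2 * (p * P) * (2 * (p * P)) ≡⟨ lem₃ p P ⟩
      4 * (p * p * (P * P)) ≤⟨ *-monoʳ-≤ 4 (*-mono-≤ (h x (here refl)) IH) ⟩
      4 * (q * r * (Q * R)) ≡⟨ lem₄ q r Q R ⟩
      4 * (q * R * (Q * r)) ≤⟨ four-mul-le (q * R) (Q * r) ⟩
      (q * R + Q * r) * (q * R + Q * r) ∎)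

  cauchy-schwarz : ∀ (xs : List Ix) (a b c : Ix → ℕ) → (∀ x → c x * c x ≤ a x * b x) →
    ∑ xs c * ∑ xs c ≤ ∑ xs a * ∑ xs b
  cauchy-schwarz xs a b c h = cauchy-schwarz-∈ xs a b c (λ x _ → h x)

  cauchy-schwarz′ : ∀ (xs : List Ix) (e f g : Ix → ℕ) →
    ∑ xs (λ x → e x * (f x * g x)) * ∑ xs (λ x → e x * (f x * g x))
      ≤ ∑ xs (λ x → e x * (f x * f x)) * ∑ xs (λ x → e x * (g x * g x))
  cauchy-schwarz′ xs e f g =
    cauchy-schwarz xs _ _ _ (λ x → ≤-reflexive (lem (e x) (f x) (g x)))
    where lem : ∀ e f g → e * (f * g) * (e * (f * g)) ≡ e * (f * f) * (e * (g * g))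
          lem = solve-∀

  ⟦_⟧ : Bool → ℕ
  ⟦ true ⟧  = 1
  ⟦ false ⟧ = 0

  ⟦⟧≤1 : ∀ b → ⟦ b ⟧ ≤ 1
  ⟦⟧≤1 true  = ≤-refl
  ⟦⟧≤1 false = z≤n

  -- Sums over Fin n.

  ∑F : ∀ {n} → (Fin n → ℕ) → ℕ
  ∑F {n} = ∑ (allFin n)

  length-allFin : ∀ n → length (allFin n) ≡ n
  length-allFin n = length-tabulate {n = n} id

  δ : ∀ {n} → Fin n → Fin n → ℕ
  δ x y = ⟦ does (x Finₚ.≟ y) ⟧

  δ-refl : ∀ {n} (x : Fin n) → δ x x ≡ 1
  δ-refl x with x Finₚ.≟ x
  ... | yes _ = refl
  ... | no ¬p = contradiction refl ¬p

  δ-≢ : ∀ {n} {x y : Fin n} → x ≢ y → δ x y ≡ 0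
  δ-≢ {x = x} {y} h with x Finₚ.≟ y
  ... | yes p = contradiction p h
  ... | no _ = refl

  δ-sym : ∀ {n} (x y : Fin n) → δ x y ≡ δ y x
  δ-sym x y with x Finₚ.≟ y
  ... | yes refl = sym (δ-refl x)
  ... | no ¬p = sym (δ-≢ (¬p ∘ sym))

  δ-* : ∀ {n} (f : Fin n → ℕ) (x y : Fin n) → δ x y * f y ≡ δ x y * f x
  δ-* f x y with x Finₚ.≟ y
  ... | yes refl = refl
  ... | no _ = refl

  ∑-tabulate : ∀ {n} (g : Fin n → Ix) (f : Ix → ℕ) → ∑ (tabulate g) f ≡ ∑F (f ∘ g)
  ∑-tabulate {n = zero}  g f = refl
  ∑-tabulate {n = suc n} g f = cong (f (g zero) +_)
    (trans (∑-tabulate (g ∘ suc) f) (sym (∑-tabulate suc (f ∘ g))))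

  ∑F-suc : ∀ {n} (f : Fin (suc n) → ℕ) → ∑F f ≡ f zero + ∑F (f ∘ suc)
  ∑F-suc f = cong (f zero +_) (∑-tabulate suc f)

  ∑F-δ : ∀ {n} (x : Fin n) → ∑F (δ x) ≡ 1
  ∑F-δ {suc n} zero = trans (∑F-suc {n} (δ zero)) (cong suc
    (trans (∑-cong (allFin n) (λ y → δ-≢ {x = zero} {suc y} (λ ()))) (∑-zero (allFin n))))
  ∑F-δ {suc n} (suc x) = trans (∑F-suc {n} (δ (suc x))) (trans (cong₂ _+_ (δ-≢ {x = suc x} {zero} (λ ()))
    (∑-cong (allFin n) (λ y → refl))) (∑F-δ x))

  ∑F-δ* : ∀ {n} (x : Fin n) (f : Fin n → ℕ) → ∑F (λ y → δ x y * f y) ≡ f x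
  ∑F-δ* {n} x f = trans (∑-cong (allFin n) (δ-* f x))
    (trans (∑-*ʳ (allFin n) (f x) (δ x)) (trans (cong (_* f x) (∑F-δ x)) (*-identityˡ (f x))))

  ∑F-*δ : ∀ {n} (x : Fin n) (f : Fin n → ℕ) → ∑F (λ y → f y * δ y x) ≡ f x
  ∑F-*δ {n} x f = trans (∑-cong (allFin n) (λ y → trans (*-comm (f y) _) (cong (_* f y) (δ-sym y x)))) (∑F-δ* x f)

  term≤∑F : ∀ {n} (f : Fin n → ℕ) x → f x ≤ ∑F f
  term≤∑F f x = term≤∑ f (∈-allFin x)

  -- Log-convex sequences.

  LogConvex : (ℕ → ℕ) → Set
  LogConvex K = ∀ m → K (suc m) * K (suc m) ≤ K m * K (suc (suc m))

  log-convex-shift : ∀ K → LogConvex K → ∀ c → LogConvex (λ m → K (c + m))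
  log-convex-shift K h c m = subst₂ (λ a b → K a * K a ≤ K (c + m) * K b)
    (sym (+-suc c m)) (sym (trans (+-suc c (suc m)) (cong suc (+-suc c m)))) (h (c + m))

  -- The quotients `K (suc i) / K i` do not decrease, stated by cross-multiplication because `K` may
  -- vanish. A zero of `K` at the place to be cancelled makes the left side zero.
  log-convex-ratio : ∀ K → LogConvex K → ∀ i k → K (suc i) * K (k + i) ≤ K i * K (suc (k + i))
  log-convex-ratio K h i zero = ≤-reflexive (*-comm (K (suc i)) (K i))
  log-convex-ratio K h i (suc k) with K (suc (k + i)) in eq
  ... | zero = ≤-trans (≤-reflexive (*-zeroʳ (K (suc i)))) z≤n
  ... | suc z = *-cancelʳ-≤ _ _ (suc z) (begin
      K (suc i) * suc z * suc z ≡⟨ *-assoc (K (suc i)) _ _ ⟩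
      K (suc i) * (suc z * suc z) ≤⟨ *-monoʳ-≤ (K (suc i)) (subst (λ u → u * u ≤ K (k + i) * K (suc (suc (k + i)))) eq (h (k + i))) ⟩
      K (suc i) * (K (k + i) * K (suc (suc (k + i)))) ≡⟨ sym (*-assoc (K (suc i)) _ _) ⟩
      K (suc i) * K (k + i) * K (suc (suc (k + i))) ≤⟨ *-monoˡ-≤ (K (suc (suc (k + i)))) (log-convex-ratio K h i k) ⟩
      K i * K (suc (k + i)) * K (suc (suc (k + i))) ≡⟨ cong (λ u → K i * u * K (suc (suc (k + i)))) eq ⟩
      K i * suc z * K (suc (suc (k + i))) ≡⟨ lem (K i) (suc z) _ ⟩
      K i * K (suc (suc (k + i))) * suc z ∎)
    where
    open ≤-Reasoning
    lem : ∀ a b c → a * b * c ≡ a * c * b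
    lem = solve-∀

  private
    -- Each use of the ratio inequality moves the two arguments one step further apart with their
    -- sum kept, until the smaller one reaches 0.
    log-convex-mul-≤ : ∀ K → LogConvex K → ∀ a k → K a * K (k + a) ≤ K 0 * K (a + (k + a))
    log-convex-mul-≤ K h zero k = ≤-refl
    log-convex-mul-≤ K h (suc a) k = begin
      K (suc a) * K (k + suc a) ≡⟨ cong (λ u → K (suc a) * K u) (+-suc k a) ⟩
      K (suc a) * K (suc k + a) ≤⟨ log-convex-ratio K h a (suc k) ⟩
      K a * K (suc (suc k) + a) ≤⟨ log-convex-mul-≤ K h a (suc (suc k)) ⟩
      K 0 * K (a + (suc (suc k) + a)) ≡⟨ cong (λ u → K 0 * K u) (lem a k) ⟩
      K 0 * K (suc a + (k + suc a)) ∎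
      where
      open ≤-Reasoning
      lem : ∀ a k → a + (suc (suc k) + a) ≡ suc a + (k + suc a)
      lem = solve-∀

  log-convex-mul : ∀ K → LogConvex K → ∀ a b → K a * K b ≤ K 0 * K (a + b)
  log-convex-mul K h a b with ≤-total a b
  ... | inj₁ p = subst (λ u → K a * K u ≤ K 0 * K (a + u)) (m∸n+n≡m p) (log-convex-mul-≤ K h a (b ∸ a))
  ... | inj₂ p = subst₂ _≤_ (*-comm (K b) (K a)) (cong (λ u → K 0 * K u) (+-comm b a))
      (subst (λ u → K b * K u ≤ K 0 * K (b + u)) (m∸n+n≡m p) (log-convex-mul-≤ K h b (a ∸ b)))

  -- The square of the value of K at the half-integer a/2, interpolated geometrically.
  halved : (ℕ → ℕ) → ℕ → ℕ
  halved K a = K ⌊ a /2⌋ * K ⌈ a /2⌉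

  -- At an odd middle index the inequality is an equality, at an even one it is the log-convexity of
  -- `K`. The recursion goes by two because `halved K (2 + a)` is `halved (K ∘ suc) a` by
  -- definition.
  halved-log-convex : ∀ K → LogConvex K → LogConvex (halved K)
  halved-log-convex K h zero = ≤-reflexive (lem (K 0) (K 1))
    where lem : ∀ a b → a * b * (a * b) ≡ a * a * (b * b)
          lem = solve-∀
  halved-log-convex K h (suc zero) = begin
    K 1 * K 1 * (K 1 * K 1) ≤⟨ *-monoˡ-≤ (K 1 * K 1) (h 0) ⟩
    K 0 * K 2 * (K 1 * K 1) ≡⟨ lem (K 0) (K 1) (K 2) ⟩
    K 0 * K 1 * (K 1 * K 2) ∎
    where open ≤-Reasoning
          lem : ∀ a b c → a * c * (b * b) ≡ a * b * (b * c)
          lem = solve-∀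
  halved-log-convex K h (suc (suc m)) = halved-log-convex (K ∘ suc) (h ∘ suc) m

  module _ (T : ℕ → ℕ) (p q : ℕ) (h : LogConvex T) (pos : ∀ m → 0 < T m) where
    open ≤-Reasoning

    private
      lem : ∀ a b c → a * b * c ≡ a * c * b
      lem = solve-∀
      lem₂ : ∀ a b c → a * (b * c) ≡ a * c * b
      lem₂ = solve-∀

    -- Growth by a factor of at least p/q, once reached, persists, because the quotients of a
    -- log-convex sequence do not decrease.
    log-convex-push : ∀ m → T m * p ≤ T (suc m) * q → T (suc m) * p ≤ T (suc (suc m)) * q
    log-convex-push m base = *-cancelˡ-≤ (T (suc m)) {{>-nonZero (pos (suc m))}} (begin
      T (suc m) * (T (suc m) * p) ≡⟨ sym (*-assoc (T (suc m)) _ p) ⟩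
      T (suc m) * T (suc m) * p ≤⟨ *-monoˡ-≤ p (h m) ⟩
      T m * T (suc (suc m)) * p ≡⟨ lem (T m) _ p ⟩
      T m * p * T (suc (suc m)) ≤⟨ *-monoˡ-≤ (T (suc (suc m))) base ⟩
      T (suc m) * q * T (suc (suc m)) ≡⟨ *-assoc (T (suc m)) q _ ⟩
      T (suc m) * (q * T (suc (suc m))) ≡⟨ cong (T (suc m) *_) (*-comm q _) ⟩
      T (suc m) * (T (suc (suc m)) * q) ∎)

    log-convex-chain : ∀ m k → T m * p ≤ T (suc m) * q → T m * p ^ k ≤ T (k + m) * q ^ k
    log-convex-chain m zero base = ≤-refl
    log-convex-chain m (suc k) base = begin
      T m * (p * p ^ k) ≡⟨ sym (*-assoc (T m) p _) ⟩
      T m * p * p ^ k ≤⟨ *-monoˡ-≤ (p ^ k) base ⟩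
      T (suc m) * q * p ^ k ≡⟨ lem (T (suc m)) q (p ^ k) ⟩
      T (suc m) * p ^ k * q ≤⟨ *-monoˡ-≤ q (log-convex-chain (suc m) k (log-convex-push m base)) ⟩
      T (k + suc m) * q ^ k * q ≡⟨ sym (lem₂ (T (k + suc m)) q (q ^ k)) ⟩
      T (k + suc m) * (q * q ^ k) ≡⟨ cong (λ u → T u * (q * q ^ k)) (+-suc k m) ⟩
      T (suc k + m) * (q * q ^ k) ∎

    -- If T_m p > T_{m+1} q then T_i p > T_{i+1} q for all i < m; otherwise T_i p ≤ T_{i+1} q for all i ≥ m.
    log-convex-interpolate : 0 < q → ∀ m k →
      T 0 * p ^ (k + m) ≤ T (k + m) * q ^ (k + m) → T m * p ^ k ≤ T (k + m) * q ^ k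
    log-convex-interpolate 0<q zero k base =
      subst (λ u → T 0 * p ^ u ≤ T (k + 0) * q ^ u) (+-identityʳ k) base
    log-convex-interpolate 0<q (suc m) k base with T (suc m) * p ≤? T (suc (suc m)) * q
    ... | yes up = log-convex-chain (suc m) k up
    ... | no ¬up = *-cancelʳ-≤ _ _ q {{>-nonZero 0<q}} (begin
        T (suc m) * p ^ k * q ≡⟨ lem (T (suc m)) (p ^ k) q ⟩
        T (suc m) * q * p ^ k ≤⟨ *-monoˡ-≤ (p ^ k) (≰⇒≥ (¬up ∘ log-convex-push m)) ⟩
        T m * p * p ^ k ≡⟨ *-assoc (T m) p _ ⟩
        T m * p ^ suc k ≤⟨ log-convex-interpolate 0<q m (suc k) (subst (λ u → T 0 * p ^ u ≤ T u * q ^ u) (+-suc k m) base) ⟩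
        T (suc k + m) * q ^ suc k ≡⟨ lem₂ (T (suc k + m)) q (q ^ k) ⟩
        T (suc k + m) * q ^ k * q ≡⟨ cong (λ u → T u * q ^ k * q) (sym (+-suc k m)) ⟩
        T (k + suc m) * q ^ k * q ∎)

  -- Vectors, powers and masks

  vecs : List Ix → ∀ m → List (Vec Ix m)
  vecs xs zero    = [] ∷ []
  vecs xs (suc m) = concatMap (λ x → map (x ∷_) (vecs xs m)) xs

  ∑-vecs : ∀ (xs : List Ix) m (f : Vec Ix (suc m) → ℕ) →
    ∑ (vecs xs (suc m)) f ≡ ∑ xs (λ x → ∑ (vecs xs m) (λ v → f (x ∷ v)))
  ∑-vecs xs m f = trans (∑-concatMap _ xs f) (∑-cong xs (λ x → ∑-map (x ∷_) (vecs xs m) f))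

  ∈-vecs : ∀ (xs : List Ix) → (∀ x → x ∈ xs) → ∀ {m} (v : Vec Ix m) → v ∈ vecs xs m
  ∈-vecs xs h []      = here refl
  ∈-vecs xs h (x ∷ v) = ∈-concatMap⁺ (λ y → map (y ∷_) (vecs xs _))
    (Any.map (λ {refl → ∈-map⁺ (x ∷_) (∈-vecs xs h v)}) (h x))

  -- A weighted average of `f` is at most the bound √τ for `f` on the support of `b`; both sides are
  -- squared since `τ` need not be a square.
  weighted-square : ∀ (xs : List Ix) (b f : Ix → ℕ) τ → (∀ x → 0 < b x → f x * f x ≤ τ) →
    ∑ xs (λ x → b x * f x) * ∑ xs (λ x → b x * f x) ≤ ∑ xs b * ∑ xs b * τ
  weighted-square xs b f τ h = ≤-trans
    (cauchy-schwarz xs b (λ x → b x * τ) _ bound)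
    (≤-reflexive (trans (cong (∑ xs b *_) (∑-*ʳ xs τ b)) (sym (*-assoc (∑ xs b) _ _))))
    where
    lem : ∀ b f → b * f * (b * f) ≡ b * (b * (f * f))
    lem = solve-∀
    bound : ∀ x → b x * f x * (b x * f x) ≤ b x * (b x * τ)
    bound x with b x in eq
    ... | zero = z≤n
    ... | suc k = ≤-trans (≤-reflexive (lem (suc k) (f x)))
      (*-monoʳ-≤ (suc k) (*-monoʳ-≤ (suc k) (h x (subst (0 <_) (sym eq) z<s))))

  ^-*-distrib : ∀ a b k → (a * b) ^ k ≡ a ^ k * b ^ k
  ^-*-distrib a b zero = refl
  ^-*-distrib a b (suc k) = trans (cong (a * b *_) (^-*-distrib a b k)) (lem a b (a ^ k) (b ^ k))
    where lem : ∀ a b c d → a * b * (c * d) ≡ a * c * (b * d)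
          lem = solve-∀

  trues falses : List Bool → ℕ
  trues []          = 0
  trues (true ∷ p)  = suc (trues p)
  trues (false ∷ p) = trues p
  falses []          = 0
  falses (true ∷ p)  = falses p
  falses (false ∷ p) = suc (falses p)

  trues-pad : ∀ p a → trues (p ++ List.replicate a false) ≡ trues p
  trues-pad []          zero    = refl
  trues-pad []          (suc a) = trues-pad [] a
  trues-pad (true ∷ p)  a       = cong suc (trues-pad p a)
  trues-pad (false ∷ p) a       = trues-pad p a

  falses-pad : ∀ p a → falses (p ++ List.replicate a false) ≡ falses p + a
  falses-pad []          zero    = refl
  falses-pad []          (suc a) = cong suc (falses-pad [] a)
  falses-pad (true ∷ p)  a       = falses-pad p a
  falses-pad (false ∷ p) a       = cong suc (falses-pad p a)

  -- Q a x y is the total weight of the walks of length a from x to y, a walk being weighted by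
  -- the product of w over all its a + 1 vertices.  As w ≈ L / d, this is L ^ (a + 1) times the
  -- kernel of the a-th power of the simple random walk, divided by the degree of y.
  module Walks {n : ℕ} (A : Fin n → Fin n → ℕ) (A-sym : ∀ x y → A x y ≡ A y x)
    (A-irrefl : ∀ x → A x x ≡ 0) (A≤1 : ∀ x y → A x y ≤ 1) (w : Fin n → ℕ) (L D : ℕ) (0<L : 0 < L) (0<D : 0 < D)
    (w-deg : ∀ x → (w x * ∑F (A x) ≡ L) ⊎ (w x ≡ 0 × ∑F (A x) ≡ 0))
    (w*D≤L : ∀ x → w x * D ≤ L) where

    private
      V = Fin n
      vs = allFin n

    instance
      L≢0 : NonZero L
      L≢0 = >-nonZero 0<L
      D≢0 : NonZero D
      D≢0 = >-nonZero 0<D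

    -- The kernel `Q` as a symmetric form

    d : V → ℕ
    d x = ∑F (A x)

    Q : ℕ → V → V → ℕ
    Q zero    x y = δ x y * w y
    Q (suc a) x y = ∑F (λ z → Q a x z * A z y) * w y

    w*d≤L : ∀ x → w x * d x ≤ L
    w*d≤L x with w-deg x
    ... | inj₁ h = ≤-reflexive h
    ... | inj₂ (h , _) rewrite h = z≤n

    -- `w x * d x ≡ L` fails at isolated vertices. After multiplication by `w x`, or by `d x` as in
    -- the next lemma, it holds at all vertices.
    w*d*w : ∀ x → w x * d x * w x ≡ L * w x
    w*d*w x with w-deg x
    ... | inj₁ h = cong (_* w x) h
    ... | inj₂ (h , _) rewrite h = sym (*-zeroʳ L)

    d*w*d : ∀ x → d x * (w x * d x) ≡ d x * L
    d*w*d x with w-deg x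
    ... | inj₁ h = cong (d x *_) h
    ... | inj₂ (_ , h) rewrite h = refl

    d≡0⇒A≡0 : ∀ x y → d y ≡ 0 → A x y ≡ 0
    d≡0⇒A≡0 x y h = n≤0⇒n≡0 (subst₂ _≤_ (A-sym y x) h (term≤∑F (A y) x))

    -- Every `Q a x y` carries the factor `w y` of its last vertex, and to this factor `w*d*w`
    -- applies.
    Q-absorb : ∀ a x y → d y * (Q a x y * w y) ≡ L * Q a x y
    Q-absorb a x y = trans (cong (d y *_) (cong (_* w y) (form a)))
      (trans (lem (d y) (w y) (coef a)) (trans (cong (coef a *_) (w*d*w y))
        (trans (lem₂ (coef a) L (w y)) (cong (L *_) (sym (form a))))))
      where
      coef : ℕ → ℕ
      coef zero    = δ x y
      coef (suc a) = ∑F (λ z → Q a x z * A z y)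
      form : ∀ a → Q a x y ≡ coef a * w y
      form zero    = refl
      form (suc a) = refl
      lem : ∀ d w c → d * (c * w * w) ≡ c * (w * d * w)
      lem = solve-∀
      lem₂ : ∀ c l w → c * (l * w) ≡ l * (c * w)
      lem₂ = solve-∀

    -- Both walks weight the vertex `z` at which they are joined; the factor `d z` trades the second
    -- weight for `L`.
    Q-compose : ∀ a b x y → ∑F (λ z → d z * (Q a x z * Q b z y)) ≡ L * Q (a + b) x y
    Q-compose a zero x y = begin
      ∑F (λ z → d z * (Q a x z * (δ z y * w y))) ≡⟨ ∑-cong vs (λ z → lem (d z) (Q a x z) (δ z y) (w y)) ⟩
      ∑F (λ z → d z * (Q a x z * w y) * δ z y) ≡⟨ ∑F-*δ y (λ z → d z * (Q a x z * w y)) ⟩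
      d y * (Q a x y * w y) ≡⟨ Q-absorb a x y ⟩
      L * Q a x y ≡⟨ cong (λ u → L * Q u x y) (sym (+-identityʳ a)) ⟩
      L * Q (a + 0) x y ∎
      where
      open ≡-Reasoning
      lem : ∀ d q e w → d * (q * (e * w)) ≡ d * (q * w) * e
      lem = solve-∀
    Q-compose a (suc b) x y = begin
      ∑F (λ z → d z * (Q a x z * (∑F (λ u → Q b z u * A u y) * w y)))
        ≡⟨ ∑-cong vs (λ z → trans (lem (d z) (Q a x z) _ (w y)) (cong (_* w y)
             (trans (sym (∑-*ˡ vs (d z * Q a x z) _)) (∑-cong vs (λ u → lem₂ (d z) (Q a x z) (Q b z u) (A u y)))))) ⟩
      ∑F (λ z → ∑F (λ u → d z * (Q a x z * Q b z u) * A u y) * w y)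
        ≡⟨ ∑-*ʳ vs (w y) _ ⟩
      ∑F (λ z → ∑F (λ u → d z * (Q a x z * Q b z u) * A u y)) * w y
        ≡⟨ cong (_* w y) (∑-swap vs vs _) ⟩
      ∑F (λ u → ∑F (λ z → d z * (Q a x z * Q b z u) * A u y)) * w y
        ≡⟨ cong (_* w y) (∑-cong vs (λ u → trans (∑-*ʳ vs (A u y) _) (cong (_* A u y) (Q-compose a b x u)))) ⟩
      ∑F (λ u → L * Q (a + b) x u * A u y) * w y
        ≡⟨ cong (_* w y) (trans (∑-cong vs (λ u → *-assoc L _ _)) (∑-*ˡ vs L _)) ⟩
      L * ∑F (λ u → Q (a + b) x u * A u y) * w y
        ≡⟨ *-assoc L _ _ ⟩
      L * Q (suc (a + b)) x y
        ≡⟨ cong (λ u → L * Q u x y) (sym (+-suc a b)) ⟩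
      L * Q (a + suc b) x y ∎
      where
      open ≡-Reasoning
      lem : ∀ d q s w → d * (q * (s * w)) ≡ d * q * s * w
      lem = solve-∀
      lem₂ : ∀ d q r a → d * q * (r * a) ≡ d * (q * r) * a
      lem₂ = solve-∀

    Q-left : ∀ a x y → Q (suc a) x y ≡ w x * ∑F (λ z → A x z * Q a z y)
    Q-left zero x y = begin
      ∑F (λ z → δ x z * w z * A z y) * w y ≡⟨ cong (_* w y) (trans (∑-cong vs (λ z → *-assoc (δ x z) _ _)) (∑F-δ* x (λ z → w z * A z y))) ⟩
      w x * A x y * w y ≡⟨ *-assoc (w x) _ _ ⟩
      w x * (A x y * w y) ≡⟨ cong (w x *_) (sym (trans (∑-cong vs (λ z → lem (A x z) (δ z y) (w y))) (∑F-*δ y (λ z → A x z * w y)))) ⟩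
      w x * ∑F (λ z → A x z * (δ z y * w y)) ∎
      where
      open ≡-Reasoning
      lem : ∀ a e w → a * (e * w) ≡ a * w * e
      lem = solve-∀
    Q-left (suc a) x y = begin
      ∑F (λ z → Q (suc a) x z * A z y) * w y
        ≡⟨ cong (_* w y) (∑-cong vs (λ z → cong (_* A z y) (Q-left a x z))) ⟩
      ∑F (λ z → w x * ∑F (λ u → A x u * Q a u z) * A z y) * w y
        ≡⟨ cong (_* w y) (trans (∑-cong vs (λ z → trans (*-assoc (w x) _ _) (cong (w x *_)
             (trans (sym (∑-*ʳ vs (A z y) _)) (∑-cong vs (λ u → *-assoc (A x u) _ _)))))) (∑-*ˡ vs (w x) _)) ⟩
      w x * ∑F (λ z → ∑F (λ u → A x u * (Q a u z * A z y))) * w y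
        ≡⟨ *-assoc (w x) _ _ ⟩
      w x * (∑F (λ z → ∑F (λ u → A x u * (Q a u z * A z y))) * w y)
        ≡⟨ cong (λ s → w x * (s * w y)) (trans (∑-swap vs vs _) (∑-cong vs (λ u → ∑-*ˡ vs (A x u) _))) ⟩
      w x * (∑F (λ u → A x u * ∑F (λ z → Q a u z * A z y)) * w y)
        ≡⟨ cong (w x *_) (trans (sym (∑-*ʳ vs (w y) _)) (∑-cong vs (λ u → *-assoc (A x u) _ _))) ⟩
      w x * ∑F (λ u → A x u * Q (suc a) u y) ∎
      where open ≡-Reasoning

    -- Weighting all `a + 1` vertices, both ends included, is what makes the kernel symmetric,
    -- unlike the transition probabilities themselves.
    Q-sym : ∀ a x y → Q a x y ≡ Q a y x
    Q-sym zero x y = trans (δ-* w x y) (cong (_* w x) (δ-sym x y))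
    Q-sym (suc a) x y = trans (cong (_* w y) (∑-cong vs (λ z →
        trans (cong₂ _*_ (Q-sym a x z) (A-sym z y)) (*-comm (Q a z x) _))))
      (trans (*-comm _ (w y)) (sym (Q-left a y x)))

    -- By `Q-compose` and symmetry, `L * Q (a + b) x y` is the inner product of `Q a x` and `Q b y`
    -- with respect to the weights `d`.
    Q-cauchy-schwarz : ∀ a b x y → Q (a + b) x y * Q (a + b) x y ≤ Q (a + a) x x * Q (b + b) y y
    Q-cauchy-schwarz a b x y = *-cancelˡ-≤ (L * L) {{m*n≢0 L L}} (begin
      L * L * (Q (a + b) x y * Q (a + b) x y) ≡⟨ lem L (Q (a + b) x y) (Q (a + b) x y) ⟩
      L * Q (a + b) x y * (L * Q (a + b) x y) ≡⟨ sym (cong₂ _*_ (Q-compose a b x y) (Q-compose a b x y)) ⟩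
      ∑F (λ z → d z * (Q a x z * Q b z y)) * ∑F (λ z → d z * (Q a x z * Q b z y))
        ≤⟨ cauchy-schwarz′ vs d (Q a x) (λ z → Q b z y) ⟩
      ∑F (λ z → d z * (Q a x z * Q a x z)) * ∑F (λ z → d z * (Q b z y * Q b z y))
        ≡⟨ cong₂ _*_ (trans (∑-cong vs (λ z → cong (λ u → d z * (Q a x z * u)) (Q-sym a x z))) (Q-compose a a x x))
                     (trans (∑-cong vs (λ z → cong (λ u → d z * (u * Q b z y)) (Q-sym b z y))) (Q-compose b b y y)) ⟩
      L * Q (a + a) x x * (L * Q (b + b) y y) ≡⟨ sym (lem L (Q (a + a) x x) (Q (b + b) y y)) ⟩
      L * L * (Q (a + a) x x * Q (b + b) y y) ∎)
      where
      open ≤-Reasoning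
      lem : ∀ l p q → l * l * (p * q) ≡ l * p * (l * q)
      lem = solve-∀

    -- Log-convex moments and bounds for the sequence `T`

    -- Three choices of `c` occur: `d` gives the traces `T`, the number of marked edges at a vertex
    -- gives the sequence `K` of a hyperedge, and `δ y` gives the returns to `y`.
    moment : (V → ℕ) → ℕ → ℕ
    moment c m = ∑F (λ z → c z * Q (m + m) z z)

    -- At one vertex, `2m + 2` is split as `m + (m + 2)`; Cauchy-Schwarz over the vertices adds the
    -- resulting inequalities up.
    moment-log-convex : ∀ c → LogConvex (moment c)
    moment-log-convex c m = cauchy-schwarz vs _ _ _ (λ z → begin
      c z * Q (suc m + suc m) z z * (c z * Q (suc m + suc m) z z)
        ≡⟨ lem (c z) (Q (suc m + suc m) z z) (Q (suc m + suc m) z z) ⟩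
      c z * c z * (Q (suc m + suc m) z z * Q (suc m + suc m) z z)
        ≤⟨ *-monoʳ-≤ (c z * c z) (subst (λ u → Q u z z * Q u z z ≤ Q (m + m) z z * Q (suc (suc m) + suc (suc m)) z z)
             (+-suc m (suc m)) (Q-cauchy-schwarz m (suc (suc m)) z z)) ⟩
      c z * c z * (Q (m + m) z z * Q (suc (suc m) + suc (suc m)) z z)
        ≡⟨ sym (lem (c z) _ _) ⟩
      c z * Q (m + m) z z * (c z * Q (suc (suc m) + suc (suc m)) z z) ∎)
      where
      open ≤-Reasoning
      lem : ∀ c p q → c * p * (c * q) ≡ c * c * (p * q)
      lem = solve-∀

    -- The rows of the random walk sum to 1. The factor `d x` on both sides makes this true at
    -- isolated vertices as well.
    Q-row-sum : ∀ a x → d x * ∑F (λ y → d y * Q a x y) ≡ d x * L ^ suc a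
    Q-row-sum zero x = trans (cong (d x *_) (trans (∑-cong vs (λ y → lem (d y) (δ x y) (w y))) (∑F-δ* x (λ y → w y * d y))))
      (trans (d*w*d x) (cong (d x *_) (sym (*-identityʳ L))))
      where lem : ∀ d e w → d * (e * w) ≡ e * (w * d)
            lem = solve-∀
    Q-row-sum (suc a) x = begin
      d x * ∑F (λ y → d y * Q (suc a) x y)
        ≡⟨ cong (d x *_) (∑-cong vs (λ y → trans (cong (d y *_) (Q-left a x y)) (trans (lem (d y) (w x) _)
             (cong (w x *_) (trans (sym (∑-*ˡ vs (d y) _)) (∑-cong vs (λ z → lem (d y) (A x z) (Q a z y)))))))) ⟩
      d x * ∑F (λ y → w x * ∑F (λ z → A x z * (d y * Q a z y)))
        ≡⟨ cong (d x *_) (trans (∑-*ˡ vs (w x) _) (cong (w x *_) (trans (∑-swap vs vs _)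
             (∑-cong vs (λ z → trans (∑-*ˡ vs (A x z) _) (step z)))))) ⟩
      d x * (w x * ∑F (λ z → A x z * L ^ suc a))
        ≡⟨ cong (λ s → d x * (w x * s)) (∑-*ʳ vs (L ^ suc a) (A x)) ⟩
      d x * (w x * (d x * L ^ suc a))
        ≡⟨ lem₂ (d x) (w x) (L ^ suc a) ⟩
      d x * (w x * d x) * L ^ suc a
        ≡⟨ cong (_* L ^ suc a) (d*w*d x) ⟩
      d x * L * L ^ suc a
        ≡⟨ *-assoc (d x) L _ ⟩
      d x * L ^ suc (suc a) ∎
      where
      open ≡-Reasoning
      lem : ∀ d w s → d * (w * s) ≡ w * (d * s)
      lem = solve-∀
      lem₂ : ∀ d w s → d * (w * (d * s)) ≡ d * (w * d) * s
      lem₂ = solve-∀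
      step : ∀ z → A x z * ∑F (λ y → d y * Q a z y) ≡ A x z * L ^ suc a
      step z with d z in eq
      ... | zero rewrite d≡0⇒A≡0 x z eq = refl
      ... | suc k = cong (A x z *_) (*-cancelˡ-≡ _ _ (suc k)
                      (subst (λ u → u * ∑F (λ y → d y * Q a z y) ≡ u * L ^ suc a) eq (Q-row-sum a z)))

    -- `T m` is `L ^ (2m + 1)` times the trace `T_m` of the overview.
    T : ℕ → ℕ
    T = moment d

    -- The matrix M has the eigenvalue 1. Without eigenvectors: Cauchy-Schwarz on the row sum at `x`
    -- shows that the return probability after `2m` steps is at least the stationary probability
    -- d(x)/∑d, and these add up to 1.
    T-lower : 0 < ∑F d → ∀ m → L * (L * L) ^ m ≤ T m
    T-lower 0<E m = *-cancelˡ-≤ (∑F d * L) {{m*n≢0 (∑F d) L {{>-nonZero 0<E}}}} (begin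
      ∑F d * L * (L * (L * L) ^ m) ≡⟨ cong (λ u → ∑F d * L * (L * u)) (^-*-distrib L L m) ⟩
      ∑F d * L * (L * (L ^ m * L ^ m)) ≡⟨ lem (∑F d) L (L ^ m) ⟩
      ∑F d * (L ^ suc m * L ^ suc m) ≡⟨ sym (∑-*ʳ vs _ d) ⟩
      ∑F (λ x → d x * (L ^ suc m * L ^ suc m)) ≤⟨ ∑-mono vs row ⟩
      ∑F (λ x → ∑F d * L * (d x * Q (m + m) x x)) ≡⟨ ∑-*ˡ vs (∑F d * L) _ ⟩
      ∑F d * L * T m ∎)
      where
      open ≤-Reasoning
      lem : ∀ e l p → e * l * (l * (p * p)) ≡ e * (l * p * (l * p))
      lem = solve-∀
      lem₂ : ∀ d r → d * (r * r) ≡ d * r * r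
      lem₂ = solve-∀
      lem₃ : ∀ d r s → d * r * s ≡ d * s * r
      lem₃ = solve-∀
      lem₄ : ∀ d e l q → d * (e * (l * q)) ≡ e * l * (d * q)
      lem₄ = solve-∀
      row : ∀ x → d x * (L ^ suc m * L ^ suc m) ≤ ∑F d * L * (d x * Q (m + m) x x)
      row x = begin
        d x * (L ^ suc m * L ^ suc m) ≡⟨ lem₂ (d x) _ ⟩
        d x * L ^ suc m * L ^ suc m ≡⟨ cong (_* L ^ suc m) (sym (Q-row-sum m x)) ⟩
        d x * r * L ^ suc m ≡⟨ lem₃ (d x) r _ ⟩
        d x * L ^ suc m * r ≡⟨ cong (_* r) (sym (Q-row-sum m x)) ⟩
        d x * r * r ≡⟨ sym (lem₂ (d x) r) ⟩
        d x * (r * r) ≤⟨ *-monoʳ-≤ (d x) cs ⟩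
        d x * (∑F d * (L * Q (m + m) x x)) ≡⟨ lem₄ (d x) (∑F d) L _ ⟩
        ∑F d * L * (d x * Q (m + m) x x) ∎
        where
        r = ∑F (λ y → d y * Q m x y)
        lem₅ : ∀ d q → d * q * (d * q) ≡ d * (d * (q * q))
        lem₅ = solve-∀
        cs : r * r ≤ ∑F d * (L * Q (m + m) x x)
        cs = ≤-trans (cauchy-schwarz vs d (λ y → d y * (Q m x y * Q m x y)) _ (λ y → ≤-reflexive (lem₅ (d y) (Q m x y))))
          (≤-reflexive (cong (∑F d *_) (trans (∑-cong vs (λ y → cong (λ u → d y * (Q m x y * u)) (Q-sym m x y))) (Q-compose m m x x))))

    T-pos : 0 < ∑F d → ∀ m → 0 < T m
    T-pos 0<E m = <-≤-trans (>-nonZero⁻¹ _ {{m*n≢0 L _ {{L≢0}} {{m^n≢0 (L * L) m {{m*n≢0 L L}}}}}}) (T-lower 0<E m)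

    -- A walk of length 2 returns from a neighbour `z` with probability 1/d(z) ≤ 1/D.
    Q₂-upper : ∀ x → D * (d x * Q 2 x x) ≤ L * L * L
    Q₂-upper x = begin
      D * (d x * Q 2 x x) ≡⟨ cong (λ u → D * (d x * u)) (Q-left 1 x x) ⟩
      D * (d x * (w x * ∑F (λ z → A x z * Q 1 z x))) ≡⟨ lem D (d x) (w x) _ ⟩
      w x * d x * (D * ∑F (λ z → A x z * Q 1 z x)) ≡⟨ cong (w x * d x *_) (sym (∑-*ˡ vs D _)) ⟩
      w x * d x * ∑F (λ z → D * (A x z * Q 1 z x)) ≤⟨ *-monoʳ-≤ (w x * d x) (∑-mono vs bound) ⟩
      w x * d x * ∑F (λ z → A x z * (L * w x)) ≡⟨ cong (w x * d x *_) (∑-*ʳ vs (L * w x) (A x)) ⟩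
      w x * d x * (d x * (L * w x)) ≡⟨ lem₂ (w x) (d x) L ⟩
      w x * d x * (w x * d x) * L ≤⟨ *-monoˡ-≤ L (*-mono-≤ (w*d≤L x) (w*d≤L x)) ⟩
      L * L * L ∎
      where
      open ≤-Reasoning
      lem : ∀ D d w s → D * (d * (w * s)) ≡ w * d * (D * s)
      lem = solve-∀
      lem₂ : ∀ w d L → w * d * (d * (L * w)) ≡ w * d * (w * d) * L
      lem₂ = solve-∀
      lem₃ : ∀ D a w b v → D * (a * (w * b * v)) ≡ a * (w * D * v) * b
      lem₃ = solve-∀
      bound : ∀ z → D * (A x z * Q 1 z x) ≤ A x z * (L * w x)
      bound z = begin
        D * (A x z * (∑F (λ u → δ z u * w u * A u x) * w x))
          ≡⟨ cong (λ s → D * (A x z * (s * w x))) (trans (∑-cong vs (λ u → *-assoc (δ z u) _ _)) (∑F-δ* z (λ u → w u * A u x))) ⟩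
        D * (A x z * (w z * A z x * w x)) ≡⟨ lem₃ D (A x z) (w z) (A z x) (w x) ⟩
        A x z * (w z * D * w x) * A z x ≤⟨ *-monoʳ-≤ (A x z * (w z * D * w x)) (A≤1 z x) ⟩
        A x z * (w z * D * w x) * 1 ≡⟨ *-identityʳ _ ⟩
        A x z * (w z * D * w x) ≤⟨ *-monoʳ-≤ (A x z) (*-monoˡ-≤ (w x) (w*D≤L z)) ⟩
        A x z * (L * w x) ∎

    T₁-upper : D * T 1 ≤ n * (L * L * L)
    T₁-upper = begin
      D * T 1 ≡⟨ sym (∑-*ˡ vs D _) ⟩
      ∑F (λ x → D * (d x * Q 2 x x)) ≤⟨ ∑-mono vs Q₂-upper ⟩
      ∑F (λ (_ : V) → L * L * L) ≡⟨ ∑-const vs _ ⟩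
      length vs * (L * L * L) ≡⟨ cong (_* (L * L * L)) (length-allFin n) ⟩
      n * (L * L * L) ∎
      where open ≤-Reasoning

    -- The interpolation starts at `T 1` because the trace is at most n/D there, while at `T 0` it
    -- can be as large as n. The hypothesis on `S` says that n/D ≤ (D/S)^(2(k+m)).
    T-upper : 0 < ∑F d → ∀ S m k → (S * S) ^ (k + m) * n ≤ D * (D * D) ^ (k + m) →
      T (suc m) * (S * L * (S * L)) ^ k ≤ T (suc (k + m)) * (D * D) ^ k
    T-upper 0<E S m k hS =
      log-convex-interpolate (λ i → T (suc i)) (S * L * (S * L)) (D * D) (λ i → moment-log-convex d (suc i))
        (λ i → T-pos 0<E (suc i)) (>-nonZero⁻¹ _ {{m*n≢0 D D}}) m k base
      where
      open ≤-Reasoning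
      r = k + m
      lem₀ : ∀ s l → s * l * (s * l) ≡ s * s * (l * l)
      lem₀ = solve-∀
      lem₁ : ∀ D t a b → D * (t * (a * b)) ≡ D * t * (a * b)
      lem₁ = solve-∀
      lem₂ : ∀ n l a b → n * (l * l * l) * (a * b) ≡ a * n * (l * (l * l * b))
      lem₂ = solve-∀
      lem₃ : ∀ D e t → D * e * t ≡ D * (t * e)
      lem₃ = solve-∀
      base : T 1 * (S * L * (S * L)) ^ r ≤ T (suc r) * (D * D) ^ r
      base = *-cancelˡ-≤ D (begin
        D * (T 1 * (S * L * (S * L)) ^ r) ≡⟨ cong (λ u → D * (T 1 * u)) (trans (cong (_^ r) (lem₀ S L)) (^-*-distrib (S * S) (L * L) r)) ⟩
        D * (T 1 * ((S * S) ^ r * (L * L) ^ r)) ≡⟨ lem₁ D (T 1) ((S * S) ^ r) ((L * L) ^ r) ⟩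
        D * T 1 * ((S * S) ^ r * (L * L) ^ r) ≤⟨ *-monoˡ-≤ _ T₁-upper ⟩
        n * (L * L * L) * ((S * S) ^ r * (L * L) ^ r) ≡⟨ lem₂ n L ((S * S) ^ r) ((L * L) ^ r) ⟩
        (S * S) ^ r * n * (L * (L * L) ^ suc r) ≤⟨ *-mono-≤ hS (T-lower 0<E (suc r)) ⟩
        D * (D * D) ^ r * T (suc r) ≡⟨ lem₃ D ((D * D) ^ r) (T (suc r)) ⟩
        D * (T (suc r) * (D * D) ^ r) ∎)

    T-upper-∸ : 0 < ∑F d → ∀ S r → (S * S) ^ r * n ≤ D * (D * D) ^ r → ∀ m → m ≤ r →
      T (suc m) * (S * L * (S * L)) ^ (r ∸ m) ≤ T (suc r) * (D * D) ^ (r ∸ m)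
    T-upper-∸ 0<E S r hS m m≤r = subst (λ u → T (suc m) * (S * L * (S * L)) ^ (r ∸ m) ≤ T (suc u) * (D * D) ^ (r ∸ m))
      (m∸n+n≡m m≤r) (T-upper 0<E S m (r ∸ m)
        (subst (λ u → (S * S) ^ u * n ≤ D * (D * D) ^ u) (sym (m∸n+n≡m m≤r)) hS))

    -- Pat B a p x y is the weight of the walks that make a free steps and then one step for each
    -- letter of p: a free step for false and a step weighted by B for true.
    Pat : (V → V → ℕ) → ℕ → List Bool → V → V → ℕ
    Pat B a []          x y = Q a x y
    Pat B a (false ∷ p) x y = Pat B (suc a) p x y
    Pat B a (true ∷ p)  x y = ∑F (λ u → ∑F (λ v → Q a x u * (B u v * Pat B 0 p v y)))

    -- Total weight of closed walks with marked steps, and rotation to a marked step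

    kernel : (V → V → ℕ) → Bool → V → V → ℕ
    kernel B false = A
    kernel B true  = B

    -- The start `x` itself is not weighted: in a closed walk it is also the end, so every position
    -- of the closed walk is weighted exactly once.
    weight : (V → V → ℕ) → ∀ {m} → V → Vec V m → Vec Bool m → ℕ
    weight B x []      []      = 1
    weight B x (z ∷ v) (b ∷ p) = kernel B b x z * (w z * weight B z v p)

    end : ∀ {m} → V → Vec V m → V
    end x []      = x
    end x (z ∷ v) = end z v

    -- The closed walks of length m are the pairs (x , v) with end x v ≡ x.
    closed : (V → V → ℕ) → ∀ {m} → V → Vec V m → Vec Bool m → ℕ
    closed B x v p = weight B x v p * δ (end x v) x

    total : (V → V → ℕ) → ∀ {m} → Vec Bool m → ℕ
    total B {m} p = ∑F (λ x → ∑ (vecs vs m) (λ v → closed B x v p))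

    private
      toward : (V → V → ℕ) → ∀ {m} → Vec Bool m → V → V → ℕ
      toward B {m} p y z = ∑ (vecs vs m) (λ v → weight B z v p * δ (end z v) y)

      toward-∷ : ∀ B {m} b (p : Vec Bool m) y z →
        toward B (b ∷ p) y z ≡ ∑F (λ z′ → kernel B b z z′ * (w z′ * toward B p y z′))
      toward-∷ B {m} b p y z = trans (∑-vecs vs m _) (∑-cong vs (λ z′ →
        trans (∑-cong (vecs vs m) (λ v → lem (kernel B b z z′) (w z′) (weight B z′ v p) _))
          (trans (∑-*ˡ (vecs vs m) (kernel B b z z′ * w z′) _) (*-assoc (kernel B b z z′) _ _))))
        where lem : ∀ a b c e → a * (b * c) * e ≡ a * b * (c * e)
              lem = solve-∀

    -- Induction over the mask, with the free run that leads to `z` collapsed into `Q a x z`: a free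
    -- step lengthens the run, a marked step closes it and opens an empty one.
    Pat-sum : ∀ B {m} (p : Vec Bool m) a x y →
      ∑F (λ z → Q a x z * toward B p y z) ≡ Pat B a (toList p) x y
    Pat-sum B [] a x y = trans (∑-cong vs (λ z → cong (Q a x z *_) (trans (+-identityʳ _) (*-identityˡ _)))) (∑F-*δ y (Q a x))
    Pat-sum B (false ∷ p) a x y = trans (begin
      ∑F (λ z → Q a x z * toward B (false ∷ p) y z)
        ≡⟨ ∑-cong vs (λ z → trans (cong (Q a x z *_) (toward-∷ B false p y z)) (trans (sym (∑-*ˡ vs (Q a x z) _))
             (∑-cong vs (λ u → lem (Q a x z) (A z u) (w u) _)))) ⟩
      ∑F (λ z → ∑F (λ u → Q a x z * A z u * (w u * toward B p y u)))
        ≡⟨ trans (∑-swap vs vs _) (∑-cong vs (λ u → trans (∑-*ʳ vs (w u * toward B p y u) (λ z → Q a x z * A z u))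
             (sym (*-assoc (∑F (λ z → Q a x z * A z u)) (w u) (toward B p y u))))) ⟩
      ∑F (λ u → Q (suc a) x u * toward B p y u) ∎) (Pat-sum B p (suc a) x y)
      where
      open ≡-Reasoning
      lem : ∀ q a w t → q * (a * (w * t)) ≡ q * a * (w * t)
      lem = solve-∀
    Pat-sum B (true ∷ p) a x y = ∑-cong vs (λ z →
      trans (cong (Q a x z *_) (toward-∷ B true p y z)) (trans (sym (∑-*ˡ vs (Q a x z) _))
        (∑-cong vs (λ u → cong (λ s → Q a x z * (B z u * s))
          (trans (sym (trans (∑-cong vs (λ s → *-assoc (δ u s) (w s) _)) (∑F-δ* u (λ s → w s * toward B p y s)))) (Pat-sum B p 0 u y))))))

    Pat-falses : ∀ B a b x y → Pat B b (List.replicate a false) x y ≡ Q (a + b) x y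
    Pat-falses B zero    b x y = refl
    Pat-falses B (suc a) b x y = trans (Pat-falses B a (suc b) x y) (cong (λ u → Q u x y) (+-suc a b))

    -- Summing over the base point `x` glues the run of `a` free steps that leaves `x` to the end of
    -- the pattern that arrives at `x`.
    Pat-compose : ∀ B a p b u v → ∑F (λ x → d x * (Q a x u * Pat B b p v x)) ≡ L * Pat B b (p ++ List.replicate a false) v u
    Pat-compose B a [] b u v = trans (∑-cong vs (λ x → cong (d x *_) (*-comm (Q a x u) _)))
      (trans (Q-compose b a v u) (cong (L *_) (trans (cong (λ s → Q s v u) (+-comm b a)) (sym (Pat-falses B a b v u)))))
    Pat-compose B a (false ∷ p) b u v = Pat-compose B a p (suc b) u v
    Pat-compose B a (true ∷ p) b u v = begin
      ∑F (λ x → d x * (Q a x u * ∑F (λ s → ∑F (λ t → Q b v s * (B s t * Pat B 0 p t x)))))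
        ≡⟨ ∑-cong vs (λ x → trans (sym (*-assoc (d x) (Q a x u) _)) (trans (sym (∑-*ˡ vs (d x * Q a x u) _)) (∑-cong vs (λ s →
             trans (sym (∑-*ˡ vs (d x * Q a x u) _)) (∑-cong vs (λ t → lem (d x) (Q a x u) (Q b v s) (B s t) _)))))) ⟩
      ∑F (λ x → ∑F (λ s → ∑F (λ t → Q b v s * B s t * (d x * (Q a x u * Pat B 0 p t x)))))
        ≡⟨ trans (∑-swap vs vs _) (∑-cong vs (λ s → trans (∑-swap vs vs _) (∑-cong vs (λ t → ∑-*ˡ vs (Q b v s * B s t) _)))) ⟩
      ∑F (λ s → ∑F (λ t → Q b v s * B s t * ∑F (λ x → d x * (Q a x u * Pat B 0 p t x))))
        ≡⟨ ∑-cong vs (λ s → trans (∑-cong vs (λ t → trans (cong (Q b v s * B s t *_) (Pat-compose B a p 0 u t)) (lem₂ (Q b v s) (B s t) L _))) (∑-*ˡ vs L _)) ⟩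
      ∑F (λ s → L * ∑F (λ t → Q b v s * (B s t * Pat B 0 (p ++ List.replicate a false) t u)))
        ≡⟨ ∑-*ˡ vs L _ ⟩
      L * Pat B b (true ∷ p ++ List.replicate a false) v u ∎
      where
      open ≡-Reasoning
      lem : ∀ d q r b t → d * q * (r * (b * t)) ≡ r * b * (d * (q * t))
      lem = solve-∀
      lem₂ : ∀ r b l t → r * b * (l * t) ≡ l * (r * (b * t))
      lem₂ = solve-∀

    -- The closed walk is restarted at its first marked step. Every free run then lies between two
    -- marked steps, the last one wrapping around.
    trace-rotate : ∀ B p a → 0 < trues p → ∃[ p′ ] (trues p ≡ suc (trues p′) × falses p′ ≡ falses p + a ×
      ∑F (λ x → d x * Pat B a p x x) ≡ L * ∑F (λ u → ∑F (λ v → B u v * Pat B 0 p′ v u)))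
    trace-rotate B (false ∷ p) a h with trace-rotate B p (suc a) h
    ... | p′ , e₁ , e₂ , e₃ = p′ , e₁ , trans e₂ (+-suc (falses p) a) , e₃
    trace-rotate B (true ∷ p) a h = p ++ List.replicate a false , cong suc (sym (trues-pad p a)) , falses-pad p a , (begin
      ∑F (λ x → d x * ∑F (λ u → ∑F (λ v → Q a x u * (B u v * Pat B 0 p v x))))
        ≡⟨ ∑-cong vs (λ x → trans (sym (∑-*ˡ vs (d x) _)) (∑-cong vs (λ u → trans (sym (∑-*ˡ vs (d x) _))
             (∑-cong vs (λ v → lem (d x) (Q a x u) (B u v) _))))) ⟩
      ∑F (λ x → ∑F (λ u → ∑F (λ v → B u v * (d x * (Q a x u * Pat B 0 p v x)))))
        ≡⟨ trans (∑-swap vs vs _) (∑-cong vs (λ s → trans (∑-swap vs vs _) (∑-cong vs (λ t → ∑-*ˡ vs (B s t) _)))) ⟩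
      ∑F (λ u → ∑F (λ v → B u v * ∑F (λ x → d x * (Q a x u * Pat B 0 p v x))))
        ≡⟨ ∑-cong vs (λ s → trans (∑-cong vs (λ t → trans (cong (B s t *_) (Pat-compose B a p 0 s t)) (lem₂ (B s t) L _))) (∑-*ˡ vs L _)) ⟩
      ∑F (λ u → L * ∑F (λ v → B u v * Pat B 0 (p ++ List.replicate a false) v u))
        ≡⟨ ∑-*ˡ vs L _ ⟩
      L * ∑F (λ u → ∑F (λ v → B u v * Pat B 0 (p ++ List.replicate a false) v u)) ∎)
      where
      open ≡-Reasoning
      lem : ∀ d q b t → d * (q * (b * t)) ≡ b * (d * (q * t))
      lem = solve-∀
      lem₂ : ∀ b l t → b * (l * t) ≡ l * (b * t)
      lem₂ = solve-∀

    -- `Pat` weights the base point at both ends, `total` only once, and `d x` trades the extra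
    -- weight for `L`. At an isolated vertex, where this trade fails, `B ≤ A` makes both sides
    -- vanish.
    total-Pat : ∀ B → (∀ x y → B x y ≤ A x y) → ∀ {m} (p : Vec Bool (suc m)) →
      L * total B p ≡ ∑F (λ x → d x * Pat B 0 (toList p) x x)
    total-Pat B B≤A {m} p = trans (sym (∑-*ˡ vs L _)) (∑-cong vs (λ x → trans (step x (w-deg x))
        (trans (*-assoc (d x) (w x) _) (cong (d x *_) (trans (sym (trans (∑-cong vs (λ s → *-assoc (δ x s) (w s) _))
          (∑F-δ* x (λ s → w s * toward B p x s)))) (Pat-sum B p 0 x x))))))
      where
      kernel≡0 : ∀ b x z → A x z ≡ 0 → kernel B b x z ≡ 0
      kernel≡0 false x z h = h
      kernel≡0 true  x z h = n≤0⇒n≡0 (subst (B x z ≤_) h (B≤A x z))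
      vanish : ∀ (p : Vec Bool (suc m)) x → d x ≡ 0 → toward B p x x ≡ 0
      vanish (b ∷ p) x h = trans (toward-∷ B b p x x) (trans (∑-cong vs (λ z →
        cong (_* (w z * toward B p x z)) (kernel≡0 b x z (trans (A-sym x z) (d≡0⇒A≡0 z x h))))) (∑-zero vs))
      step : ∀ x → (w x * d x ≡ L) ⊎ (w x ≡ 0 × d x ≡ 0) → L * toward B p x x ≡ d x * w x * toward B p x x
      step x (inj₁ h) = cong (_* toward B p x x) (trans (sym h) (*-comm (w x) (d x)))
      step x (inj₂ (_ , h)) rewrite vanish p x h = trans (*-zeroʳ L) (sym (*-zeroʳ (d x * w x)))

    total-rotate : ∀ B → (∀ x y → B x y ≤ A x y) → ∀ {m} (p : Vec Bool (suc m)) → 0 < trues (toList p) →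
      ∃[ p′ ] (trues (toList p) ≡ suc (trues p′) × falses p′ ≡ falses (toList p) ×
        total B p ≡ ∑F (λ u → ∑F (λ v → B u v * Pat B 0 p′ v u)))
    total-rotate B B≤A p h with trace-rotate B (toList p) 0 h
    ... | p′ , e₁ , e₂ , e₃ = p′ , e₁ , trans e₂ (+-identityʳ _) ,
      *-cancelˡ-≡ _ _ L (trans (total-Pat B B≤A p) e₃)

    -- Closed walks whose marked steps lie in one hyperedge

    module Bounded (B : V → V → ℕ) (K : ℕ → ℕ) (K-lc : LogConvex K) (β : ℕ) (∑B≤β : ∑F (λ u → ∑F (B u)) ≤ β)
      (Bˡ : ∀ u v → 0 < B u v → ∀ m → Q (m + m) u u ≤ K m)
      (Bʳ : ∀ u v → 0 < B u v → ∀ m → Q (m + m) v v ≤ K m) where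

      ∑∑-square : ∀ (f : V → V → ℕ) τ → (∀ u v → 0 < B u v → f u v * f u v ≤ τ) →
        ∑F (λ u → ∑F (λ v → B u v * f u v)) * ∑F (λ u → ∑F (λ v → B u v * f u v)) ≤ β * β * τ
      ∑∑-square f τ h = ≤-trans (cauchy-schwarz vs (λ u → ∑F (B u)) (λ u → ∑F (B u) * τ) _
          (λ u → ≤-trans (weighted-square vs (B u) (f u) τ (h u)) (≤-reflexive (*-assoc (∑F (B u)) _ _))))
        (≤-trans (≤-reflexive (trans (cong (r *_) (∑-*ʳ vs τ _)) (sym (*-assoc r r τ))))
          (*-monoˡ-≤ τ (*-mono-≤ ∑B≤β ∑B≤β)))
        where r = ∑F (λ u → ∑F (B u))

      Q-square : ∀ a x y → (∀ m → Q (m + m) x x ≤ K m) → (∀ m → Q (m + m) y y ≤ K m) → Q a x y * Q a x y ≤ halved K a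
      Q-square a x y gx gy = subst (λ u → Q u x y * Q u x y ≤ halved K a) (⌊n/2⌋+⌈n/2⌉≡n a)
        (≤-trans (Q-cauchy-schwarz ⌊ a /2⌋ ⌈ a /2⌉ x y) (*-mono-≤ (gx _) (gy _)))

      -- A marked step costs `β * K 0`: `β` for the choice of its edge, and `K 0` for merging the
      -- gaps on its two sides by the log-convexity of `halved K`, a sequence that is itself a
      -- square.
      Pat-square : ∀ p a x y → (∀ m → Q (m + m) x x ≤ K m) → (∀ m → Q (m + m) y y ≤ K m) →
        Pat B a p x y * Pat B a p x y ≤ (β * K 0) ^ trues p * (β * K 0) ^ trues p * halved K (falses p + a)
      Pat-square [] a x y gx gy = ≤-trans (Q-square a x y gx gy) (≤-reflexive (sym (+-identityʳ _)))
      Pat-square (false ∷ p) a x y gx gy = subst (λ u → Pat B (suc a) p x y * Pat B (suc a) p x y ≤ e * e * halved K u)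
        (+-suc (falses p) a) (Pat-square p (suc a) x y gx gy)
        where e = (β * K 0) ^ trues p
      Pat-square (true ∷ p) a x y gx gy = begin
        Pat B a (true ∷ p) x y * Pat B a (true ∷ p) x y
          ≡⟨ cong (λ s → s * s) (∑-cong vs (λ u → ∑-cong vs (λ v → lem (Q a x u) (B u v) _))) ⟩
        ∑F (λ u → ∑F (λ v → B u v * f u v)) * ∑F (λ u → ∑F (λ v → B u v * f u v))
          ≤⟨ ∑∑-square f τ bound ⟩
        β * β * τ
          ≡⟨ lem₂ β (K 0) e _ ⟩
        β * K 0 * e * (β * K 0 * e) * halved K (falses p + a) ∎
        where
        open ≤-Reasoning
        e = (β * K 0) ^ trues p
        f : V → V → ℕ
        f u v = Q a x u * Pat B 0 p v y
        τ = e * e * (K 0 * K 0 * halved K (falses p + a))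
        lem : ∀ q b t → q * (b * t) ≡ b * (q * t)
        lem = solve-∀
        lem₂ : ∀ β k e g → β * β * (e * e * (k * k * g)) ≡ β * k * e * (β * k * e) * g
        lem₂ = solve-∀
        lem₃ : ∀ p q → p * q * (p * q) ≡ p * p * (q * q)
        lem₃ = solve-∀
        lem₄ : ∀ g e h → g * (e * e * h) ≡ e * e * (g * h)
        lem₄ = solve-∀
        bound : ∀ u v → 0 < B u v → f u v * f u v ≤ τ
        bound u v h = begin
          f u v * f u v ≡⟨ lem₃ (Q a x u) (Pat B 0 p v y) ⟩
          Q a x u * Q a x u * (Pat B 0 p v y * Pat B 0 p v y) ≤⟨ *-mono-≤ (Q-square a x u gx (Bˡ u v h)) (Pat-square p 0 v y (Bʳ u v h) gy) ⟩
          halved K a * (e * e * halved K (falses p + 0)) ≡⟨ lem₄ (halved K a) e _ ⟩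
          e * e * (halved K a * halved K (falses p + 0)) ≤⟨ *-monoʳ-≤ (e * e) (log-convex-mul (halved K) (halved-log-convex K K-lc) a (falses p + 0)) ⟩
          e * e * (K 0 * K 0 * halved K (a + (falses p + 0))) ≡⟨ cong (λ s → e * e * (K 0 * K 0 * halved K s)) (trans (cong (a +_) (+-identityʳ _)) (+-comm a _)) ⟩
          τ ∎

      -- Around a closed walk, `t + 1` marked steps leave `t + 1` gaps, hence `t` merges. The step
      -- that the rotation puts first costs `β` alone.
      total-square : (∀ x y → B x y ≤ A x y) → ∀ {m} (p : Vec Bool (suc m)) t → trues (toList p) ≡ suc t →
        total B p * total B p ≤ β * β * ((β * K 0) ^ t * (β * K 0) ^ t * halved K (falses (toList p)))
      total-square B≤A p t ht with total-rotate B B≤A p (subst (0 <_) (sym ht) z<s)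
      ... | p′ , e₁ , e₂ , e₃ = subst₂ _≤_ (cong (λ u → u * u) (sym e₃))
          (cong₂ (λ i j → β * β * ((β * K 0) ^ i * (β * K 0) ^ i * halved K j)) (sym (suc-injective (trans (sym ht) e₁))) (trans (+-identityʳ _) e₂))
          (∑∑-square (λ u v → Pat B 0 p′ v u) _ (λ u v h → Pat-square p′ 0 v u (Bʳ u v h) (Bˡ u v h)))

    -- Summation over all hyperedges

    module Family {X : Set} (Hs : List X) (B : X → V → V → ℕ) (B-sym : ∀ h x y → B h x y ≡ B h y x)
      (B≤A : ∀ h x y → B h x y ≤ A x y) (β : ℕ) (∑B≤β : ∀ h → h ∈ Hs → ∑F (λ u → ∑F (B h u)) ≤ β)
      (d₁ : ℕ) (∑B≤d₁A : ∀ x y → ∑ Hs (λ h → B h x y) ≤ d₁ * A x y) where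

      -- A vertex counts once for every edge of `B h` at it. Summed over `h`, the coefficient of `z`
      -- is then at most `d₁ * d z`, that is `d₁` times its coefficient in `T`.
      K : X → ℕ → ℕ
      K h = moment (λ z → ∑F (B h z))

      K₀-upper : ∀ h → h ∈ Hs → D * K h 0 ≤ β * L
      K₀-upper h h∈ = begin
        D * K h 0 ≡⟨ sym (∑-*ˡ vs D _) ⟩
        ∑F (λ z → D * (∑F (B h z) * (δ z z * w z))) ≤⟨ ∑-mono vs (λ z → ≤-trans (≤-reflexive (trans (cong (λ u → D * (∑F (B h z) * (u * w z))) (δ-refl z)) (lem D (∑F (B h z)) (w z))))
                                                                  (*-monoʳ-≤ (∑F (B h z)) (w*D≤L z))) ⟩
        ∑F (λ z → ∑F (B h z) * L) ≡⟨ ∑-*ʳ vs L _ ⟩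
        ∑F (λ z → ∑F (B h z)) * L ≤⟨ *-monoˡ-≤ L (∑B≤β h h∈) ⟩
        β * L ∎
        where
        open ≤-Reasoning
        lem : ∀ D b w → D * (b * (1 * w)) ≡ b * (w * D)
        lem = solve-∀

      ∑K-upper : ∀ m → ∑ Hs (λ h → K h m) ≤ d₁ * T m
      ∑K-upper m = begin
        ∑ Hs (λ h → ∑F (λ z → ∑F (B h z) * Q (m + m) z z)) ≡⟨ ∑-swap Hs vs _ ⟩
        ∑F (λ z → ∑ Hs (λ h → ∑F (B h z) * Q (m + m) z z)) ≡⟨ ∑-cong vs (λ z → trans (∑-*ʳ Hs _ _) (cong (_* Q (m + m) z z) (∑-swap Hs vs _))) ⟩
        ∑F (λ z → ∑F (λ y → ∑ Hs (λ h → B h z y)) * Q (m + m) z z)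
          ≤⟨ ∑-mono vs (λ z → ≤-trans (*-monoˡ-≤ (Q (m + m) z z) (≤-trans (∑-mono vs (∑B≤d₁A z)) (≤-reflexive (∑-*ˡ vs d₁ _)))) (≤-reflexive (*-assoc d₁ _ _))) ⟩
        ∑F (λ z → d₁ * (d z * Q (m + m) z z)) ≡⟨ ∑-*ˡ vs d₁ _ ⟩
        d₁ * T m ∎
        where open ≤-Reasoning

      Bˡ : ∀ h u v → 0 < B h u v → ∀ m → Q (m + m) u u ≤ K h m
      Bˡ h u v 0<B m = ≤-trans (≤-trans (≤-reflexive (sym (*-identityˡ _))) (*-monoˡ-≤ (Q (m + m) u u) (≤-trans 0<B (term≤∑F (B h u) v))))
        (term≤∑F (λ z → ∑F (B h z) * Q (m + m) z z) u)

      total-square-scaled : ∀ {m} (p : Vec Bool (suc m)) t → trues (toList p) ≡ suc t → ∀ h → h ∈ Hs →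
        D ^ t * total (B h) p * (D ^ t * total (B h) p) ≤
          β * (β * β * L) ^ t * (β * (β * β * L) ^ t) * halved (K h) (falses (toList p))
      total-square-scaled p t ht h h∈ = begin
        D ^ t * total (B h) p * (D ^ t * total (B h) p) ≡⟨ lem (D ^ t) (total (B h) p) ⟩
        D ^ t * D ^ t * (total (B h) p * total (B h) p) ≤⟨ *-monoʳ-≤ (D ^ t * D ^ t) (total-square (B≤A h) p t ht) ⟩
        D ^ t * D ^ t * (β * β * (E * E * g)) ≡⟨ lem₂ (D ^ t) β E g ⟩
        β * (D ^ t * E) * (β * (D ^ t * E)) * g ≤⟨ *-monoˡ-≤ g (*-mono-≤ (*-monoʳ-≤ β bound) (*-monoʳ-≤ β bound)) ⟩
        β * (β * β * L) ^ t * (β * (β * β * L) ^ t) * g ∎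
        where
        open ≤-Reasoning
        open Bounded (B h) (K h) (moment-log-convex (λ z → ∑F (B h z))) β (∑B≤β h h∈) (Bˡ h)
          (λ u v 0<B → Bˡ h v u (subst (0 <_) (B-sym h u v) 0<B))
        E = (β * K h 0) ^ t
        g = halved (K h) (falses (toList p))
        lem : ∀ a b → a * b * (a * b) ≡ a * a * (b * b)
        lem = solve-∀
        lem₂ : ∀ d β e g → d * d * (β * β * (e * e * g)) ≡ β * (d * e) * (β * (d * e)) * g
        lem₂ = solve-∀
        lem₃ : ∀ D β k → D * (β * k) ≡ β * (D * k)
        lem₃ = solve-∀
        bound : D ^ t * E ≤ (β * β * L) ^ t
        bound = begin
          D ^ t * E ≡⟨ sym (^-*-distrib D (β * K h 0) t) ⟩
          (D * (β * K h 0)) ^ t ≤⟨ ^-monoˡ-≤ t (≤-trans (≤-reflexive (lem₃ D β (K h 0))) (≤-trans (*-monoʳ-≤ β (K₀-upper h h∈)) (≤-reflexive (sym (*-assoc β β L))))) ⟩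
          (β * β * L) ^ t ∎

      -- With at least two free steps, both indices of `halved (K h)` are at least 1, where the
      -- bounds on `T` begin. Cauchy-Schwarz over `h` separates the two half-lengths, and each of
      -- the two sums is bounded by `d₁` times a value of `T`.
      family-bound : 0 < ∑F d → ∀ S r X → (S * S) ^ r * n ≤ D * (D * D) ^ r → L * X ≡ T (suc r) →
        ∀ {m} (p : Vec Bool (suc m)) t f → trues (toList p) ≡ suc t → falses (toList p) ≡ suc (suc f) → suc t + f ≡ r + r →
        ∑ Hs (λ h → total (B h) p) * S ^ suc t ≤ β * (β * β) ^ t * d₁ * (X * D)
      family-bound 0<E S r X hS hX p t f ht hf htf = *-cancelˡ-≤ (D ^ t * L ^ suc t)
        {{m*n≢0 (D ^ t) (L ^ suc t) {{m^n≢0 D t}} {{m^n≢0 L (suc t)}}}} (begin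
          D ^ t * L ^ suc t * (Σtot * S ^ suc t) ≡⟨ lem₅ (D ^ t) (L ^ suc t) Σtot (S ^ suc t) ⟩
          D ^ t * Σtot * (S ^ suc t * L ^ suc t) ≡⟨ cong (D ^ t * Σtot *_) (sym (^-*-distrib S L (suc t))) ⟩
          D ^ t * Σtot * (S * L) ^ suc t ≤⟨ sq-cancel-≤ squared ⟩
          E * d₁ * (T (suc r) * D ^ suc t) ≡⟨ cong₂ (λ u v → β * u * d₁ * (v * D ^ suc t)) (^-*-distrib (β * β) L t) (sym hX) ⟩
          β * ((β * β) ^ t * L ^ t) * d₁ * (L * X * (D * D ^ t))
            ≡⟨ lem₆ β ((β * β) ^ t) (L ^ t) d₁ L X D (D ^ t) ⟩
          D ^ t * (L * L ^ t) * (β * (β * β) ^ t * d₁ * (X * D)) ∎)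
        where
        open ≤-Reasoning
        Σtot = ∑ Hs (λ h → total (B h) p)
        E = β * (β * β * L) ^ t
        m₁ = ⌊ f /2⌋
        m₂ = ⌈ f /2⌉
        f≤r+r : f ≤ r + r
        f≤r+r = subst (f ≤_) htf (m≤n+m f (suc t))
        m₂≤r : m₂ ≤ r
        m₂≤r = subst (m₂ ≤_) (sym (n≡⌈n+n/2⌉ r)) (⌈n/2⌉-mono f≤r+r)
        m₁≤r : m₁ ≤ r
        m₁≤r = ≤-trans (⌊n/2⌋≤⌈n/2⌉ f) m₂≤r
        -- The distances of the two half-lengths from `r` add up to the number of marked steps; this
        -- is the power of D/S that the interpolation costs.
        gap : (r ∸ m₁) + (r ∸ m₂) ≡ suc t
        gap = +-cancelʳ-≡ f _ _ (trans (cong ((r ∸ m₁) + (r ∸ m₂) +_) (sym (⌊n/2⌋+⌈n/2⌉≡n f)))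
          (trans (lem₇ (r ∸ m₁) (r ∸ m₂) m₁ m₂) (trans (cong₂ _+_ (m∸n+n≡m m₁≤r) (m∸n+n≡m m₂≤r)) (sym htf))))
          where lem₇ : ∀ a b c e → a + b + (c + e) ≡ (a + c) + (b + e)
                lem₇ = solve-∀
        p₀ = S * L * (S * L)
        q₀ = D * D
        TT : T (suc m₁) * T (suc m₂) * p₀ ^ suc t ≤ T (suc r) * T (suc r) * q₀ ^ suc t
        TT = begin
          T (suc m₁) * T (suc m₂) * p₀ ^ suc t
            ≡⟨ cong (T (suc m₁) * T (suc m₂) *_) (trans (cong (p₀ ^_) (sym gap)) (^-distribˡ-+-* p₀ (r ∸ m₁) (r ∸ m₂))) ⟩
          T (suc m₁) * T (suc m₂) * (p₀ ^ (r ∸ m₁) * p₀ ^ (r ∸ m₂))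
            ≡⟨ lem (T (suc m₁)) (T (suc m₂)) (p₀ ^ (r ∸ m₁)) (p₀ ^ (r ∸ m₂)) ⟩
          T (suc m₁) * p₀ ^ (r ∸ m₁) * (T (suc m₂) * p₀ ^ (r ∸ m₂))
            ≤⟨ *-mono-≤ (T-upper-∸ 0<E S r hS m₁ m₁≤r) (T-upper-∸ 0<E S r hS m₂ m₂≤r) ⟩
          T (suc r) * q₀ ^ (r ∸ m₁) * (T (suc r) * q₀ ^ (r ∸ m₂))
            ≡⟨ sym (lem (T (suc r)) (T (suc r)) (q₀ ^ (r ∸ m₁)) (q₀ ^ (r ∸ m₂))) ⟩
          T (suc r) * T (suc r) * (q₀ ^ (r ∸ m₁) * q₀ ^ (r ∸ m₂))
            ≡⟨ cong (T (suc r) * T (suc r) *_) (trans (sym (^-distribˡ-+-* q₀ (r ∸ m₁) (r ∸ m₂))) (cong (q₀ ^_) gap)) ⟩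
          T (suc r) * T (suc r) * q₀ ^ suc t ∎
          where lem : ∀ a b c e → a * b * (c * e) ≡ a * c * (b * e)
                lem = solve-∀
        cs : D ^ t * Σtot * (D ^ t * Σtot) ≤ E * E * (d₁ * d₁) * (T (suc m₁) * T (suc m₂))
        cs = begin
          D ^ t * Σtot * (D ^ t * Σtot)
            ≡⟨ cong (λ u → u * u) (sym (∑-*ˡ Hs (D ^ t) (λ h → total (B h) p))) ⟩
          ∑ Hs (λ h → D ^ t * total (B h) p) * ∑ Hs (λ h → D ^ t * total (B h) p)
            ≤⟨ cauchy-schwarz-∈ Hs (λ h → E * E * K h (suc m₁)) (λ h → K h (suc m₂)) _ (λ h h∈ →
                 ≤-trans (total-square-scaled p t ht h h∈) (≤-reflexive (trans (cong (λ u → E * E * halved (K h) u) hf) (sym (*-assoc (E * E) _ _))))) ⟩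
          ∑ Hs (λ h → E * E * K h (suc m₁)) * ∑ Hs (λ h → K h (suc m₂))
            ≡⟨ cong (_* ∑ Hs (λ h → K h (suc m₂))) (∑-*ˡ Hs (E * E) _) ⟩
          E * E * ∑ Hs (λ h → K h (suc m₁)) * ∑ Hs (λ h → K h (suc m₂))
            ≤⟨ *-mono-≤ (*-monoʳ-≤ (E * E) (∑K-upper (suc m₁))) (∑K-upper (suc m₂)) ⟩
          E * E * (d₁ * T (suc m₁)) * (d₁ * T (suc m₂))
            ≡⟨ lem E d₁ (T (suc m₁)) (T (suc m₂)) ⟩
          E * E * (d₁ * d₁) * (T (suc m₁) * T (suc m₂)) ∎
          where lem : ∀ e d a b → e * e * (d * a) * (d * b) ≡ e * e * (d * d) * (a * b)
                lem = solve-∀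
        sq-^ : ∀ a k → a ^ k * a ^ k ≡ (a * a) ^ k
        sq-^ a k = sym (^-*-distrib a a k)
        squared : D ^ t * Σtot * (S * L) ^ suc t * (D ^ t * Σtot * (S * L) ^ suc t) ≤
                  E * d₁ * (T (suc r) * D ^ suc t) * (E * d₁ * (T (suc r) * D ^ suc t))
        squared = begin
          D ^ t * Σtot * (S * L) ^ suc t * (D ^ t * Σtot * (S * L) ^ suc t)
            ≡⟨ lem (D ^ t * Σtot) ((S * L) ^ suc t) ⟩
          D ^ t * Σtot * (D ^ t * Σtot) * ((S * L) ^ suc t * (S * L) ^ suc t)
            ≡⟨ cong (D ^ t * Σtot * (D ^ t * Σtot) *_) (sq-^ (S * L) (suc t)) ⟩
          D ^ t * Σtot * (D ^ t * Σtot) * p₀ ^ suc t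
            ≤⟨ *-monoˡ-≤ (p₀ ^ suc t) cs ⟩
          E * E * (d₁ * d₁) * (T (suc m₁) * T (suc m₂)) * p₀ ^ suc t
            ≡⟨ *-assoc (E * E * (d₁ * d₁)) _ _ ⟩
          E * E * (d₁ * d₁) * (T (suc m₁) * T (suc m₂) * p₀ ^ suc t)
            ≤⟨ *-monoʳ-≤ (E * E * (d₁ * d₁)) TT ⟩
          E * E * (d₁ * d₁) * (T (suc r) * T (suc r) * q₀ ^ suc t)
            ≡⟨ cong (λ u → E * E * (d₁ * d₁) * (T (suc r) * T (suc r) * u)) (sym (sq-^ D (suc t))) ⟩
          E * E * (d₁ * d₁) * (T (suc r) * T (suc r) * (D ^ suc t * D ^ suc t))
            ≡⟨ lem₂ E d₁ (T (suc r)) (D ^ suc t) ⟩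
          E * d₁ * (T (suc r) * D ^ suc t) * (E * d₁ * (T (suc r) * D ^ suc t)) ∎
          where
          lem : ∀ a b → a * b * (a * b) ≡ a * a * (b * b)
          lem = solve-∀
          lem₂ : ∀ e d t x → e * e * (d * d) * (t * t * (x * x)) ≡ e * d * (t * x) * (e * d * (t * x))
          lem₂ = solve-∀
        lem₅ : ∀ d l s x → d * l * (s * x) ≡ d * s * (x * l)
        lem₅ = solve-∀
        lem₆ : ∀ β c l d L X D e → β * (c * l) * d * (L * X * (D * e)) ≡ e * (L * l) * (β * c * d * (X * D))
        lem₆ = solve-∀

    -- Closed walks that visit a vertex twice

    -- With this kernel, the masks of two marked steps measure the closed walks that are in `y`
    -- after both steps, so the rotation lemmas apply to coincidences too.
    into : V → V → V → ℕ
    into y u z = A u z * δ z y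

    into≤A : ∀ y u z → into y u z ≤ A u z
    into≤A y u z = ≤-trans (*-monoʳ-≤ (A u z) (⟦⟧≤1 _)) (≤-reflexive (*-identityʳ _))

    Pat-none : ∀ B p a x y → trues p ≡ 0 → Pat B a p x y ≡ Q (falses p + a) x y
    Pat-none B []          a x y h = refl
    Pat-none B (false ∷ p) a x y h = trans (Pat-none B p (suc a) x y h) (cong (λ u → Q u x y) (+-suc (falses p) a))

    -- The marked step left over after the rotation ends in `y` and cuts the walk into two factors.
    Pat-one : ∀ y p a → trues p ≡ 1 → ∃₂ λ b c → b + c ≡ falses p + a ×
      (∀ x z → Pat (into y) a p x z ≡ ∑F (λ u → Q b x u * A u y) * Q c y z)
    Pat-one y (false ∷ p) a h with Pat-one y p (suc a) h
    ... | b , c , e , f = b , c , trans e (+-suc (falses p) a) , f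
    Pat-one y (true ∷ p) a h = a , falses p , +-comm a _ , λ x z →
      trans (∑-cong vs (λ u → trans (∑-cong vs (λ v → trans (cong (λ s → Q a x u * (A u v * δ v y * s))
          (trans (Pat-none (into y) p 0 v z (suc-injective h)) (cong (λ s → Q s v z) (+-identityʳ (falses p)))))
          (lem (Q a x u) (A u v) (δ v y) _)))
        (trans (∑F-*δ y (λ v → Q a x u * (A u v * Q (falses p) v z))) (sym (*-assoc (Q a x u) _ _)))))
        (∑-*ʳ vs (Q (falses p) y z) _)
      where lem : ∀ q a e r → q * (a * e * r) ≡ q * (a * r) * e
            lem = solve-∀

    private
      first-step≡0 : ∀ y → ∑F (λ u → Q 0 y u * A u y) ≡ 0
      first-step≡0 y = trans (∑-cong vs (λ u → *-assoc (δ y u) _ _)) (trans (∑F-δ* y (λ u → w u * A u y))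
        (trans (cong (w y *_) (A-irrefl y)) (*-zeroʳ (w y))))

      -- The two returns have lengths `b + 1` and `c + 1`. A return of length 1 would be a loop, so
      -- both lengths are at least 2, and log-convexity from there on pushes them apart to 2 and
      -- `r + r`.
      return-product : ∀ y b c r → b + c ≡ r + r →
        ∑F (λ u → Q b y u * A u y) * ∑F (λ u → Q c y u * A u y) * (w y * w y) ≤ Q 2 y y * Q (r + r) y y
      return-product y zero c r h rewrite first-step≡0 y = z≤n
      return-product y (suc b) zero r h = subst (λ u → R * u * (w y * w y) ≤ Q 2 y y * Q (r + r) y y) (sym (first-step≡0 y))
        (subst (λ u → u * (w y * w y) ≤ Q 2 y y * Q (r + r) y y) (sym (*-zeroʳ R)) z≤n)
        where R = ∑F (λ u → Q (suc b) y u * A u y)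
      return-product y (suc b) (suc c) r h = ≤-trans (≤-reflexive (lem (∑F (λ u → Q (suc b) y u * A u y)) (∑F (λ u → Q (suc c) y u * A u y)) (w y))) (sq-cancel-≤ (begin
          Q (2 + b) y y * Q (2 + c) y y * (Q (2 + b) y y * Q (2 + c) y y)
            ≡⟨ lem₂ (Q (2 + b) y y) _ ⟩
          Q (2 + b) y y * Q (2 + b) y y * (Q (2 + c) y y * Q (2 + c) y y)
            ≤⟨ *-mono-≤ (Q-sq (2 + b)) (Q-sq (2 + c)) ⟩
          halved K (2 + b) * halved K (2 + c)
            ≤⟨ log-convex-mul (λ m → halved K (2 + m)) (log-convex-shift (halved K) (halved-log-convex K K-lc) 2) b c ⟩
          halved K 2 * halved K (2 + (b + c))
            ≡⟨ cong (λ u → halved K 2 * halved K u) (trans (cong suc (sym (+-suc b c))) h) ⟩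
          K 1 * K 1 * halved K (r + r)
            ≡⟨ cong₂ (λ i j → K 1 * K 1 * (K i * K j)) (sym (n≡⌊n+n/2⌋ r)) (sym (n≡⌈n+n/2⌉ r)) ⟩
          K 1 * K 1 * (K r * K r)
            ≡⟨ sym (lem₂ (K 1) (K r)) ⟩
          K 1 * K r * (K 1 * K r) ∎))
        where
        open ≤-Reasoning
        K : ℕ → ℕ
        K m = Q (m + m) y y
        K-lc : LogConvex K
        K-lc m = subst₂ _≤_ (cong₂ _*_ (K≡ (suc m)) (K≡ (suc m))) (cong₂ _*_ (K≡ m) (K≡ (suc (suc m)))) (moment-log-convex (δ y) m)
          where K≡ : ∀ m → moment (δ y) m ≡ K m
                K≡ m = ∑F-δ* y (λ z → Q (m + m) z z)
        Q-sq : ∀ a → Q a y y * Q a y y ≤ halved K a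
        Q-sq a = subst (λ u → Q u y y * Q u y y ≤ halved K a) (⌊n/2⌋+⌈n/2⌉≡n a) (Q-cauchy-schwarz ⌊ a /2⌋ ⌈ a /2⌉ y y)
        lem : ∀ R R′ w → R * R′ * (w * w) ≡ R * w * (R′ * w)
        lem = solve-∀
        lem₂ : ∀ a b → a * b * (a * b) ≡ a * a * (b * b)
        lem₂ = solve-∀

    coincidence-at : ∀ r {m} (p : Vec Bool (suc m)) → trues (toList p) ≡ 2 → falses (toList p) ≡ r + r → ∀ y →
      D * total (into y) p ≤ L * (d y * Q (r + r) y y)
    coincidence-at r p ht hf y with total-rotate (into y) (into≤A y) p (subst (0 <_) (sym ht) z<s)
    ... | p′ , e₁ , e₂ , e₃ with Pat-one y p′ 0 (suc-injective (trans (sym e₁) ht))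
    ... | b , c , e₄ , e₅ = subst (λ u → D * u ≤ L * (d y * Q (r + r) y y)) (sym tot≡) (bound (w-deg y))
      where
      open ≤-Reasoning
      R R′ : ℕ
      R  = ∑F (λ u → Q b y u * A u y)
      R′ = ∑F (λ u → Q c y u * A u y)
      tot≡ : total (into y) p ≡ R * R′
      tot≡ = trans e₃ (trans (∑-cong vs (λ u → trans (∑-cong vs (λ v → trans (*-assoc (A u v) _ _)
          (lem₀ (A u v) (δ v y) _)))
          (trans (∑F-*δ y (λ v → A u v * Pat (into y) 0 p′ v u)) (cong (A u y *_) (e₅ y u)))))
        (trans (∑-cong vs (λ u → lem₁ (A u y) R (Q c y u))) (∑-*ˡ vs R _)))
        where
        lem₀ : ∀ a e q → a * (e * q) ≡ a * q * e
        lem₀ = solve-∀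
        lem₁ : ∀ a R q → a * (R * q) ≡ R * (q * a)
        lem₁ = solve-∀
      b+c : b + c ≡ r + r
      b+c = trans e₄ (trans (+-identityʳ _) (trans e₂ hf))
      bound : (w y * d y ≡ L) ⊎ (w y ≡ 0 × d y ≡ 0) → D * (R * R′) ≤ L * (d y * Q (r + r) y y)
      bound (inj₂ (_ , h)) = subst (_≤ L * (d y * Q (r + r) y y)) (sym (trans (cong (λ u → D * (R * u)) R′≡0) (trans (cong (D *_) (*-zeroʳ R)) (*-zeroʳ D)))) z≤n
        where
        R′≡0 : R′ ≡ 0
        R′≡0 = trans (∑-cong vs (λ u → trans (cong (Q c y u *_) (d≡0⇒A≡0 u y h)) (*-zeroʳ (Q c y u)))) (∑-zero vs)
      bound (inj₁ h) = *-cancelˡ-≤ (L * L) {{m*n≢0 L L}} (begin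
        L * L * (D * (R * R′)) ≡⟨ cong (λ u → u * u * (D * (R * R′))) (sym h) ⟩
        w y * d y * (w y * d y) * (D * (R * R′)) ≡⟨ lem₁ (w y) (d y) D R R′ ⟩
        D * (d y * d y) * (R * R′ * (w y * w y)) ≤⟨ *-monoʳ-≤ (D * (d y * d y)) (return-product y b c r b+c) ⟩
        D * (d y * d y) * (Q 2 y y * Q (r + r) y y) ≡⟨ lem₂ D (d y) (Q 2 y y) (Q (r + r) y y) ⟩
        D * (d y * Q 2 y y) * (d y * Q (r + r) y y) ≤⟨ *-monoˡ-≤ (d y * Q (r + r) y y) (Q₂-upper y) ⟩
        L * L * L * (d y * Q (r + r) y y) ≡⟨ *-assoc (L * L) L _ ⟩
        L * L * (L * (d y * Q (r + r) y y)) ∎)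
        where
        lem₁ : ∀ w d D R S → w * d * (w * d) * (D * (R * S)) ≡ D * (d * d) * (R * S * (w * w))
        lem₁ = solve-∀
        lem₂ : ∀ D d p q → D * (d * d) * (p * q) ≡ D * (d * p) * (d * q)
        lem₂ = solve-∀

    -- The short return gains a factor 1/D by `Q₂-upper`, and the passage from `T r` to `T (suc r)`
    -- costs (D/S)², which leaves D/S².
    coincidence-bound : 0 < ∑F d → ∀ S r X → 0 < r → (S * S) ^ r * n ≤ D * (D * D) ^ r → L * X ≡ T (suc r) →
      ∀ {m} (p : Vec Bool (suc m)) → trues (toList p) ≡ 2 → falses (toList p) ≡ r + r →
      S * S * ∑F (λ y → total (into y) p) ≤ D * X
    coincidence-bound 0<E S (suc r) X _ hS hX p ht hf = *-cancelˡ-≤ (D * (L * L)) {{m*n≢0 D (L * L) {{D≢0}} {{m*n≢0 L L}}}} (begin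
      D * (L * L) * (S * S * Σt) ≡⟨ lem D L S Σt ⟩
      D * Σt * p₀ ≡⟨ cong (_* p₀) (sym (∑-*ˡ vs D _)) ⟩
      ∑F (λ y → D * total (into y) p) * p₀ ≤⟨ *-monoˡ-≤ p₀ (∑-mono vs (coincidence-at (suc r) p ht hf)) ⟩
      ∑F (λ y → L * (d y * Q (suc r + suc r) y y)) * p₀ ≡⟨ cong (_* p₀) (∑-*ˡ vs L _) ⟩
      L * T (suc r) * p₀ ≡⟨ *-assoc L _ _ ⟩
      L * (T (suc r) * p₀) ≤⟨ *-monoʳ-≤ L up ⟩
      L * (T (suc (suc r)) * (D * D)) ≡⟨ cong (λ u → L * (u * (D * D))) (sym hX) ⟩
      L * (L * X * (D * D)) ≡⟨ lem₂ L X D ⟩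
      D * (L * L) * (D * X) ∎)
      where
      open ≤-Reasoning
      Σt = ∑F (λ y → total (into y) p)
      p₀ = S * L * (S * L)
      lem : ∀ D L S t → D * (L * L) * (S * S * t) ≡ D * t * (S * L * (S * L))
      lem = solve-∀
      lem₂ : ∀ L X D → L * (L * X * (D * D)) ≡ D * (L * L) * (D * X)
      lem₂ = solve-∀
      up : T (suc r) * p₀ ≤ T (suc (suc r)) * (D * D)
      up = subst₂ _≤_ (cong (T (suc r) *_) (*-identityʳ p₀)) (cong (T (suc (suc r)) *_) (*-identityʳ (D * D))) (T-upper 0<E S r 1 hS)

    plain : ∀ {m} → Vec Bool m
    plain {m} = Vec.replicate m false

    total-plain : ∀ r → L * total A (plain {suc r + suc r}) ≡ T (suc r)
    total-plain r = trans (total-Pat A (λ _ _ → ≤-refl) (plain {suc r + suc r})) (∑-cong vs (λ x → cong (d x *_)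
      (trans (cong (λ p → Pat A 0 p x x) (toList-plain (suc r + suc r))) (trans (Pat-falses A (suc r + suc r) 0 x x) (cong (λ u → Q u x x) (+-identityʳ (suc r + suc r)))))))
      where
      toList-plain : ∀ m → toList (plain {m}) ≡ List.replicate m false
      toList-plain zero    = refl
      toList-plain (suc m) = cong (false ∷_) (toList-plain m)

    total-plain-lower : 0 < ∑F d → ∀ r → (L * L) ^ suc r ≤ total A (plain {suc r + suc r})
    total-plain-lower 0<E r = *-cancelˡ-≤ L (subst (L * (L * L) ^ suc r ≤_) (sym (total-plain r)) (T-lower 0<E (suc r)))

    -- Closed walks confined to few vertices

    weight-upper : ∀ {m} x (v : Vec V m) → D ^ m * weight A x v plain ≤ L ^ m
    weight-upper x [] = ≤-refl
    weight-upper {suc m} x (z ∷ v) = begin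
      D * D ^ m * (A x z * (w z * weight A z v plain)) ≤⟨ *-monoʳ-≤ (D * D ^ m) (*-monoˡ-≤ _ (A≤1 x z)) ⟩
      D * D ^ m * (1 * (w z * weight A z v plain)) ≡⟨ lem D (D ^ m) (w z) _ ⟩
      w z * D * (D ^ m * weight A z v plain) ≤⟨ *-mono-≤ (w*D≤L z) (weight-upper z v) ⟩
      L * L ^ m ∎
      where
      open ≤-Reasoning
      lem : ∀ a b w t → a * b * (1 * (w * t)) ≡ w * a * (b * t)
      lem = solve-∀

    product : (V → ℕ) → ∀ {m} → Vec V m → ℕ
    product Z []      = 1
    product Z (z ∷ v) = Z z * product Z v

    ∑-product : ∀ Z m → ∑ (vecs vs m) (product Z) ≡ ∑F Z ^ m
    ∑-product Z zero    = refl
    ∑-product Z (suc m) = trans (∑-vecs vs m _) (trans (∑-cong vs (λ z → trans (∑-*ˡ (vecs vs m) (Z z) _) (cong (Z z *_) (∑-product Z m)))) (∑-*ʳ vs _ Z))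

    -- The start of a closed walk is determined by its last vertex and contributes no factor.
    ∑-closed-product : ∀ Z m → ∑F (λ x → ∑ (vecs vs (suc m)) (λ v → product Z v * δ (end x v) x)) ≡ ∑F Z ^ suc m
    ∑-closed-product Z m = trans (∑-swap vs (vecs vs (suc m)) _) (trans (∑-cong (vecs vs (suc m)) inner) (∑-product Z (suc m)))
      where
      inner : ∀ v → ∑F (λ x → product Z v * δ (end x v) x) ≡ product Z v
      inner (z ∷ v) = trans (∑-*ˡ vs (product Z (z ∷ v)) _) (trans (cong (product Z (z ∷ v) *_) (∑F-δ (end z v))) (*-identityʳ _))

    -- `Z z` will be the number of edges of a hyperedge at `z`. The product of `Z` along the walk
    -- dominates the indicator of confinement to its vertices and, unlike the bare condition, sums
    -- to a power of `∑F Z`.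
    confined-bound : ∀ Z m → D ^ suc m * ∑F (λ x → ∑ (vecs vs (suc m)) (λ v → closed A x v plain * product Z v)) ≤ L ^ suc m * ∑F Z ^ suc m
    confined-bound Z m = begin
      D ^ suc m * ∑F (λ x → ∑ (vecs vs (suc m)) (λ v → closed A x v plain * product Z v))
        ≡⟨ trans (sym (∑-*ˡ vs (D ^ suc m) _)) (∑-cong vs (λ x → sym (∑-*ˡ (vecs vs (suc m)) (D ^ suc m) _))) ⟩
      ∑F (λ x → ∑ (vecs vs (suc m)) (λ v → D ^ suc m * (closed A x v plain * product Z v)))
        ≤⟨ ∑-mono vs (λ x → ∑-mono (vecs vs (suc m)) (λ v → ≤-trans (≤-reflexive (lem (D ^ suc m) (weight A x v plain) _ _)) (*-monoˡ-≤ _ (weight-upper x v)))) ⟩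
      ∑F (λ x → ∑ (vecs vs (suc m)) (λ v → L ^ suc m * (product Z v * δ (end x v) x)))
        ≡⟨ trans (∑-cong vs (λ x → ∑-*ˡ (vecs vs (suc m)) (L ^ suc m) _)) (∑-*ˡ vs (L ^ suc m) _) ⟩
      L ^ suc m * ∑F (λ x → ∑ (vecs vs (suc m)) (λ v → product Z v * δ (end x v) x))
        ≡⟨ cong (L ^ suc m *_) (∑-closed-product Z m) ⟩
      L ^ suc m * ∑F Z ^ suc m ∎
      where
      open ≤-Reasoning
      lem : ∀ D a e p → D * (a * e * p) ≡ D * a * (p * e)
      lem = solve-∀

  private variable
    sz : ℕ

  -- Subsets as Boolean vectors, and degrees in a list of subsets

  lookup-injective : ∀ {X : Set} {xs : List X} → Unique xs → ∀ i j → List.lookup xs i ≡ List.lookup xs j → i ≡ j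
  lookup-injective (x∉ ∷ u) zero    zero    eq = refl
  lookup-injective (x∉ ∷ u) zero    (suc j) eq = contradiction eq (All.lookup x∉ (∈-lookup j))
  lookup-injective (x∉ ∷ u) (suc i) zero    eq = contradiction (sym eq) (All.lookup x∉ (∈-lookup i))
  lookup-injective (x∉ ∷ u) (suc i) (suc j) eq = cong suc (lookup-injective u i j eq)

  ⊆⇒lookup : ∀ {σ h : Subset sz} → σ ⊆ h → ∀ e → lookup σ e ≡ true → lookup h e ≡ true
  ⊆⇒lookup {σ = σ} s e p = []=⇒lookup (s (lookup⇒[]= e σ p))

  lookup⇒⊆ : ∀ {σ h : Subset sz} → (∀ e → lookup σ e ≡ true → lookup h e ≡ true) → σ ⊆ h
  lookup⇒⊆ {h = h} f {e} p = lookup⇒[]= e h (f e ([]=⇒lookup p))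

  ∣∣≡∑ : ∀ (σ : Subset sz) → ∣ σ ∣ ≡ ∑F (λ e → ⟦ lookup σ e ⟧)
  ∣∣≡∑ []          = refl
  ∣∣≡∑ (true ∷ σ)  = trans (cong suc (∣∣≡∑ σ)) (sym (∑F-suc (λ e → ⟦ lookup (true ∷ σ) e ⟧)))
  ∣∣≡∑ (false ∷ σ) = trans (∣∣≡∑ σ) (sym (∑F-suc (λ e → ⟦ lookup (false ∷ σ) e ⟧)))

  deg : List (Subset sz) → Subset sz → ℕ
  deg Hs σ = ∑ Hs (λ h → ⟦ does (σ ⊆? h) ⟧)

  length-filter-⊆ : ∀ (Hs : List (Subset sz)) σ → length (filter (σ ⊆?_) Hs) ≡ deg Hs σ
  length-filter-⊆ []       σ = refl
  length-filter-⊆ (h ∷ Hs) σ with does (σ ⊆? h)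
  ... | true  = cong suc (length-filter-⊆ Hs σ)
  ... | false = length-filter-⊆ Hs σ

  deg-antitone : ∀ (Hs : List (Subset sz)) {σ τ} → σ ⊆ τ → deg Hs τ ≤ deg Hs σ
  deg-antitone Hs {σ} {τ} s = ∑-mono Hs step
    where
    step : ∀ h → ⟦ does (τ ⊆? h) ⟧ ≤ ⟦ does (σ ⊆? h) ⟧
    step h with τ ⊆? h
    ... | no _  = z≤n
    ... | yes p = ≤-reflexive (cong ⟦_⟧ (sym (dec-true (σ ⊆? h) (p ∘ s))))

  deg₁ : List (Subset sz) → Fin sz → ℕ
  deg₁ Hs e = ∑ Hs (λ h → ⟦ lookup h e ⟧)

  deg≤deg₁ : ∀ (Hs : List (Subset sz)) σ e → lookup σ e ≡ true → deg Hs σ ≤ deg₁ Hs e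
  deg≤deg₁ Hs σ e p = ∑-mono Hs step
    where
    step : ∀ h → ⟦ does (σ ⊆? h) ⟧ ≤ ⟦ lookup h e ⟧
    step h with σ ⊆? h
    ... | no _  = z≤n
    ... | yes s = ≤-reflexive (cong ⟦_⟧ (sym (⊆⇒lookup s e p)))

  ∑F-unique≤1 : ∀ (f : Fin sz → ℕ) → (∀ e → f e ≤ 1) → (∀ e e′ → 0 < f e → 0 < f e′ → e ≡ e′) → ∑F f ≤ 1
  ∑F-unique≤1 {sz} f f≤1 uniq with ∑F f in eq
  ... | zero = z≤n
  ... | suc k with ∑->0⇒∃ (allFin sz) f (subst (0 <_) (sym eq) z<s)
  ...   | e , _ , p = subst₂ _≤_ eq (∑F-δ e) (∑-mono (allFin sz) step)
    where
    step : ∀ e′ → f e′ ≤ δ e e′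
    step e′ with f e′ in q
    ... | zero = z≤n
    ... | suc j rewrite uniq e e′ p (subst (0 <_) (sym q) z<s) = subst₂ _≤_ q (sym (δ-refl e′)) (f≤1 e′)

  pos-*ˡ : ∀ {a b} → 0 < a * b → 0 < a
  pos-*ˡ {suc a} h = z<s

  pos-*ʳ : ∀ {a b} → 0 < a * b → 0 < b
  pos-*ʳ {a} {b} h = pos-*ˡ (subst (0 <_) (*-comm a b) h)

  ⟦⟧>0 : ∀ {b} → 0 < ⟦ b ⟧ → b ≡ true
  ⟦⟧>0 {true} h = refl

  δ>0 : ∀ {n} {x y : Fin n} → 0 < δ x y → x ≡ y
  δ>0 {x = x} {y} h with x Finₚ.≟ y
  ... | yes p = p

  positive : ℕ → ℕ
  positive zero    = 0
  positive (suc _) = 1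

  positive≤1 : ∀ k → positive k ≤ 1
  positive≤1 zero    = z≤n
  positive≤1 (suc _) = ≤-refl

  positive-mono : ∀ {j k} → j ≤ k → positive j ≤ positive k
  positive-mono {zero}          h = z≤n
  positive-mono {suc j} {suc k} h = ≤-refl

  positive-≥1 : ∀ {k} → 1 ≤ k → positive k ≡ 1
  positive-≥1 {suc k} h = refl

  -- Incidence between edges and vertices, and trimming to minimum degree

  module Incidence {n} (G : Graph n) where

    private
      vs = allFin n
      es = allFin (nEdges G)

    V = Fin n
    E = Fin (nEdges G)

    private
      lo hi : E → V
      lo e = proj₁ (edgeAt G e)
      hi e = proj₂ (edgeAt G e)

    abstract
      J : E → V → V → ℕ
      J e x y = δ (lo e) x * δ (hi e) y + δ (lo e) y * δ (hi e) x

      J-sym : ∀ e x y → J e x y ≡ J e y x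
      J-sym e x y = +-comm (δ (lo e) x * δ (hi e) y) _

      J⇒Joins : ∀ {e x y} → 0 < J e x y → Joins (edgeAt G e) x y
      J⇒Joins {e} {x} {y} h with δ (lo e) x * δ (hi e) y in eq
      ... | suc k = inj₁ (δ>0 (pos-*ˡ {b = δ (hi e) y} p) , δ>0 (pos-*ʳ {δ (lo e) x} p))
        where p : 0 < δ (lo e) x * δ (hi e) y
              p = subst (0 <_) (sym eq) z<s
      ... | zero = inj₂ (δ>0 (pos-*ˡ {b = δ (hi e) x} h) , δ>0 (pos-*ʳ {δ (lo e) y} h))

      Joins⇒J : ∀ {e x y} → Joins (edgeAt G e) x y → 0 < J e x y
      Joins⇒J {e} (inj₁ (refl , refl)) = ≤-trans (≤-reflexive (sym (cong₂ _*_ (δ-refl (lo e)) (δ-refl (hi e))))) (m≤m+n _ _)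
      Joins⇒J {e} (inj₂ (refl , refl)) = ≤-trans (≤-reflexive (sym (cong₂ _*_ (δ-refl (lo e)) (δ-refl (hi e))))) (m≤n+m _ _)

      edge-< : ∀ e → lo e Fin.< hi e
      edge-< e = All.lookup (Graph.ordered G) (∈-lookup e)

      -- Edges are stored with increasing ends, so two edges joining the same pair agree in
      -- orientation; then they are equal entries of a list without repetitions.
      J-unique : ∀ {e e′ x y} → 0 < J e x y → 0 < J e′ x y → e ≡ e′
      J-unique {e} {e′} p q = lookup-injective (Graph.distinct G) e e′ (same (J⇒Joins p) (J⇒Joins q))
        where
        same : ∀ {x y} → Joins (edgeAt G e) x y → Joins (edgeAt G e′) x y → edgeAt G e ≡ edgeAt G e′
        same (inj₁ (a , b)) (inj₁ (c , d)) = cong₂ _,_ (trans a (sym c)) (trans b (sym d))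
        same (inj₂ (a , b)) (inj₂ (c , d)) = cong₂ _,_ (trans a (sym c)) (trans b (sym d))
        same (inj₁ (a , b)) (inj₂ (c , d)) = contradiction (subst₂ Fin._<_ (trans c (sym b)) (trans d (sym a)) (edge-< e′)) (<-asym (edge-< e))
        same (inj₂ (a , b)) (inj₁ (c , d)) = contradiction (subst₂ Fin._<_ (trans c (sym b)) (trans d (sym a)) (edge-< e′)) (<-asym (edge-< e))

      J-irrefl : ∀ e x → J e x x ≡ 0
      J-irrefl e x with J e x x in eq
      ... | zero = refl
      ... | suc k with J⇒Joins {e} {x} {x} (subst (0 <_) (sym eq) z<s)
      ...   | inj₁ (a , b) = contradiction (trans a (sym b)) (Finₚ.<⇒≢ (edge-< e))
      ...   | inj₂ (a , b) = contradiction (trans a (sym b)) (Finₚ.<⇒≢ (edge-< e))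

      J≤1 : ∀ e x y → J e x y ≤ 1
      J≤1 e x y with lo e Finₚ.≟ x | hi e Finₚ.≟ x
      ... | yes a | yes b = contradiction (trans a (sym b)) (Finₚ.<⇒≢ (edge-< e))
      ... | yes a | no _ = subst (_≤ 1) (sym (trans (cong₂ _+_ (*-identityˡ _) (*-zeroʳ (δ (lo e) y))) (+-identityʳ _))) (⟦⟧≤1 _)
      ... | no _ | yes b = subst (_≤ 1) (sym (*-identityʳ (δ (lo e) y))) (⟦⟧≤1 _)
      ... | no _ | no _ = subst (_≤ 1) (sym (*-zeroʳ (δ (lo e) y))) z≤n

      ∑∑J : ∀ e → ∑F (λ x → ∑F (J e x)) ≡ 2
      ∑∑J e = trans (∑-cong vs (λ x → trans (∑-+ vs _ _) (cong₂ _+_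
          (trans (∑-*ˡ vs (δ (lo e) x) (δ (hi e))) (trans (cong (δ (lo e) x *_) (∑F-δ (hi e))) (*-identityʳ _)))
          (trans (∑-*ʳ vs (δ (hi e) x) (δ (lo e))) (trans (cong (_* δ (hi e) x) (∑F-δ (lo e))) (*-identityˡ _))))))
        (trans (∑-+ vs (δ (lo e)) (δ (hi e))) (cong₂ _+_ (∑F-δ (lo e)) (∑F-δ (hi e))))

    Adj : (E → Bool) → V → V → ℕ
    Adj u x y = ∑F (λ e → ⟦ u e ⟧ * J e x y)

    Adj-sym : ∀ u x y → Adj u x y ≡ Adj u y x
    Adj-sym u x y = ∑-cong es (λ e → cong (⟦ u e ⟧ *_) (J-sym e x y))

    Adj-irrefl : ∀ u x → Adj u x x ≡ 0
    Adj-irrefl u x = trans (∑-cong es (λ e → trans (cong (⟦ u e ⟧ *_) (J-irrefl e x)) (*-zeroʳ ⟦ u e ⟧))) (∑-zero es)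

    Adj≤1 : ∀ u x y → Adj u x y ≤ 1
    Adj≤1 u x y = ∑F-unique≤1 _ (λ e → *-mono-≤ (⟦⟧≤1 (u e)) (J≤1 e x y))
      (λ e e′ p q → J-unique (pos-*ʳ {⟦ u e ⟧} p) (pos-*ʳ {⟦ u e′ ⟧} q))

    Adj>0 : ∀ u x y → 0 < Adj u x y → ∃[ e ] (u e ≡ true × 0 < J e x y)
    Adj>0 u x y h with ∑->0⇒∃ es _ h
    ... | e , _ , p = e , ⟦⟧>0 (pos-*ˡ p) , pos-*ʳ {⟦ u e ⟧} p

    ∑∑Adj : ∀ u → ∑F (λ x → ∑F (Adj u x)) ≡ ∑F (λ e → ⟦ u e ⟧) * 2
    ∑∑Adj u = trans (∑-cong vs (λ x → ∑-swap vs es _)) (trans (∑-swap vs es _)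
      (trans (∑-cong es (λ e → trans (∑-cong vs (λ x → ∑-*ˡ vs ⟦ u e ⟧ (J e x))) (trans (∑-*ˡ vs ⟦ u e ⟧ _) (cong (⟦ u e ⟧ *_) (∑∑J e)))))
        (∑-*ʳ es 2 _)))

    degree-in : (E → Bool) → V → ℕ
    degree-in u x = ∑F (Adj u x)

    Adj-mono : ∀ {u u′ : E → Bool} → (∀ e → u′ e ≡ true → u e ≡ true) → ∀ x y → Adj u′ x y ≤ Adj u x y
    Adj-mono {u} {u′} s x y = ∑-mono es step
      where
      step : ∀ e → ⟦ u′ e ⟧ * J e x y ≤ ⟦ u e ⟧ * J e x y
      step e with u′ e in eq
      ... | false = z≤n
      ... | true rewrite s e eq = ≤-refl

    private
      nonisolated : (E → Bool) → ℕ
      nonisolated u = ∑F (λ x → positive (degree-in u x))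

      delete : (E → Bool) → V → E → Bool
      delete u x e = u e ∧ does (∑F (J e x) ≟ 0)

      delete⊆ : ∀ u x e → delete u x e ≡ true → u e ≡ true
      delete⊆ u x e h with u e
      ... | true = refl

      inc≤1 : ∀ e x → ∑F (J e x) ≤ 1
      inc≤1 e x = ∑F-unique≤1 _ (J≤1 e x) uniq
        where
        uniq : ∀ y y′ → 0 < J e x y → 0 < J e x y′ → y ≡ y′
        uniq y y′ p q with J⇒Joins {e} {x} {y} p | J⇒Joins {e} {x} {y′} q
        ... | inj₁ (_ , b) | inj₁ (_ , d) = trans (sym b) d
        ... | inj₂ (a , _) | inj₂ (c , _) = trans (sym a) c
        ... | inj₁ (a , _) | inj₂ (_ , d) = contradiction (trans a (sym d)) (Finₚ.<⇒≢ (edge-< e))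
        ... | inj₂ (_ , b) | inj₁ (c , _) = contradiction (trans c (sym b)) (Finₚ.<⇒≢ (edge-< e))

      delete-size : ∀ u x → ∑F (λ e → ⟦ u e ⟧) ≡ ∑F (λ e → ⟦ delete u x e ⟧) + degree-in u x
      delete-size u x = trans (∑-cong es step) (trans (∑-+ es _ _) (cong (∑F (λ e → ⟦ delete u x e ⟧) +_)
          (sym (trans (∑-swap vs es _) (∑-cong es (λ e → ∑-*ˡ vs ⟦ u e ⟧ (J e x)))))))
        where
        step : ∀ e → ⟦ u e ⟧ ≡ ⟦ delete u x e ⟧ + ⟦ u e ⟧ * ∑F (J e x)
        step e with u e | ∑F (J e x) | inc≤1 e x
        ... | false | _ | _ = refl
        ... | true | zero | _ = refl
        ... | true | suc zero | _ = refl
        ... | true | suc (suc _) | s≤s ()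

      delete-isolates : ∀ u x → degree-in (delete u x) x ≡ 0
      delete-isolates u x = trans (∑-swap vs es _) (trans (∑-cong es (λ e → trans (∑-*ˡ vs ⟦ delete u x e ⟧ (J e x)) (step e))) (∑-zero es))
        where
        step : ∀ e → ⟦ delete u x e ⟧ * ∑F (J e x) ≡ 0
        step e with u e | ∑F (J e x)
        ... | false | _ = refl
        ... | true | zero = refl
        ... | true | suc _ = refl

      fewer-nonisolated : ∀ u x → 1 ≤ degree-in u x → suc (nonisolated (delete u x)) ≤ nonisolated u
      fewer-nonisolated u x h = begin
        suc (nonisolated (delete u x)) ≡⟨ +-comm 1 _ ⟩
        nonisolated (delete u x) + 1 ≡⟨ cong (nonisolated (delete u x) +_) (sym (∑F-δ x)) ⟩
        nonisolated (delete u x) + ∑F (δ x) ≡⟨ sym (∑-+ vs _ _) ⟩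
        ∑F (λ y → positive (degree-in (delete u x) y) + δ x y) ≤⟨ ∑-mono vs step ⟩
        nonisolated u ∎
        where
        open ≤-Reasoning
        step : ∀ y → positive (degree-in (delete u x) y) + δ x y ≤ positive (degree-in u y)
        step y with x Finₚ.≟ y
        ... | yes refl = subst₂ (λ a b → positive a + 1 ≤ b) (sym (delete-isolates u x)) (sym (positive-≥1 h)) ≤-refl
        ... | no _ = ≤-trans (≤-reflexive (+-identityʳ _)) (positive-mono (∑-mono vs (Adj-mono (delete⊆ u x) y)))

      -- `k` bounds the number of deletions still possible, since each one isolates a further
      -- vertex. A deletion removes fewer than `D` edges, so the surplus over `D * k` survives.
      trim′ : ∀ D k u → nonisolated u ≤ k → D * k < ∑F (λ e → ⟦ u e ⟧) →
       ∃[ u′ ] ((∀ e → u′ e ≡ true → u e ≡ true) × 0 < ∑F (λ e → ⟦ u′ e ⟧) × (∀ x → degree-in u′ x ≡ 0 ⊎ D ≤ degree-in u′ x))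
      trim′ D k u ≤k big with Finₚ.any? (λ x → (1 ≤? degree-in u x) ×-dec (degree-in u x <? D))
      ... | no none = u , (λ _ h → h) , ≤-<-trans z≤n big , λ x → fine x
        where
        fine : ∀ x → degree-in u x ≡ 0 ⊎ D ≤ degree-in u x
        fine x with degree-in u x in eq | degree-in u x <? D
        ... | zero  | _ = inj₁ refl
        ... | suc j | no ¬p = inj₂ (≮⇒≥ ¬p)
        ... | suc j | yes p = contradiction (x , subst (1 ≤_) (sym eq) (s≤s z≤n) , subst (_< D) (sym eq) p) none
      trim′ D zero u ≤k big | yes (x , 1≤d , d<D) = contradiction (≤-trans (fewer-nonisolated u x 1≤d) ≤k) λ ()
      trim′ D (suc k) u ≤k big | yes (x , 1≤d , d<D)
       with trim′ D k (delete u x) (s≤s⁻¹ (≤-trans (fewer-nonisolated u x 1≤d) ≤k))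
         (+-cancelʳ-< (degree-in u x) _ _ (<-≤-trans (<-trans (+-monoʳ-< (D * k) d<D)
           (subst (_< ∑F (λ e → ⟦ u e ⟧)) (trans (*-suc D k) (+-comm D _)) big)) (≤-reflexive (delete-size u x))))
      ... | u′ , s , p , q = u′ , (λ e h → delete⊆ u x e (s e h)) , p , q

      nonisolated≤n : ∀ u → nonisolated u ≤ n
      nonisolated≤n u = ≤-trans (∑-mono vs (λ x → positive≤1 (degree-in u x))) (≤-reflexive (trans (∑-const vs 1) (trans (*-identityʳ _) (length-allFin n))))

    trim : ∀ D u → D * n < ∑F (λ e → ⟦ u e ⟧) →
      ∃[ u′ ] ((∀ e → u′ e ≡ true → u e ≡ true) × 0 < ∑F (λ e → ⟦ u′ e ⟧) × (∀ x → degree-in u′ x ≡ 0 ⊎ D ≤ degree-in u′ x))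
    trim D u = trim′ D n u (nonisolated≤n u)

    degree≤n : ∀ u x → degree-in u x ≤ n
    degree≤n u x = ≤-trans (∑-mono vs (Adj≤1 u x)) (≤-reflexive (trans (∑-const vs 1) (trans (*-identityʳ _) (length-allFin n))))

    reciprocal : ℕ → ℕ
    reciprocal zero    = 0
    reciprocal (suc k) = n ! / suc k

    -- The division is exact: `suc k` divides its own factorial, which divides `n !`.
    reciprocal-* : ∀ k → k ≤ n → (reciprocal k * k ≡ n !) ⊎ (reciprocal k ≡ 0 × k ≡ 0)
    reciprocal-* zero    _ = inj₂ (refl , refl)
    reciprocal-* (suc k) h = inj₁ (m/n*n≡m (∣-trans (m∣m*n (k !)) (m≤n⇒m!∣n! h)))

    reciprocal-≤ : ∀ D k → k ≤ n → k ≡ 0 ⊎ D ≤ k → reciprocal k * D ≤ n !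
    reciprocal-≤ D k h g with reciprocal-* k h
    ... | inj₂ (e , _) rewrite e = z≤n
    reciprocal-≤ D k h (inj₁ refl) | inj₁ _ = z≤n
    reciprocal-≤ D k h (inj₂ D≤k) | inj₁ e = ≤-trans (*-monoʳ-≤ (reciprocal k) D≤k) (≤-reflexive e)

  -- Enumeration of the masks and arithmetic of the thresholds

  masks : ∀ k → List (Vec Bool k)
  masks = vecs (true ∷ false ∷ [])

  ∈-masks : ∀ {k} (p : Vec Bool k) → p ∈ masks k
  ∈-masks = ∈-vecs _ λ { true → here refl ; false → there (here refl) }

  ∑-masks-const : ∀ k c → ∑ (masks k) (λ _ → c) ≡ 2 ^ k * c
  ∑-masks-const zero    c = refl
  ∑-masks-const (suc k) c = trans (∑-vecs _ k _) (trans (cong₂ _+_ (∑-masks-const k c) (cong (_+ 0) (∑-masks-const k c)))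
    (lem (2 ^ k) c))
    where lem : ∀ a c → a * c + (a * c + 0) ≡ (a + (a + 0)) * c
          lem = solve-∀

  trues+falses : ∀ {k} (p : Vec Bool k) → trues (toList p) + falses (toList p) ≡ k
  trues+falses []          = refl
  trues+falses (true ∷ p)  = cong suc (trues+falses p)
  trues+falses (false ∷ p) = trans (+-suc (trues (toList p)) _) (cong suc (trues+falses p))

  -- The threshold for `2 + t` edges is at least 1, so a set contained in no hyperedge is never
  -- saturated.
  power-trade : ∀ S D r t → 0 < S → S ≤ D → 3 + t ≤ suc r + suc r → (S * S) ^ (2 + t) ≤ (S * S) ^ suc r * D ^ suc t
  power-trade S D r t 0<S S≤D h = begin
    (S * S) ^ (2 + t) ≡⟨ ^-*-distrib S S (2 + t) ⟩
    S ^ (2 + t) * S ^ (2 + t) ≡⟨ lem S (S ^ suc t) ⟩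
    S ^ (3 + t) * S ^ suc t ≤⟨ *-mono-≤ (^-monoʳ-≤ S {{>-nonZero 0<S}} h) (^-monoˡ-≤ (suc t) S≤D) ⟩
    S ^ (suc r + suc r) * D ^ suc t ≡⟨ cong (_* D ^ suc t) (trans (^-distribˡ-+-* S (suc r) (suc r)) (sym (^-*-distrib S S (suc r)))) ⟩
    (S * S) ^ suc r * D ^ suc t ∎
    where
    open ≤-Reasoning
    lem : ∀ s p → s * p * (s * p) ≡ s * (s * p) * p
    lem = solve-∀

  -- The uncancelled estimate on the weight Y of the walks with a saturated set of edges, reduced.
  cancel-saturated : ∀ C S D r t b Y X Σt → 0 < S → 0 < D → S ≤ D →
    C * ((S * S) ^ suc r * D ^ suc t) * Y ≤ 2 * (S * S) ^ (2 + t) * Σt →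
    Σt * S ^ (2 + t) ≤ b * (S * S) ^ r * (X * D) → C * Y ≤ 2 * b * X
  cancel-saturated C S D r t b Y X Σt 0<S 0<D S≤D h₁ h₂ =
    *-cancelˡ-≤ ((S * S) ^ suc r * (D * D ^ t)) {{nz}} (begin
      (S * S) ^ suc r * (D * D ^ t) * (C * Y) ≡⟨ lem₁ ((S * S) ^ suc r) (D * D ^ t) C Y ⟩
      C * ((S * S) ^ suc r * D ^ suc t) * Y ≤⟨ h₁ ⟩
      2 * (S * S) ^ (2 + t) * Σt ≡⟨ cong (λ u → 2 * u * Σt) (^-*-distrib S S (2 + t)) ⟩
      2 * (S ^ (2 + t) * S ^ (2 + t)) * Σt ≡⟨ lem₂ (S ^ (2 + t)) Σt ⟩
      -- The factor (S/D)^t is dropped here; with just two marked edges, `t = 0`, nothing is lost.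
      2 * S ^ (2 + t) * (Σt * S ^ (2 + t)) ≤⟨ *-mono-≤ (*-monoʳ-≤ 2 (*-monoʳ-≤ S (*-monoʳ-≤ S (^-monoˡ-≤ t S≤D)))) h₂ ⟩
      2 * (S * (S * D ^ t)) * (b * (S * S) ^ r * (X * D)) ≡⟨ lem₃ S (D ^ t) b ((S * S) ^ r) X D ⟩
      S * S * (S * S) ^ r * (D * D ^ t) * (2 * b * X) ∎)
    where
    open ≤-Reasoning
    instance
      _ = >-nonZero 0<S
      _ = >-nonZero 0<D
    nz : NonZero ((S * S) ^ suc r * (D * D ^ t))
    nz = m*n≢0 _ _ {{m^n≢0 (S * S) (suc r) {{m*n≢0 S S}}}} {{m^n≢0 D (suc t)}}
    lem₁ : ∀ a d c y → a * d * (c * y) ≡ c * (a * d) * y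
    lem₁ = solve-∀
    lem₂ : ∀ a s → 2 * (a * a) * s ≡ 2 * a * (s * a)
    lem₂ = solve-∀
    lem₃ : ∀ s d b r x D → 2 * (s * (s * d)) * (b * r * (x * D)) ≡ s * s * r * (D * d) * (2 * b * x)
    lem₃ = solve-∀

  -- `M` counts the masks, `B` bounds the loss for a single mask, and the 4 leaves each kind of bad
  -- walk a quarter of `X`.
  two-stage : ∀ C M Y b B X → 0 < M → C ≡ 4 * M * B → b ≤ B → C * Y ≤ M * (b * X) → 0 < B → 4 * Y ≤ X
  two-stage C M Y b B X 0<M refl b≤B h 0<B = *-cancelˡ-≤ (M * B) {{m*n≢0 M B {{>-nonZero 0<M}} {{>-nonZero 0<B}}}} (begin
    M * B * (4 * Y) ≡⟨ lem M B Y ⟩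
    4 * M * B * Y ≤⟨ h ⟩
    M * (b * X) ≤⟨ *-monoʳ-≤ M (*-monoˡ-≤ X b≤B) ⟩
    M * (B * X) ≡⟨ sym (*-assoc M B X) ⟩
    M * B * X ∎)
    where
    open ≤-Reasoning
    lem : ∀ m b y → m * b * (4 * y) ≡ 4 * m * b * y
    lem = solve-∀

  -- The conditions 2 ≤ j ≤ 2ℓ - 2 and j = 2 on the number j of marked steps.
  if-middle : ℕ → ℕ → ℕ → ℕ
  if-middle (suc (suc _)) (suc (suc _)) c = c
  if-middle _             _             c = 0

  if-two : ℕ → ℕ → ℕ
  if-two 2 c = c
  if-two _ c = 0

  -- The search for a closed walk that is not bad

  module Step {n} (G : Graph n) (u : Fin (nEdges G) → Bool) (D : ℕ) (0<D : 0 < D)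
    (0<u : 0 < ∑F (λ e → ⟦ u e ⟧))
    (trimmed : ∀ x → Incidence.degree-in G u x ≡ 0 ⊎ D ≤ Incidence.degree-in G u x) where

    open Incidence G

    private
      vs = allFin n
      es = allFin (nEdges G)

    A : V → V → ℕ
    A = Adj u

    n!>0 : 0 < n !
    n!>0 = 1≤n! n

    open Walks A (Adj-sym u) (Adj-irrefl u) (Adj≤1 u) (λ x → reciprocal (degree-in u x)) (n !) D n!>0 0<D
      (λ x → reciprocal-* (degree-in u x) (degree≤n u x))
      (λ x → reciprocal-≤ D (degree-in u x) (degree≤n u x) (trimmed x)) public

    0<∑d : 0 < ∑F d
    0<∑d = subst (0 <_) (sym (∑∑Adj u)) (*-mono-< 0<u (z<s {n = 1}))

    B : Subset (nEdges G) → V → V → ℕ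
    B h = Adj (λ e → u e ∧ lookup h e)

    B≤A : ∀ h x y → B h x y ≤ A x y
    B≤A h = Adj-mono step
      where
      step : ∀ e → u e ∧ lookup h e ≡ true → u e ≡ true
      step e p with u e
      ... | true = refl

    ⟦∧⟧ : ∀ a b → ⟦ a ∧ b ⟧ ≡ ⟦ a ⟧ * ⟦ b ⟧
    ⟦∧⟧ true  b = sym (+-identityʳ _)
    ⟦∧⟧ false b = refl

    ∑∑B : ∀ h → ∑F (λ x → ∑F (B h x)) ≤ ∣ h ∣ * 2
    ∑∑B h = ≤-trans (≤-reflexive (∑∑Adj _)) (*-monoˡ-≤ 2 (≤-trans (∑-mono es (λ e →
      ≤-trans (≤-reflexive (⟦∧⟧ (u e) (lookup h e))) (≤-trans (*-monoˡ-≤ _ (⟦⟧≤1 (u e))) (≤-reflexive (*-identityˡ _)))))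
      (≤-reflexive (sym (∣∣≡∑ h)))))

    ∑B : ∀ Hs W → (∀ e → deg₁ Hs e ≤ W) → ∀ x y → ∑ Hs (λ h → B h x y) ≤ W * A x y
    ∑B Hs W deg≤W x y = begin
      ∑ Hs (λ h → ∑F (λ e → ⟦ u e ∧ lookup h e ⟧ * J e x y))
        ≡⟨ ∑-swap Hs es _ ⟩
      ∑F (λ e → ∑ Hs (λ h → ⟦ u e ∧ lookup h e ⟧ * J e x y))
        ≤⟨ ∑-mono es (λ e → ≤-trans (≤-reflexive (trans (∑-cong Hs (λ h → trans (cong (_* J e x y) (⟦∧⟧ (u e) (lookup h e)))
             (lem ⟦ u e ⟧ ⟦ lookup h e ⟧ (J e x y)))) (∑-*ʳ Hs _ _))) (*-monoˡ-≤ (⟦ u e ⟧ * J e x y) (deg≤W e))) ⟩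
      ∑F (λ e → W * (⟦ u e ⟧ * J e x y))
        ≡⟨ ∑-*ˡ es W _ ⟩
      W * A x y ∎
      where
      open ≤-Reasoning
      lem : ∀ a b c → a * b * c ≡ b * (a * c)
      lem = solve-∀

    hit : ∀ {k} → E → V → Vec V k → Vec Bool k → Bool
    hit e x []      []      = false
    hit e x (z ∷ v) (b ∷ p) = (b ∧ does (1 ≤? J e x z)) ∨ hit e z v p

    traversed : ∀ {k} → V → Vec V k → Vec Bool k → Subset (nEdges G)
    traversed x v p = Vec.tabulate (λ e → hit e x v p)

    hit-sound : ∀ {k} e x (v : Vec V k) p → hit e x v p ≡ true →
      ∃[ i ] (lookup p i ≡ true × 0 < J e (lookup (x ∷ v) (inject₁ i)) (lookup v i))
    hit-sound e x [] [] ()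
    hit-sound e x (z ∷ v) (false ∷ p) h with hit-sound e z v p h
    ... | i , a , c = suc i , a , c
    hit-sound e x (z ∷ v) (true ∷ p) h with J e x z in q
    ... | suc _ = zero , refl , subst (0 <_) (sym q) z<s
    ... | zero with hit-sound e z v p h
    ...   | i , a , c = suc i , a , c

    -- The edge traversed at a marked step lies in `h` by assumption, so `A` may be replaced by
    -- `B h` there.
    weight-marked : ∀ h {k} x (v : Vec V k) p → (∀ e → hit e x v p ≡ true → lookup h e ≡ true) →
      weight A x v plain ≤ weight (B h) x v p
    weight-marked h x [] [] f = ≤-refl
    weight-marked h x (z ∷ v) (false ∷ p) f = *-monoʳ-≤ (A x z) (*-monoʳ-≤ (reciprocal (degree-in u z)) (weight-marked h z v p f))
    weight-marked h x (z ∷ v) (true ∷ p) f = *-mono-≤ (∑-mono es step)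
        (*-monoʳ-≤ (reciprocal (degree-in u z)) (weight-marked h z v p (λ e q → f e (rest e q))))
      where
      rest : ∀ e → hit e z v p ≡ true → does (1 ≤? J e x z) ∨ hit e z v p ≡ true
      rest e q = trans (cong (does (1 ≤? J e x z) ∨_) q) (∨-zeroʳ _)
      step : ∀ e → ⟦ u e ⟧ * J e x z ≤ ⟦ u e ∧ lookup h e ⟧ * J e x z
      step e with 1 ≤? J e x z
      ... | no ¬p = subst (λ j → ⟦ u e ⟧ * j ≤ ⟦ u e ∧ lookup h e ⟧ * j) (sym (n<1⇒n≡0 (≰⇒> ¬p))) (≤-trans (≤-reflexive (*-zeroʳ ⟦ u e ⟧)) z≤n)
      ... | yes q = *-monoˡ-≤ (J e x z) (≤-reflexive (trans (sym (*-identityʳ ⟦ u e ⟧))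
          (trans (cong (λ b → ⟦ u e ⟧ * ⟦ b ⟧) (sym (f e (cong (_∨ hit e z v p) (dec-true (1 ≤? J e x z) q))))) (sym (⟦∧⟧ (u e) (lookup h e))))))

    incident : Subset (nEdges G) → V → ℕ
    incident h = degree-in (lookup h)

    ∑-incident : ∀ h → ∑F (incident h) ≡ ∣ h ∣ * 2
    ∑-incident h = trans (∑∑Adj (lookup h)) (cong (_* 2) (sym (∣∣≡∑ h)))

    ∑walks : ∀ k → (V → Vec V k → ℕ) → ℕ
    ∑walks k f = ∑F (λ x → ∑ (vecs vs k) (f x))

    ∑walks-mono : ∀ k {f g : V → Vec V k → ℕ} → (∀ x v → f x v ≤ g x v) → ∑walks k f ≤ ∑walks k g
    ∑walks-mono k h = ∑-mono vs (λ x → ∑-mono (vecs vs k) (h x))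

    ∑walks-zero : ∀ k → ∑walks k (λ _ _ → 0) ≡ 0
    ∑walks-zero k = trans (∑-cong vs (λ x → ∑-zero (vecs vs k))) (∑-zero vs)

    ∑walks-*ˡ : ∀ k c (f : V → Vec V k → ℕ) → ∑walks k (λ x v → c * f x v) ≡ c * ∑walks k f
    ∑walks-*ˡ k c f = trans (∑-cong vs (λ x → ∑-*ˡ (vecs vs k) c (f x))) (∑-*ˡ vs c _)

    ∑walks-+ : ∀ k (f g : V → Vec V k → ℕ) → ∑walks k (λ x v → f x v + g x v) ≡ ∑walks k f + ∑walks k g
    ∑walks-+ k f g = trans (∑-cong vs (λ x → ∑-+ (vecs vs k) (f x) (g x))) (∑-+ vs _ _)

    ∑walks-swap : ∀ {Y : Set} k (ys : List Y) (f : V → Vec V k → Y → ℕ) →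
      ∑walks k (λ x v → ∑ ys (f x v)) ≡ ∑ ys (λ y → ∑walks k (λ x v → f x v y))
    ∑walks-swap k ys f = trans (∑-cong vs (λ x → ∑-swap (vecs vs k) ys (f x))) (∑-swap vs ys _)

    module Search (r : ℕ) (0<r : 0 < r) (S : ℕ) (0<S : 0 < S) (S≤D : S ≤ D)
      (hS : (S * S) ^ r * n ≤ D * (D * D) ^ r)
      (Hs : List (Subset (nEdges G))) (sizes : ∀ h → h ∈ Hs → ∣ h ∣ ≡ suc r + suc r)
      (deg≤ : ∀ e → deg₁ Hs e ≤ (S * S) ^ r) where

      N : ℕ
      N = suc r + suc r

      β : ℕ
      β = N * 2

      -- Dominates the constant `β * (β * β) ^ t` of `family-bound` for all numbers of marked steps
      -- at once.
      b₂ : ℕ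
      b₂ = β * (β * β) ^ N

      X : ℕ
      X = total A (plain {N})

      X-moment : n ! * X ≡ T (suc r)
      X-moment = total-plain r

      -- For a mask of two steps, the sum over `y` is the weight of the closed walk if both steps
      -- end in the same vertex, and 0 otherwise.
      coincidences : V → Vec V N → Vec Bool N → ℕ
      coincidences x v p = if-two (trues (toList p)) (∑F (λ y → closed (into y) x v p))

      coincidences-bound : ∀ K → K * D ≤ 4 * (S * S) → ∀ p → K * ∑walks N (λ x v → coincidences x v p) ≤ 4 * X
      coincidences-bound K hK p = by-count (trues (toList p)) refl
        where
        open ≤-Reasoning
        lem : ∀ d k s → d * (k * s) ≡ k * d * s
        lem = solve-∀
        lem₂ : ∀ d x → 4 * (d * x) ≡ d * (4 * x)
        lem₂ = solve-∀
        none : K * ∑walks N (λ _ _ → 0) ≤ 4 * X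
        none = ≤-trans (≤-reflexive (trans (cong (K *_) (∑walks-zero N)) (*-zeroʳ K))) z≤n
        by-count : ∀ t → trues (toList p) ≡ t → K * ∑walks N (λ x v → if-two t (∑F (λ y → closed (into y) x v p))) ≤ 4 * X
        by-count zero                ht = none
        by-count (suc zero)          ht = none
        by-count (suc (suc (suc _))) ht = none
        by-count (suc (suc zero))    ht = *-cancelˡ-≤ D (begin
          D * (K * ∑walks N (λ x v → ∑F (λ y → closed (into y) x v p))) ≡⟨ cong (λ s → D * (K * s)) (∑walks-swap N vs (λ x v y → closed (into y) x v p)) ⟩
          D * (K * ∑F (λ y → total (into y) p)) ≡⟨ lem D K _ ⟩
          K * D * ∑F (λ y → total (into y) p) ≤⟨ *-monoˡ-≤ _ hK ⟩
          4 * (S * S) * ∑F (λ y → total (into y) p) ≡⟨ *-assoc 4 (S * S) _ ⟩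
          4 * (S * S * ∑F (λ y → total (into y) p)) ≤⟨ *-monoʳ-≤ 4 (coincidence-bound 0<∑d S r X 0<r hS X-moment p ht f≡) ⟩
          4 * (D * X) ≡⟨ lem₂ D X ⟩
          D * (4 * X) ∎)
          where
          f≡ : falses (toList p) ≡ r + r
          f≡ = suc-injective (suc-injective (trans (cong (_+ falses (toList p)) (sym ht)) (trans (trues+falses p) (cong suc (+-suc r r)))))

      -- With j marked steps this is bound (b) in the form S^(2(ℓ-j)) D^(j-1), cleared of its
      -- denominator. The `suc` makes room for the hyperedge about to be added.
      Unsaturated : ℕ → V → Vec V N → Vec Bool N → Set
      Unsaturated C x v p = suc (deg Hs (traversed x v p)) * (S * S) ^ trues (toList p) ≤ C * ((S * S) ^ suc r * D ^ (trues (toList p) ∸ 1))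

      unsaturated? : ∀ C x v p → Dec (Unsaturated C x v p)
      unsaturated? C x v p = _ ≤? _

      saturation : ℕ → V → Vec V N → Vec Bool N → ℕ
      saturation C x v p = if-middle (trues (toList p)) (falses (toList p)) ⟦ not (does (unsaturated? C x v p)) ⟧

      private
        closed-deg : ∀ x (v : Vec V N) (p : Vec Bool N) → closed A x v plain * deg Hs (traversed x v p) ≤ ∑ Hs (λ h → closed (B h) x v p)
        closed-deg x v p = ≤-trans (≤-reflexive (sym (∑-*ˡ Hs (closed A x v plain) (λ h → ⟦ does (traversed x v p ⊆? h) ⟧)))) (∑-mono Hs step)
          where
          step : ∀ h → closed A x v plain * ⟦ does (traversed x v p ⊆? h) ⟧ ≤ closed (B h) x v p
          step h with traversed x v p ⊆? h
          ... | no _  = ≤-trans (≤-reflexive (*-zeroʳ (closed A x v plain))) z≤n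
          ... | yes s = ≤-trans (≤-reflexive (*-identityʳ _)) (*-monoˡ-≤ _ (weight-marked h x v p
                          (λ e q → ⊆⇒lookup s e (trans (lookup∘tabulate (λ e → hit e x v p) e) q))))

        -- Saturation bounds `suc deg` from below. By `power-trade` the degree is not 0, hence
        -- `suc deg` is at most twice the degree; this is the factor 2.
        saturated-deg : ∀ C → 0 < C → ∀ x v p t → trues (toList p) ≡ 2 + t → 2 ≤ falses (toList p) → ¬ Unsaturated C x v p →
          C * ((S * S) ^ suc r * D ^ suc t) ≤ 2 * (S * S) ^ (2 + t) * deg Hs (traversed x v p)
        saturated-deg C 0<C x v p t ht hf ¬uns with deg Hs (traversed x v p) | subst (λ j → suc (deg Hs (traversed x v p)) * (S * S) ^ j > C * ((S * S) ^ suc r * D ^ (j ∸ 1))) ht (≰⇒> ¬uns)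
        ... | zero | big = contradiction (≤-trans big (≤-trans (≤-reflexive (*-identityˡ _)) (≤-trans (power-trade S D r t 0<S S≤D t+3≤)
                             (≤-trans (≤-reflexive (sym (*-identityˡ _))) (*-monoˡ-≤ _ 0<C))))) (<-irrefl refl)
          where
          t+3≤ : 3 + t ≤ suc r + suc r
          t+3≤ = ≤-trans (≤-trans (n≤1+n (3 + t)) (≤-reflexive (+-comm 2 (2 + t)))) (≤-trans (+-mono-≤ (≤-reflexive (sym ht)) hf) (≤-reflexive (trues+falses p)))
        ... | suc k | big = ≤-trans (<⇒≤ big) (≤-trans (*-monoˡ-≤ ((S * S) ^ (2 + t)) (s≤s (s≤s (m≤n+m k k)))) (≤-reflexive (lem ((S * S) ^ (2 + t)) k)))
          where lem : ∀ a k → suc (suc (k + k)) * a ≡ 2 * a * suc k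
                lem = solve-∀

      -- A walk with saturated marked edges is charged to all the hyperedges that contain these
      -- edges, of which there are at least half the threshold; `family-bound` limits what the
      -- hyperedges can receive altogether.
      saturation-bound : ∀ C → 0 < C → ∀ p → C * ∑walks N (λ x v → saturation C x v p * closed A x v plain) ≤ 2 * b₂ * X
      saturation-bound C 0<C p = by-count (trues (toList p)) (falses (toList p)) refl refl
        where
        ⟦_⟧ₛ : V → Vec V N → ℕ
        ⟦_⟧ₛ x v = ⟦ not (does (unsaturated? C x v p)) ⟧
        none : C * ∑walks N (λ _ _ → 0) ≤ 2 * b₂ * X
        none = ≤-trans (≤-reflexive (trans (cong (C *_) (∑walks-zero N)) (*-zeroʳ C))) z≤n
        middle : ∀ t f → trues (toList p) ≡ 2 + t → falses (toList p) ≡ 2 + f →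
          C * ∑walks N (λ x v → ⟦_⟧ₛ x v * closed A x v plain) ≤ 2 * b₂ * X
        middle t f ht hf = ≤-trans (cancel-saturated C S D r t (β * (β * β) ^ suc t) (∑walks N (λ x v → ⟦_⟧ₛ x v * closed A x v plain)) X
            (∑ Hs (λ h → total (B h) p)) 0<S 0<D S≤D upper
            (Family.family-bound Hs B (λ h → Adj-sym (λ e → u e ∧ lookup h e)) B≤A β
              (λ h h∈ → ≤-trans (∑∑B h) (≤-reflexive (cong (_* 2) (sizes h h∈)))) ((S * S) ^ r) (∑B Hs _ deg≤) 0<∑d S r X hS X-moment p (suc t) f ht hf count))
          (*-monoˡ-≤ X (*-monoʳ-≤ 2 (*-monoʳ-≤ β (^-monoʳ-≤ (β * β) {{m*n≢0 β β}} t≤N))))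
          where
          count : suc (suc t) + f ≡ r + r
          count = suc-injective (suc-injective (trans (lem t f) (trans (cong₂ _+_ (sym ht) (sym hf)) (trans (trues+falses p) (cong suc (+-suc r r))))))
            where lem : ∀ t f → suc (suc (suc (suc t) + f)) ≡ (2 + t) + (2 + f)
                  lem = solve-∀
          t≤N : suc t ≤ N
          t≤N = ≤-trans (n≤1+n _) (≤-trans (≤-reflexive (sym ht)) (≤-trans (m≤m+n _ _) (≤-reflexive (trues+falses p))))
          pointwise : ∀ x v → C * ((S * S) ^ suc r * D ^ suc t) * (⟦_⟧ₛ x v * closed A x v plain) ≤
            2 * (S * S) ^ (2 + t) * ∑ Hs (λ h → closed (B h) x v p)
          pointwise x v = by-decision (unsaturated? C x v p)
           where
           open ≤-Reasoning
           lem : ∀ a d c → a * d * (1 * c) ≡ a * (c * d)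
           lem = solve-∀
           by-decision : (dec : Dec (Unsaturated C x v p)) →
             C * ((S * S) ^ suc r * D ^ suc t) * (⟦ not (does dec) ⟧ * closed A x v plain) ≤
             2 * (S * S) ^ (2 + t) * ∑ Hs (λ h → closed (B h) x v p)
           by-decision (yes _) = ≤-trans (≤-reflexive (*-zeroʳ (C * ((S * S) ^ suc r * D ^ suc t)))) z≤n
           by-decision (no ¬uns) = begin
              C * ((S * S) ^ suc r * D ^ suc t) * (1 * closed A x v plain)
                ≤⟨ *-monoˡ-≤ _ (saturated-deg C 0<C x v p t ht (≤-trans (s≤s (s≤s z≤n)) (≤-reflexive (sym hf))) ¬uns) ⟩
              2 * (S * S) ^ (2 + t) * deg Hs (traversed x v p) * (1 * closed A x v plain)
                ≡⟨ lem (2 * (S * S) ^ (2 + t)) _ _ ⟩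
              2 * (S * S) ^ (2 + t) * (closed A x v plain * deg Hs (traversed x v p))
                ≤⟨ *-monoʳ-≤ (2 * (S * S) ^ (2 + t)) (closed-deg x v p) ⟩
              2 * (S * S) ^ (2 + t) * ∑ Hs (λ h → closed (B h) x v p) ∎
          upper : C * ((S * S) ^ suc r * D ^ suc t) * ∑walks N (λ x v → ⟦_⟧ₛ x v * closed A x v plain) ≤
            2 * (S * S) ^ (2 + t) * ∑ Hs (λ h → total (B h) p)
          upper = ≤-trans (≤-reflexive (sym (∑walks-*ˡ N (C * ((S * S) ^ suc r * D ^ suc t)) _))) (≤-trans (∑walks-mono N pointwise)
            (≤-reflexive (trans (∑walks-*ˡ N (2 * (S * S) ^ (2 + t)) _) (cong (2 * (S * S) ^ (2 + t) *_) (∑walks-swap N Hs (λ x v h → closed (B h) x v p))))))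
        by-count : ∀ t f → trues (toList p) ≡ t → falses (toList p) ≡ f →
          C * ∑walks N (λ x v → if-middle t f (⟦_⟧ₛ x v) * closed A x v plain) ≤ 2 * b₂ * X
        by-count zero          _             ht hf = none
        by-count (suc zero)    _             ht hf = none
        by-count (suc (suc t)) zero          ht hf = none
        by-count (suc (suc t)) (suc zero)    ht hf = none
        by-count (suc (suc t)) (suc (suc f)) ht hf = middle t f ht hf

      confinement-bound : ∀ Λ → Λ * length Hs ≤ D ^ N →
        Λ * ∑walks N (λ x v → ∑ Hs (λ h → closed A x v plain * product (incident h) v)) ≤ β ^ N * X
      confinement-bound Λ hΛ = *-cancelˡ-≤ (D ^ N) {{m^n≢0 D N}} (begin
        D ^ N * (Λ * ∑walks N (λ x v → ∑ Hs (λ h → closed A x v plain * product (incident h) v)))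
          ≡⟨ cong (λ s → D ^ N * (Λ * s)) (∑walks-swap N Hs (λ x v h → closed A x v plain * product (incident h) v)) ⟩
        D ^ N * (Λ * ∑ Hs confined)
          ≡⟨ lem (D ^ N) Λ _ ⟩
        Λ * (D ^ N * ∑ Hs confined)
          ≡⟨ cong (Λ *_) (sym (∑-*ˡ Hs (D ^ N) confined)) ⟩
        Λ * ∑ Hs (λ h → D ^ N * confined h)
          ≤⟨ *-monoʳ-≤ Λ (∑-mono-∈ Hs (λ h h∈ → ≤-trans (confined-bound (incident h) (r + suc r))
               (≤-reflexive (cong (λ s → (n !) ^ N * s ^ N) (trans (∑-incident h) (cong (_* 2) (sizes h h∈))))))) ⟩
        Λ * ∑ Hs (λ _ → (n !) ^ N * β ^ N)
          ≡⟨ trans (cong (Λ *_) (∑-const Hs _)) (sym (*-assoc Λ _ _)) ⟩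
        Λ * length Hs * ((n !) ^ N * β ^ N)
          ≤⟨ *-mono-≤ hΛ (*-monoˡ-≤ (β ^ N) (≤-trans (≤-reflexive L^N) (total-plain-lower 0<∑d r))) ⟩
        D ^ N * (X * β ^ N)
          ≡⟨ cong (D ^ N *_) (*-comm X _) ⟩
        D ^ N * (β ^ N * X) ∎)
        where
        open ≤-Reasoning
        confined : Subset (nEdges G) → ℕ
        confined h = ∑walks N (λ x v → closed A x v plain * product (incident h) v)
        lem : ∀ d l s → d * (l * s) ≡ l * (d * s)
        lem = solve-∀
        L^N : (n !) ^ N ≡ (n ! * n !) ^ suc r
        L^N = trans (^-distribˡ-+-* (n !) (suc r) (suc r)) (sym (^-*-distrib (n !) (n !) (suc r)))

      X>0 : 0 < X
      X>0 = <-≤-trans (m^n>0 (n ! * n !) {{m*n≢0 (n !) (n !)}} (suc r)) (total-plain-lower 0<∑d r)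

      -- The averaging yields a walk whose own bad terms add up to less than its weight. Each term
      -- is a natural multiple of that weight, so being smaller forces it to be 0.
      GoodWalk : ℕ → Set
      GoodWalk C = ∃₂ λ x v → (∀ p → coincidences x v p < closed A x v plain) ×
        (∀ p → saturation C x v p * closed A x v plain < closed A x v plain) ×
        (∀ h → h ∈ Hs → closed A x v plain * product (incident h) v < closed A x v plain)

      good-walk : ∀ K C Λ → K ≡ 4 * 2 ^ N * 4 → C ≡ 4 * 2 ^ N * (2 * b₂) → Λ ≡ 4 * 1 * β ^ N →
        K * D ≤ 4 * (S * S) → Λ * length Hs ≤ D ^ N → GoodWalk C
      good-walk K C Λ eK eC eΛ hK hΛ = from-start (∑-<⇒∃ vs _ _ small)
        where
        open ≤-Reasoning
        instance
          _ = m^n≢0 2 N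
          b₂≢0 : NonZero b₂
          b₂≢0 = m*n≢0 β ((β * β) ^ N) {{_}} {{m^n≢0 (β * β) N}}
        Y₁ Y₂ Y₃ : V → Vec V N → ℕ
        Y₁ x v = ∑ (masks N) (coincidences x v)
        Y₂ x v = ∑ (masks N) (λ p → saturation C x v p * closed A x v plain)
        Y₃ x v = ∑ Hs (λ h → closed A x v plain * product (incident h) v)
        masks-bound : ∀ c k (f : V → Vec V N → Vec Bool N → ℕ) → (∀ p → c * ∑walks N (λ x v → f x v p) ≤ k) →
          c * ∑walks N (λ x v → ∑ (masks N) (f x v)) ≤ 2 ^ N * k
        masks-bound c k f h = ≤-trans (≤-reflexive (trans (cong (c *_) (∑walks-swap N (masks N) f)) (sym (∑-*ˡ (masks N) c (λ p → ∑walks N (λ x v → f x v p))))))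
          (≤-trans (∑-mono (masks N) h) (≤-reflexive (∑-masks-const N k)))
        4Y₁≤X : 4 * ∑walks N Y₁ ≤ X
        4Y₁≤X = two-stage K (2 ^ N) (∑walks N Y₁) 4 4 X (m^n>0 2 N) eK ≤-refl (masks-bound K (4 * X) coincidences (coincidences-bound K hK)) z<s
        4Y₂≤X : 4 * ∑walks N Y₂ ≤ X
        4Y₂≤X = two-stage C (2 ^ N) (∑walks N Y₂) (2 * b₂) (2 * b₂) X (m^n>0 2 N) eC ≤-refl
          (masks-bound C (2 * b₂ * X) _ (saturation-bound C (subst (0 <_) (sym eC) (>-nonZero⁻¹ _ {{m*n≢0 (4 * 2 ^ N) (2 * b₂) {{m*n≢0 4 (2 ^ N)}} {{m*n≢0 2 b₂}}}}))))
          (>-nonZero⁻¹ _ {{m*n≢0 2 b₂}})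
        4Y₃≤X : 4 * ∑walks N Y₃ ≤ X
        4Y₃≤X = two-stage Λ 1 (∑walks N Y₃) (β ^ N) (β ^ N) X z<s eΛ ≤-refl
          (≤-trans (confinement-bound Λ hΛ) (≤-reflexive (sym (*-identityˡ _)))) (m^n>0 β N)
        small : ∑walks N (λ x v → Y₁ x v + (Y₂ x v + Y₃ x v)) < ∑walks N (λ x v → closed A x v plain)
        small = *-cancelˡ-< 4 _ _ (begin-strict
          4 * ∑walks N (λ x v → Y₁ x v + (Y₂ x v + Y₃ x v))
            ≡⟨ cong (4 *_) (trans (∑walks-+ N Y₁ (λ x v → Y₂ x v + Y₃ x v)) (cong (∑walks N Y₁ +_) (∑walks-+ N Y₂ Y₃))) ⟩
          4 * (∑walks N Y₁ + (∑walks N Y₂ + ∑walks N Y₃))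
            ≡⟨ lem (∑walks N Y₁) (∑walks N Y₂) (∑walks N Y₃) ⟩
          4 * ∑walks N Y₁ + (4 * ∑walks N Y₂ + 4 * ∑walks N Y₃)
            ≤⟨ +-mono-≤ 4Y₁≤X (+-mono-≤ 4Y₂≤X 4Y₃≤X) ⟩
          X + (X + X)
            <⟨ +-monoʳ-< X (+-monoʳ-< X (m<m+n X (≤-trans X>0 (≤-reflexive (sym (+-identityʳ X)))))) ⟩
          4 * X ∎)
          where lem : ∀ a b c → 4 * (a + (b + c)) ≡ 4 * a + (4 * b + 4 * c)
                lem = solve-∀
        from-walk : ∀ x → ∃[ v ] (v ∈ vecs vs N × Y₁ x v + (Y₂ x v + Y₃ x v) < closed A x v plain) → GoodWalk C
        from-walk x (v , _ , q) = x , v ,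
          (λ p → ≤-<-trans (≤-trans (term≤∑ (coincidences x v) (∈-masks p)) (m≤m+n (Y₁ x v) (Y₂ x v + Y₃ x v))) q) ,
          (λ p → ≤-<-trans (≤-trans (term≤∑ (λ p → saturation C x v p * closed A x v plain) (∈-masks p))
            (≤-trans (m≤m+n (Y₂ x v) (Y₃ x v)) (m≤n+m (Y₂ x v + Y₃ x v) (Y₁ x v)))) q) ,
          (λ h h∈ → ≤-<-trans (≤-trans (term≤∑ (λ h → closed A x v plain * product (incident h) v) h∈)
            (≤-trans (m≤n+m (Y₃ x v) (Y₂ x v)) (m≤n+m (Y₂ x v + Y₃ x v) (Y₁ x v)))) q)
        from-start : ∃[ x ] (x ∈ vs × ∑ (vecs vs N) (λ v → Y₁ x v + (Y₂ x v + Y₃ x v)) < ∑ (vecs vs N) (λ v → closed A x v plain)) → GoodWalk C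
        from-start (x , _ , q) = from-walk x (∑-<⇒∃ (vecs vs N) _ _ q)

  does-true : ∀ {P : Set} (dec : Dec P) → does dec ≡ true → P
  does-true (yes p) _ = p

  -- Cyclic predecessors

  prev : ∀ {k} → Fin (suc k) → Fin (suc k)
  prev zero    = fromℕ _
  prev (suc i) = inject₁ i

  -- In a cycle of length at least 3 no two indices precede each other. This excludes two steps that
  -- run through one edge in opposite directions.
  prev-prev : ∀ {k} → 2 ≤ k → (i : Fin (suc k)) → prev (prev i) ≢ i
  prev-prev {suc k} (s≤s 1≤k) zero eq = <⇒≢ 1≤k (sym (trans (sym (trans (Finₚ.toℕ-inject₁ (fromℕ k)) (Finₚ.toℕ-fromℕ k))) (cong toℕ eq)))
  prev-prev {suc k} (s≤s 1≤k) (suc zero) eq = <⇒≢ (s≤s 1≤k) (sym (trans (sym (Finₚ.toℕ-fromℕ (suc k))) (cong toℕ eq)))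
  prev-prev {suc (suc k)} h (suc (suc i)) eq = <⇒≢ (m<n⇒m<1+n (n<1+n (toℕ i)))
    (trans (sym (trans (Finₚ.toℕ-inject₁ (inject₁ i)) (Finₚ.toℕ-inject₁ i))) (cong toℕ eq))

  prev-≢ : ∀ {k} → 1 ≤ k → (i : Fin (suc k)) → prev i ≢ i
  prev-≢ {suc k} h (suc i) eq = <⇒≢ (n<1+n (toℕ i)) (trans (sym (Finₚ.toℕ-inject₁ i)) (cong toℕ eq))

  prev-surjective : ∀ {k} (i : Fin (suc k)) → ∃[ j ] prev j ≡ i
  prev-surjective {k} i with k ≟ toℕ i
  ... | yes p = zero , Finₚ.toℕ-injective (trans (Finₚ.toℕ-fromℕ k) p)
  ... | no ¬p = suc (Fin.lower₁ i ¬p) , Finₚ.inject₁-lower₁ i ¬p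

  CycAdj-prev : ∀ {k} (j : Fin (suc k)) → CycAdj (suc k) (prev j) j
  CycAdj-prev {k} zero = inj₂ (cong suc (Finₚ.toℕ-fromℕ k) , refl)
  CycAdj-prev (suc j) = inj₁ (cong suc (Finₚ.toℕ-inject₁ j))

  CycAdj⇒prev : ∀ {k} (i j : Fin (suc k)) → CycAdj (suc k) i j → prev j ≡ i
  CycAdj⇒prev i (suc j) (inj₁ h) = Finₚ.toℕ-injective (trans (Finₚ.toℕ-inject₁ j) (sym (suc-injective h)))
  CycAdj⇒prev {k} i zero (inj₂ (h , _)) = Finₚ.toℕ-injective (trans (Finₚ.toℕ-fromℕ k) (sym (suc-injective h)))

  trues≡∑ : ∀ {k} (p : Vec Bool k) → trues (toList p) ≡ ∑F (λ i → ⟦ lookup p i ⟧)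
  trues≡∑ []          = refl
  trues≡∑ (true ∷ p)  = trans (cong suc (trues≡∑ p)) (sym (∑F-suc (λ i → ⟦ lookup (true ∷ p) i ⟧)))
  trues≡∑ (false ∷ p) = trans (trues≡∑ p) (sym (∑F-suc (λ i → ⟦ lookup (false ∷ p) i ⟧)))

  ∣image∣ : ∀ {k m} (ε : Fin k → Fin m) → Injective _≡_ _≡_ ε → ∀ (σ : Subset m) → (∀ e → lookup σ e ≡ true → ∃[ i ] ε i ≡ e) →
    ∣ σ ∣ ≡ ∑F (λ i → ⟦ lookup σ (ε i) ⟧)
  ∣image∣ {k} {m} ε inj σ covered = begin
    ∣ σ ∣ ≡⟨ ∣∣≡∑ σ ⟩
    ∑F (λ e → ⟦ lookup σ e ⟧) ≡⟨ ∑-cong (allFin m) step ⟩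
    ∑F (λ e → ∑F (λ i → δ (ε i) e * ⟦ lookup σ e ⟧)) ≡⟨ ∑-swap (allFin m) (allFin k) _ ⟩
    ∑F (λ i → ∑F (λ e → δ (ε i) e * ⟦ lookup σ e ⟧)) ≡⟨ ∑-cong (allFin k) (λ i → ∑F-δ* (ε i) (λ e → ⟦ lookup σ e ⟧)) ⟩
    ∑F (λ i → ⟦ lookup σ (ε i) ⟧) ∎
    where
    open ≡-Reasoning
    same : ∀ i₀ i → δ (ε i) (ε i₀) ≡ δ i₀ i
    same i₀ i with i₀ Finₚ.≟ i
    ... | yes refl = δ-refl (ε i₀)
    ... | no ¬p = δ-≢ (¬p ∘ sym ∘ inj)
    step : ∀ e → ⟦ lookup σ e ⟧ ≡ ∑F (λ i → δ (ε i) e * ⟦ lookup σ e ⟧)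
    step e with lookup σ e in eq
    ... | false = sym (trans (∑-cong (allFin k) (λ i → *-zeroʳ (δ (ε i) e))) (∑-zero (allFin k)))
    ... | true with covered e eq
    ...   | i₀ , refl = sym (trans (∑-cong (allFin k) (λ i → trans (*-identityʳ _) (same i₀ i))) (∑F-δ i₀))

  -- The cycle traced by a good walk

  module NewEdge {n} (G : Graph n) (u : Fin (nEdges G) → Bool) (D : ℕ) (0<D : 0 < D)
    (0<u : 0 < ∑F (λ e → ⟦ u e ⟧))
    (trimmed : ∀ x → Incidence.degree-in G u x ≡ 0 ⊎ D ≤ Incidence.degree-in G u x)
    {k : ℕ} (2≤k : 2 ≤ k) (x : Fin n) (v : Vec (Fin n) (suc k)) where

    open Incidence G
    open Step G u D 0<D 0<u trimmed

    private
      N = suc k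

    weight-pos : ∀ {j} (x : V) (v : Vec V j) → 0 < weight A x v plain → ∀ i → 0 < A (lookup (x ∷ v) (inject₁ i)) (lookup v i)
    weight-pos x (z ∷ v) h zero = pos-*ˡ h
    weight-pos x (z ∷ v) h (suc i) = weight-pos z v (pos-*ʳ {reciprocal (degree-in u z)} (pos-*ʳ {A x z} h)) i

    end-last : ∀ {j} x (v : Vec V (suc j)) → end x v ≡ lookup v (fromℕ j)
    end-last x (z ∷ []) = refl
    end-last x (z ∷ z′ ∷ v) = end-last z (z′ ∷ v)

    into-weight : ∀ y {j} x (v : Vec V j) p → (∀ i → lookup p i ≡ true → lookup v i ≡ y) → weight A x v plain ≡ weight (into y) x v p
    into-weight y x [] [] h = refl
    into-weight y x (z ∷ v) (false ∷ p) h = cong (λ s → A x z * (reciprocal (degree-in u z) * s)) (into-weight y z v p (h ∘ suc))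
    into-weight y x (z ∷ v) (true ∷ p) h = cong₂ (λ s t → s * (reciprocal (degree-in u z) * t))
      (trans (sym (*-identityʳ (A x z))) (cong (A x z *_) (sym (trans (cong (δ z) (sym (h zero refl))) (δ-refl z))))) (into-weight y z v p (h ∘ suc))

    product≡0 : ∀ Z {j} (v : Vec V j) → product Z v ≡ 0 → ∃[ i ] Z (lookup v i) ≡ 0
    product≡0 Z (z ∷ v) h with m*n≡0⇒m≡0∨n≡0 (Z z) h
    ... | inj₁ p = zero , p
    ... | inj₂ q with product≡0 Z v q
    ...   | i , p = suc i , p

    pair-mask : Fin N → Fin N → Vec Bool N
    pair-mask i j = Vec.tabulate (λ l → does (i Finₚ.≟ l) ∨ does (j Finₚ.≟ l))

    pair-mask-trues : ∀ i j → i ≢ j → trues (toList (pair-mask i j)) ≡ 2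
    pair-mask-trues i j i≢j = trans (trues≡∑ (pair-mask i j)) (trans (∑-cong (allFin N) step) (trans (∑-+ (allFin N) (δ i) (δ j)) (cong₂ _+_ (∑F-δ i) (∑F-δ j))))
      where
      step : ∀ l → ⟦ lookup (pair-mask i j) l ⟧ ≡ δ i l + δ j l
      step l rewrite lookup∘tabulate (λ l → does (i Finₚ.≟ l) ∨ does (j Finₚ.≟ l)) l with i Finₚ.≟ l | j Finₚ.≟ l
      ... | yes p | yes q = contradiction (trans p (sym q)) i≢j
      ... | yes p | no _ = refl
      ... | no _ | yes q = refl
      ... | no _ | no _ = refl

    pair-mask-true : ∀ i j l → lookup (pair-mask i j) l ≡ true → l ≡ i ⊎ l ≡ j
    pair-mask-true i j l h rewrite lookup∘tabulate (λ l → does (i Finₚ.≟ l) ∨ does (j Finₚ.≟ l)) l with i Finₚ.≟ l | j Finₚ.≟ l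
    ... | yes p | _ = inj₁ (sym p)
    ... | no _ | yes q = inj₂ (sym q)
    pair-mask-true i j l () | no _ | no _

    module _ (0<closed : 0 < closed A x v plain)
      (no-coincidence : ∀ p → trues (toList p) ≡ 2 → ∑F (λ y → closed (into y) x v p) < closed A x v plain) where

      tgt : Fin N → V
      tgt = lookup v

      -- If two targets agreed, the mask of these two steps would put the whole weight of the walk
      -- into the single summand `y = tgt i`, against `no-coincidence`.
      tgt-injective : Injective _≡_ _≡_ tgt
      tgt-injective {i} {j} eq with i Finₚ.≟ j
      ... | yes p = p
      ... | no i≢j = contradiction (no-coincidence (pair-mask i j) (pair-mask-trues i j i≢j))
          (≤⇒≯ (≤-trans (≤-reflexive (cong (_* δ (end x v) x) (into-weight (tgt i) x v (pair-mask i j) same)))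
            (term≤∑F (λ y → closed (into y) x v (pair-mask i j)) (tgt i))))
        where
        same : ∀ l → lookup (pair-mask i j) l ≡ true → lookup v l ≡ tgt i
        same l h with pair-mask-true i j l h
        ... | inj₁ refl = refl
        ... | inj₂ refl = sym eq

      end≡x : end x v ≡ x
      end≡x = δ>0 (pos-*ʳ {weight A x v plain} 0<closed)

      src-prev : ∀ i → lookup (x ∷ v) (inject₁ i) ≡ tgt (prev i)
      src-prev zero    = trans (sym end≡x) (end-last x v)
      src-prev (suc i) = refl

      A-step : ∀ i → 0 < A (tgt (prev i)) (tgt i)
      A-step i = subst (λ s → 0 < A s (tgt i)) (src-prev i) (weight-pos x v (pos-*ˡ 0<closed) i)

      abstract
        ε : Fin N → E
        ε i = proj₁ (Adj>0 u _ _ (A-step i))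

        ε-allowed : ∀ i → u (ε i) ≡ true
        ε-allowed i = proj₁ (proj₂ (Adj>0 u _ _ (A-step i)))

        ε-joins : ∀ i → 0 < J (ε i) (tgt (prev i)) (tgt i)
        ε-joins i = proj₂ (proj₂ (Adj>0 u _ _ (A-step i)))

      ε-injective : Injective _≡_ _≡_ ε
      ε-injective {i} {j} eq = cases (J⇒Joins (ε-joins i)) (J⇒Joins (subst (λ e → 0 < J e (tgt (prev j)) (tgt j)) (sym eq) (ε-joins j)))
        where
        swapped : tgt (prev i) ≡ tgt j → tgt i ≡ tgt (prev j) → i ≡ j
        swapped p q = contradiction (trans (cong prev (tgt-injective p)) (sym (tgt-injective q))) (prev-prev 2≤k i)
        cases : Joins (edgeAt G (ε i)) (tgt (prev i)) (tgt i) → Joins (edgeAt G (ε i)) (tgt (prev j)) (tgt j) → i ≡ j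
        cases (inj₁ (a , b)) (inj₁ (c , d)) = tgt-injective (trans (sym b) d)
        cases (inj₂ (a , b)) (inj₂ (c , d)) = tgt-injective (trans (sym a) c)
        cases (inj₁ (a , b)) (inj₂ (c , d)) = swapped (trans (sym a) c) (trans (sym b) d)
        cases (inj₂ (a , b)) (inj₁ (c , d)) = swapped (trans (sym b) d) (trans (sym a) c)

      new : Subset (nEdges G)
      new = Vec.tabulate (λ e → does (Finₚ.any? (λ i → ε i Finₚ.≟ e)))

      new-sound : ∀ e → lookup new e ≡ true → ∃[ i ] ε i ≡ e
      new-sound e h = does-true (Finₚ.any? (λ i → ε i Finₚ.≟ e))
        (trans (sym (lookup∘tabulate (λ e → does (Finₚ.any? (λ i → ε i Finₚ.≟ e))) e)) h)

      new-complete : ∀ i → lookup new (ε i) ≡ true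
      new-complete i = trans (lookup∘tabulate (λ e → does (Finₚ.any? (λ i → ε i Finₚ.≟ e))) (ε i))
        (dec-true (Finₚ.any? (λ j → ε j Finₚ.≟ ε i)) (i , refl))

      new-allowed : ∀ e → lookup new e ≡ true → u e ≡ true
      new-allowed e h with new-sound e h
      ... | i , refl = ε-allowed i

      ∣new∣ : ∣ new ∣ ≡ N
      ∣new∣ = trans (∣image∣ ε ε-injective new new-sound) (trans (∑-cong (allFin N) (λ i → cong ⟦_⟧ (new-complete i)))
        (trans (∑-const (allFin N) 1) (trans (*-identityʳ _) (length-allFin N))))

      new-isCycle : IsCycleCopy G N new
      new-isCycle = tgt , tgt-injective ,
        (λ i j adj → ε j , J⇒Joins (subst (λ s → 0 < J (ε j) (tgt s) (tgt j)) (CycAdj⇒prev i j adj) (ε-joins j))) ,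
        (λ e e∈ → sound e (new-sound e ([]=⇒lookup e∈))) ,
        (λ e i j adj joins → lookup⇒[]= e new (subst (λ s → lookup new s ≡ true)
          (J-unique (subst (λ s → 0 < J (ε j) (tgt s) (tgt j)) (CycAdj⇒prev i j adj) (ε-joins j)) (Joins⇒J joins)) (new-complete j)))
        where
        sound : ∀ e → ∃[ i ] ε i ≡ e → ∃₂ λ i j → CycAdj N i j × Joins (edgeAt G e) (tgt i) (tgt j)
        sound e (j , refl) = prev j , j , CycAdj-prev j , J⇒Joins (ε-joins j)

      sub-mask : Subset (nEdges G) → Vec Bool N
      sub-mask σ = Vec.tabulate (λ i → lookup σ (ε i))

      sub-mask-trues : ∀ σ → σ ⊆ new → trues (toList (sub-mask σ)) ≡ ∣ σ ∣
      sub-mask-trues σ σ⊆ = trans (trues≡∑ (sub-mask σ)) (trans (∑-cong (allFin N) (λ i → cong ⟦_⟧ (lookup∘tabulate (λ i → lookup σ (ε i)) i)))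
        (sym (∣image∣ ε ε-injective σ (λ e h → new-sound e (⊆⇒lookup σ⊆ e h)))))

      -- Together with `deg-antitone` this carries the degree bound from the edges traversed at the
      -- marked steps over to `σ`.
      traversed⊆ : ∀ σ → traversed x v (sub-mask σ) ⊆ σ
      traversed⊆ σ = lookup⇒⊆ {σ = traversed x v (sub-mask σ)} λ e h →
        step e (hit-sound e x v (sub-mask σ) (trans (sym (lookup∘tabulate (λ e → hit e x v (sub-mask σ)) e)) h))
        where
        step : ∀ e → ∃[ i ] (lookup (sub-mask σ) i ≡ true × 0 < J e (lookup (x ∷ v) (inject₁ i)) (lookup v i)) → lookup σ e ≡ true
        step e (i , q , j) = subst (λ s → lookup σ s ≡ true) (J-unique (ε-joins i) (subst (λ s → 0 < J e s (tgt i)) (src-prev i) j))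
          (trans (sym (lookup∘tabulate (λ i → lookup σ (ε i)) i)) q)

      incident-pos : ∀ h e y z → lookup h e ≡ true → 0 < J e y z → 0 < incident h y
      incident-pos h e y z h∋e j = <-≤-trans (<-≤-trans j (≤-trans (≤-reflexive (trans (sym (*-identityˡ _)) (cong (λ b → ⟦ b ⟧ * J e y z) (sym h∋e))))
        (term≤∑F (λ e → ⟦ lookup h e ⟧ * J e y z) e))) (term≤∑F (Adj (lookup h) y) z)

      -- The vertex `tgt i` lies on no edge of `h` but on two edges of the cycle, `ε i` entering it
      -- and `ε j` leaving it. Neither can belong to `σ`.
      overlap-at : ∀ h σ → σ ⊆ new → σ ⊆ h → ∀ i j → prev j ≡ i → incident h (tgt i) ≡ 0 → 2 + ∣ σ ∣ ≤ N
      overlap-at h σ σ⊆new σ⊆h i j refl zi = begin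
          2 + ∣ σ ∣ ≡⟨ cong (2 +_) (∣image∣ ε ε-injective σ (λ e h → new-sound e (⊆⇒lookup σ⊆new e h))) ⟩
          2 + ∑F (λ l → ⟦ lookup σ (ε l) ⟧) ≡⟨ cong (_+ ∑F (λ l → ⟦ lookup σ (ε l) ⟧)) (sym (cong₂ _+_ (∑F-δ i) (∑F-δ j))) ⟩
          ∑F (δ i) + ∑F (δ j) + ∑F (λ l → ⟦ lookup σ (ε l) ⟧) ≡⟨ cong (_+ ∑F (λ l → ⟦ lookup σ (ε l) ⟧)) (sym (∑-+ (allFin N) (δ i) (δ j))) ⟩
          ∑F (λ l → δ i l + δ j l) + ∑F (λ l → ⟦ lookup σ (ε l) ⟧) ≡⟨ sym (∑-+ (allFin N) (λ l → δ i l + δ j l) (λ l → ⟦ lookup σ (ε l) ⟧)) ⟩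
          ∑F (λ l → δ i l + δ j l + ⟦ lookup σ (ε l) ⟧) ≤⟨ ∑-mono (allFin N) step ⟩
          ∑F (λ (_ : Fin N) → 1) ≡⟨ trans (∑-const (allFin N) 1) (trans (*-identityʳ _) (length-allFin N)) ⟩
          N ∎
        where
        open ≤-Reasoning
        absent : ∀ e z → 0 < J e (tgt i) z → lookup σ e ≡ false
        absent e z j with lookup σ e in eq
        ... | false = refl
        ... | true = contradiction (incident-pos h e (tgt i) z (⊆⇒lookup σ⊆h e eq) j) (≤⇒≯ (≤-reflexive zi))
        absent-i : lookup σ (ε i) ≡ false
        absent-i = absent (ε i) (tgt (prev i)) (subst (0 <_) (J-sym (ε i) _ _) (ε-joins i))
        absent-j : lookup σ (ε j) ≡ false
        absent-j = absent (ε j) (tgt j) (ε-joins j)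
        step : ∀ l → δ i l + δ j l + ⟦ lookup σ (ε l) ⟧ ≤ 1
        step l with i Finₚ.≟ l | j Finₚ.≟ l
        ... | yes refl | yes q = contradiction (sym q) (prev-≢ (≤-trans (n≤1+n 1) 2≤k) j)
        ... | yes refl | no _  = ≤-reflexive (cong (λ b → 1 + ⟦ b ⟧) absent-i)
        ... | no _ | yes refl  = ≤-reflexive (cong (λ b → 1 + ⟦ b ⟧) absent-j)
        ... | no _ | no _      = ⟦⟧≤1 _

      overlap-small : ∀ h → product (incident h) v ≡ 0 → ∀ σ → σ ⊆ new → σ ⊆ h → 2 + ∣ σ ∣ ≤ N
      overlap-small h h≡0 σ σ⊆new σ⊆h = overlap-at h σ σ⊆new σ⊆h i j (proj₂ (prev-surjective i)) (proj₂ (product≡0 (incident h) v h≡0))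
        where
        i = proj₁ (product≡0 (incident h) v h≡0)
        j = proj₁ (prev-surjective i)

  -- The constants and the greedy construction

  module Constants (r : ℕ) where

    N β b₂ : ℕ
    N  = suc r + suc r
    β  = N * 2
    b₂ = β * (β * β) ^ N

    -- With K, C and Λ₀, each of the three kinds of bad closed walks weighs at most a quarter of all
    -- closed walks; the further factor in Λ keeps the saturated edges few.
    abstract
      K C Λ₀ Λ : ℕ
      K  = 4 * 2 ^ N * 4
      C  = 4 * 2 ^ N * (2 * b₂)
      Λ₀ = 4 * 1 * β ^ N
      Λ  = Λ₀ * (N * 4 ^ r)

      K≡ : K ≡ 4 * 2 ^ N * 4
      K≡ = refl
      C≡ : C ≡ 4 * 2 ^ N * (2 * b₂)
      C≡ = refl
      Λ₀≡ : Λ₀ ≡ 4 * 1 * β ^ N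
      Λ₀≡ = refl
      Λ≡ : Λ ≡ Λ₀ * (N * 4 ^ r)
      Λ≡ = refl

    instance
      N*4^r≢0 : NonZero (N * 4 ^ r)
      N*4^r≢0 = m*n≢0 N (4 ^ r) {{_}} {{m^n≢0 4 r}}
      Λ₀≢0 : NonZero Λ₀
      Λ₀≢0 = subst NonZero (sym Λ₀≡) (m*n≢0 4 (β ^ N) {{_}} {{m^n≢0 β N}})
      Λ≢0 : NonZero Λ
      Λ≢0 = subst NonZero (sym Λ≡) (m*n≢0 Λ₀ (N * 4 ^ r))

  if-middle-absorbs : ∀ t f s c → 2 ≤ t → 2 ≤ f → if-middle t f s * c < c → s ≡ 0
  if-middle-absorbs (suc (suc t)) (suc (suc f)) zero    c _ _ h = refl
  if-middle-absorbs (suc (suc t)) (suc (suc f)) (suc s) c _ _ h = contradiction h (≤⇒≯ (m≤m+n c (s * c)))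
  if-middle-absorbs (suc zero) _ s c (s≤s ()) _ h
  if-middle-absorbs (suc (suc t)) (suc zero) s c _ (s≤s ()) h

  does-false : ∀ {P : Set} (dec : Dec P) → ⟦ not (does dec) ⟧ ≡ 0 → P
  does-false (yes p) h = p

  -- `suc B` rounds suffice, for then already the length exceeds `B`.
  grow-list : ∀ {X : Set} (P : List X → Set) Λ B .{{_ : NonZero Λ}} → P [] →
    (∀ xs → P xs → Λ * length xs ≤ B → ∃[ x ] P (x ∷ xs)) → ∃[ xs ] (P xs × B < Λ * length xs)
  grow-list {X} P Λ B p[] step = finish (grow (suc B))
    where
    grow : ∀ k → ∃[ xs ] (P xs × (length xs ≡ k ⊎ B < Λ * length xs))
    grow zero = [] , p[] , inj₁ refl
    grow (suc k) with grow k
    ... | xs , p , inj₂ done = xs , p , inj₂ done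
    ... | xs , p , inj₁ refl with Λ * length xs ≤? B
    ...   | no ¬q = xs , p , inj₂ (≰⇒> ¬q)
    ...   | yes q with step xs p q
    ...     | x , p′ = x ∷ xs , p′ , inj₁ refl
    finish : ∃[ xs ] (P xs × (length xs ≡ suc B ⊎ B < Λ * length xs)) → ∃[ xs ] (P xs × B < Λ * length xs)
    finish (xs , p , inj₂ done) = xs , p , done
    finish (xs , p , inj₁ eq) = xs , p , <-≤-trans (subst (B <_) (sym eq) (n<1+n B)) (m≤n*m (length xs) Λ)

  module Greedy {n} (G : Graph n) (r : ℕ) (0<r : 0 < r) (D S : ℕ) (0<D : 0 < D) (0<S : 0 < S) (0<n : 0 < n)
    (S≤D : S ≤ D) (hS : (S * S) ^ r * n ≤ D * (D * D) ^ r) (hS′ : D * (D * D) ^ r ≤ 4 ^ r * (S * S) ^ r * n)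
    (hK : Constants.K r * D ≤ 4 * (S * S)) (many-edges : 4 * (n * D) ≤ nEdges G) where

    open Constants r

    private
      m = nEdges G
      es = allFin m
      W = (S * S) ^ r

    -- The invariant of the construction. Single edges, sizes from 2 to 2ℓ-2 and size 2ℓ-1 are kept
    -- apart, because the three are preserved for different reasons: unsaturated edges, unsaturated
    -- marked sets, and small overlaps.
    record Balanced (Hs : List (Subset m)) : Set where
      field
        no-repeats : Unique Hs
        sizes    : All (λ h → ∣ h ∣ ≡ N) Hs
        cycles   : All (IsCycleCopy G N) Hs
        deg-edge : ∀ e → deg₁ Hs e ≤ W
        deg-mid  : ∀ σ → 2 ≤ ∣ σ ∣ → 2 + ∣ σ ∣ ≤ N → deg Hs σ * (S * S) ^ ∣ σ ∣ ≤ C * ((S * S) ^ suc r * D ^ (∣ σ ∣ ∸ 1))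
        deg-top  : ∀ σ → suc ∣ σ ∣ ≡ N → deg Hs σ ≤ 1

    private
      saturated : List (Subset m) → Fin m → Bool
      saturated Hs e = does (W ≤? deg₁ Hs e)

      -- Double counting: `W` times the number of saturated edges is at most `N * length Hs`, and by
      -- `hS′` the bound `D ^ N` is at most `4 ^ r * W * n * D`. The factor `N * 4 ^ r` of `Λ`
      -- cancels both losses, and `Λ₀ ≥ 4` supplies the 4.
      few-saturated : ∀ Hs → All (λ h → ∣ h ∣ ≡ N) Hs → Λ * length Hs ≤ D ^ N → 4 * ∑F (λ e → ⟦ saturated Hs e ⟧) ≤ D * n
      few-saturated Hs sizes hΛ = *-cancelˡ-≤ (W * (N * 4 ^ r)) {{m*n≢0 W (N * 4 ^ r) {{W≢0}}}} (begin
          W * (N * 4 ^ r) * (4 * s) ≡⟨ lem W (N * 4 ^ r) s ⟩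
          4 * (N * 4 ^ r) * (W * s) ≤⟨ *-monoʳ-≤ (4 * (N * 4 ^ r)) count ⟩
          4 * (N * 4 ^ r) * (length Hs * N) ≤⟨ *-monoˡ-≤ (length Hs * N) Λ-big ⟩
          Λ * (length Hs * N) ≡⟨ sym (*-assoc Λ _ N) ⟩
          Λ * length Hs * N ≤⟨ *-monoˡ-≤ N hΛ ⟩
          D ^ N * N ≡⟨ cong (_* N) D^N ⟩
          D * (D * (D * D) ^ r) * N ≤⟨ *-monoˡ-≤ N (*-monoʳ-≤ D hS′) ⟩
          D * (4 ^ r * W * n) * N ≡⟨ lem₂ D (4 ^ r) W n N ⟩
          W * (N * 4 ^ r) * (D * n) ∎)
        where
        open ≤-Reasoning
        instance
          _ = >-nonZero 0<S
        W≢0 : NonZero W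
        W≢0 = m^n≢0 (S * S) r {{m*n≢0 S S}}
        s = ∑F (λ e → ⟦ saturated Hs e ⟧)
        lem : ∀ w a s → w * a * (4 * s) ≡ 4 * a * (w * s)
        lem = solve-∀
        lem₂ : ∀ D q w n N → D * (q * w * n) * N ≡ w * (N * q) * (D * n)
        lem₂ = solve-∀
        Λ-big : 4 * (N * 4 ^ r) ≤ Λ
        Λ-big = ≤-trans (*-monoˡ-≤ (N * 4 ^ r) (≤-trans (≤-trans (≤-reflexive (sym (*-identityʳ 4))) (*-monoʳ-≤ 4 (m^n>0 β N))) (≤-reflexive (sym Λ₀≡)))) (≤-reflexive (sym Λ≡))
        D^N : D ^ N ≡ D * (D * (D * D) ^ r)
        D^N = trans (^-distribˡ-+-* D (suc r) (suc r)) (trans (lem₃ D (D ^ r)) (cong (λ u → D * (D * u)) (sym (^-*-distrib D D r))))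
          where lem₃ : ∀ d p → d * p * (d * p) ≡ d * (d * (p * p))
                lem₃ = solve-∀
        sat-≤ : ∀ e → W * ⟦ saturated Hs e ⟧ ≤ deg₁ Hs e
        sat-≤ e = by-decision (W ≤? deg₁ Hs e)
          where
          by-decision : (dec : Dec (W ≤ deg₁ Hs e)) → W * ⟦ does dec ⟧ ≤ deg₁ Hs e
          by-decision (yes p) = ≤-trans (≤-reflexive (*-identityʳ W)) p
          by-decision (no _)  = ≤-trans (≤-reflexive (*-zeroʳ W)) z≤n
        count : W * s ≤ length Hs * N
        count = begin
          W * s ≡⟨ sym (∑-*ˡ es W _) ⟩
          ∑F (λ e → W * ⟦ saturated Hs e ⟧) ≤⟨ ∑-mono es sat-≤ ⟩
          ∑F (λ e → ∑ Hs (λ h → ⟦ lookup h e ⟧)) ≡⟨ ∑-swap es Hs _ ⟩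
          ∑ Hs (λ h → ∑F (λ e → ⟦ lookup h e ⟧)) ≤⟨ ∑-mono-∈ Hs (λ h h∈ → ≤-reflexive (trans (sym (∣∣≡∑ h)) (All.lookup sizes h∈))) ⟩
          ∑ Hs (λ _ → N) ≡⟨ ∑-const Hs N ⟩
          length Hs * N ∎

      many-unsaturated : ∀ Hs → 4 * ∑F (λ e → ⟦ saturated Hs e ⟧) ≤ D * n → D * n < ∑F (λ e → ⟦ not (saturated Hs e) ⟧)
      -- Otherwise `4 * m`, which is at least `16 * (D * n)`, would be at most `5 * (D * n)`.
      many-unsaturated Hs few = ≰⇒> λ le → <⇒≱ (m<m+n (5 * (D * n)) (>-nonZero⁻¹ _ {{m*n≢0 11 (D * n) {{_}} {{m*n≢0 D n}}}})) (begin
          5 * (D * n) + 11 * (D * n) ≡⟨ lem D n ⟩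
          4 * (4 * (n * D)) ≤⟨ *-monoʳ-≤ 4 many-edges ⟩
          4 * m ≡⟨ cong (4 *_) m≡ ⟩
          4 * (free + s) ≡⟨ *-distribˡ-+ 4 free s ⟩
          4 * free + 4 * s ≤⟨ +-mono-≤ (*-monoʳ-≤ 4 le) few ⟩
          4 * (D * n) + D * n ≡⟨ +-comm (4 * (D * n)) _ ⟩
          5 * (D * n) ∎)
        where
        open ≤-Reasoning
        instance
          _ = >-nonZero 0<D
          _ = >-nonZero 0<n
        s = ∑F (λ e → ⟦ saturated Hs e ⟧)
        free = ∑F (λ e → ⟦ not (saturated Hs e) ⟧)
        lem : ∀ D n → 5 * (D * n) + 11 * (D * n) ≡ 4 * (4 * (n * D))
        lem = solve-∀
        complement : ∀ b → 1 ≡ ⟦ not b ⟧ + ⟦ b ⟧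
        complement true  = refl
        complement false = refl
        m≡ : m ≡ free + s
        m≡ = trans (sym (trans (∑-const es 1) (trans (*-identityʳ _) (length-allFin m))))
          (trans (∑-cong es (λ e → complement (saturated Hs e))) (∑-+ es _ _))

      unsaturated-deg : ∀ Hs e → not (saturated Hs e) ≡ true → suc (deg₁ Hs e) ≤ W
      unsaturated-deg Hs e = by-decision (W ≤? deg₁ Hs e)
        where
        by-decision : (dec : Dec (W ≤ deg₁ Hs e)) → not (does dec) ≡ true → suc (deg₁ Hs e) ≤ W
        by-decision (no ¬p) _ = ≰⇒> ¬p

    module AddCycle (Hs : List (Subset m)) (bal : Balanced Hs) (u : Fin m → Bool)

      (u⊆ : ∀ e → u e ≡ true → not (saturated Hs e) ≡ true) (0<u : 0 < ∑F (λ e → ⟦ u e ⟧))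

      (trimmed : ∀ x → Incidence.degree-in G u x ≡ 0 ⊎ D ≤ Incidence.degree-in G u x) where

      open Balanced bal
      module St = Step G u D 0<D 0<u trimmed
      module Se = St.Search r 0<r S 0<S S≤D hS Hs (λ h h∈ → All.lookup sizes h∈) deg-edge

      2≤k : 2 ≤ r + suc r
      2≤k = +-mono-≤ 0<r (s≤s z≤n)

      module _ (x : Fin n) (v : Vec (Fin n) N) where

        c : ℕ
        c = St.closed St.A x v St.plain

        module _ (no-coincidence : ∀ p → Se.coincidences x v p < c)

          (no-saturation : ∀ p → Se.saturation C x v p * c < c)

          (no-confinement : ∀ h → h ∈ Hs → c * St.product (St.incident h) v < c) where

          0<c : 0 < c
          0<c = ≤-<-trans z≤n (no-coincidence St.plain)

          if-two-≡ : ∀ p → trues (toList p) ≡ 2 → ∑F (λ y → St.closed (St.into y) x v p) < c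
          if-two-≡ p h = subst (λ t → if-two t (∑F (λ y → St.closed (St.into y) x v p)) < c) h (no-coincidence p)

          module Ne = NewEdge G u D 0<D 0<u trimmed 2≤k x v

          new = Ne.new 0<c if-two-≡
          ∣new∣ = Ne.∣new∣ 0<c if-two-≡
          new-isCycle = Ne.new-isCycle 0<c if-two-≡
          overlap-small = Ne.overlap-small 0<c if-two-≡
          sub-mask = Ne.sub-mask 0<c if-two-≡

          confined≡0 : ∀ h → h ∈ Hs → St.product (St.incident h) v ≡ 0
          confined≡0 h h∈ with St.product (St.incident h) v | no-confinement h h∈
          ... | zero  | _ = refl
          ... | suc k | q = contradiction q (≤⇒≯ (m≤m*n c (suc k)))

          edge-bound : ∀ e b → lookup new e ≡ b → ⟦ lookup new e ⟧ + deg₁ Hs e ≤ W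
          edge-bound e false eq = subst (λ b → ⟦ b ⟧ + deg₁ Hs e ≤ W) (sym eq) (deg-edge e)
          edge-bound e true  eq = subst (λ b → ⟦ b ⟧ + deg₁ Hs e ≤ W) (sym eq)
            (unsaturated-deg Hs e (u⊆ e (Ne.new-allowed 0<c if-two-≡ e eq)))

          mid-bound : ∀ σ → 2 ≤ ∣ σ ∣ → 2 + ∣ σ ∣ ≤ N → (dec : Dec (σ ⊆ new)) →
            (⟦ does dec ⟧ + deg Hs σ) * (S * S) ^ ∣ σ ∣ ≤ C * ((S * S) ^ suc r * D ^ (∣ σ ∣ ∸ 1))
          mid-bound σ 2≤ ≤N (no _) = deg-mid σ 2≤ ≤N
          mid-bound σ 2≤ ≤N (yes σ⊆) = ≤-trans (*-monoˡ-≤ ((S * S) ^ ∣ σ ∣) (s≤s (deg-antitone Hs (Ne.traversed⊆ 0<c if-two-≡ σ))))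
            (subst (λ j → suc (deg Hs (St.traversed x v (sub-mask σ))) * (S * S) ^ j ≤ C * ((S * S) ^ suc r * D ^ (j ∸ 1))) tr unsat)
            where
            tr : trues (toList (sub-mask σ)) ≡ ∣ σ ∣
            tr = Ne.sub-mask-trues 0<c if-two-≡ σ σ⊆
            fl : 2 ≤ falses (toList (sub-mask σ))
            fl = +-cancelʳ-≤ ∣ σ ∣ 2 _ (≤-trans ≤N (≤-reflexive (trans (sym (trues+falses (sub-mask σ)))
              (trans (+-comm (trues (toList (sub-mask σ))) _) (cong (falses (toList (sub-mask σ)) +_) tr)))))
            unsat : Se.Unsaturated C x v (sub-mask σ)
            unsat = does-false (Se.unsaturated? C x v (sub-mask σ)) (if-middle-absorbs _ _ _ c (subst (2 ≤_) (sym tr) 2≤) fl (no-saturation (sub-mask σ)))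

          -- A set of size 2ℓ-1 inside the new cycle lies in no earlier hyperedge, because the
          -- overlaps have at most 2ℓ-2 edges.
          top-bound : ∀ σ → suc ∣ σ ∣ ≡ N → (dec : Dec (σ ⊆ new)) → ⟦ does dec ⟧ + deg Hs σ ≤ 1
          top-bound σ eq (no _) = deg-top σ eq
          top-bound σ eq (yes σ⊆) = s≤s (≮⇒≥ λ 0<deg → disjoint (∑->0⇒∃ Hs _ 0<deg))
            where
            disjoint : ¬ (∃[ h ] (h ∈ Hs × 0 < ⟦ does (σ ⊆? h) ⟧))
            disjoint (h , h∈ , p) = by-decision (σ ⊆? h) p
              where
              by-decision : (dec : Dec (σ ⊆ h)) → 0 < ⟦ does dec ⟧ → ⊥
              by-decision (yes s) _ = <⇒≱ (≤-reflexive (cong suc (sym eq))) (overlap-small h (confined≡0 h h∈) σ σ⊆ s)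

          new-fresh : ∀ {h} → h ∈ Hs → new ≢ h
          new-fresh {h} h∈ eq = <⇒≱ (s≤s (n≤1+n N)) (subst (λ s → 2 + s ≤ N) ∣new∣
            (overlap-small h (confined≡0 h h∈) new (λ p → p) (λ {e} p → subst (e Data.Fin.Subset.∈_) eq p)))

          deg-edge′ : ∀ e → deg₁ (new ∷ Hs) e ≤ W
          deg-edge′ e = edge-bound e (lookup new e) refl

          deg-mid′ : ∀ σ → 2 ≤ ∣ σ ∣ → 2 + ∣ σ ∣ ≤ N → deg (new ∷ Hs) σ * (S * S) ^ ∣ σ ∣ ≤ C * ((S * S) ^ suc r * D ^ (∣ σ ∣ ∸ 1))
          deg-mid′ σ 2≤ ≤N = mid-bound σ 2≤ ≤N (σ ⊆? new)

          deg-top′ : ∀ σ → suc ∣ σ ∣ ≡ N → deg (new ∷ Hs) σ ≤ 1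
          deg-top′ σ eq = top-bound σ eq (σ ⊆? new)

          result : ∃[ h ] Balanced (h ∷ Hs)
          result = new , record
            { no-repeats = All.tabulate new-fresh ∷ no-repeats
            ; sizes    = ∣new∣ ∷ sizes
            ; cycles   = new-isCycle ∷ cycles
            ; deg-edge = deg-edge′
            ; deg-mid  = deg-mid′
            ; deg-top  = deg-top′
            }

      from-walk : Se.GoodWalk C → ∃[ h ] Balanced (h ∷ Hs)
      from-walk (x , v , h₁ , h₂ , h₃) = result x v h₁ h₂ h₃

      added : Λ₀ * length Hs ≤ D ^ N → ∃[ h ] Balanced (h ∷ Hs)
      added h = from-walk (Se.good-walk K C Λ₀ K≡ C≡ Λ₀≡ hK h)

    add-cycle : ∀ Hs → Balanced Hs → Λ * length Hs ≤ D ^ N → ∃[ h ] Balanced (h ∷ Hs)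
    add-cycle Hs bal hΛ = from-trimmed (Incidence.trim G D (λ e → not (saturated Hs e)) (many-unsaturated Hs (few-saturated Hs (Balanced.sizes bal) hΛ)))
      where
      Λ₀≤ : Λ₀ * length Hs ≤ D ^ N
      Λ₀≤ = ≤-trans (*-monoˡ-≤ (length Hs) (≤-trans (m≤m*n Λ₀ (N * 4 ^ r)) (≤-reflexive (sym Λ≡)))) hΛ
      from-trimmed : ∃[ u ] ((∀ e → u e ≡ true → not (saturated Hs e) ≡ true) × 0 < ∑F (λ e → ⟦ u e ⟧) ×
        (∀ x → Incidence.degree-in G u x ≡ 0 ⊎ D ≤ Incidence.degree-in G u x)) → ∃[ h ] Balanced (h ∷ Hs)
      from-trimmed (u , u⊆ , 0<u , trimmed) = AddCycle.added Hs bal u u⊆ 0<u trimmed Λ₀≤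

    private
      empty-balanced : Balanced []
      empty-balanced = record
        { no-repeats = [] ; sizes = [] ; cycles = [] ; deg-edge = λ _ → z≤n ; deg-mid = λ _ _ _ → z≤n ; deg-top = λ _ _ → z≤n }

    balanced-family : ∃[ Hs ] (Balanced Hs × D ^ N < Λ * length Hs)
    balanced-family = grow-list Balanced Λ (D ^ N) empty-balanced add-cycle

  -- Comparison of products of powers

  ^-cancel-≤ : ∀ k .{{_ : NonZero k}} {a b} → a ^ k ≤ b ^ k → a ≤ b
  ^-cancel-≤ k {a} {b} h with a ≤? b
  ... | yes p = p
  ... | no ¬p = contradiction h (<⇒≱ (^-monoˡ-< k (≰⇒> ¬p)))

  -- Both inequalities express one comparison of real powers, cleared by `q` and by `M`: the
  -- relations say (α₂-α₁)/q = (pe-ne)/M and (A₂-A₁)/q = (pn-nn)/M. Raising to the power `M` and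
  -- extracting the root of order `q` leads from the first to the second.
  power-compare : ∀ d C e n q M {α₁ α₂ A₁ A₂ pe ne pn nn} .{{_ : NonZero q}} .{{_ : NonZero e}} .{{_ : NonZero n}} →
    d ^ q * (e ^ α₁ * n ^ A₁) ≤ C ^ q * (e ^ α₂ * n ^ A₂) →
    q * pe + α₁ * M ≡ q * ne + α₂ * M →
    q * pn + A₁ * M ≡ q * nn + A₂ * M →
    d ^ M * (e ^ ne * n ^ nn) ≤ C ^ M * (e ^ pe * n ^ pn)
  power-compare d C e n q M {α₁} {α₂} {A₁} {A₂} {pe} {ne} {pn} {nn} h rel₁ rel₂ =
    ^-cancel-≤ q (*-cancelʳ-≤ _ _ (e ^ (α₁ * M) * n ^ (A₁ * M))
      {{m*n≢0 _ _ {{m^n≢0 e (α₁ * M)}} {{m^n≢0 n (A₁ * M)}}}} (begin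
        (d ^ M * (e ^ ne * n ^ nn)) ^ q * (e ^ (α₁ * M) * n ^ (A₁ * M))
          ≡⟨ split d ne nn α₁ A₁ ⟩
        (d ^ q * (e ^ α₁ * n ^ A₁)) ^ M * (e ^ (q * ne) * n ^ (q * nn))
          ≤⟨ *-monoˡ-≤ _ (^-monoˡ-≤ M h) ⟩
        (C ^ q * (e ^ α₂ * n ^ A₂)) ^ M * (e ^ (q * ne) * n ^ (q * nn))
          ≡⟨ sym (split C ne nn α₂ A₂) ⟩
        (C ^ M * (e ^ ne * n ^ nn)) ^ q * (e ^ (α₂ * M) * n ^ (A₂ * M))
          ≡⟨ gather C ne nn α₂ A₂ ⟩
        C ^ (M * q) * (e ^ (q * ne + α₂ * M) * n ^ (q * nn + A₂ * M))
          ≡⟨ cong₂ (λ i j → C ^ (M * q) * (e ^ i * n ^ j)) (sym rel₁) (sym rel₂) ⟩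
        C ^ (M * q) * (e ^ (q * pe + α₁ * M) * n ^ (q * pn + A₁ * M))
          ≡⟨ sym (gather C pe pn α₁ A₁) ⟩
        (C ^ M * (e ^ pe * n ^ pn)) ^ q * (e ^ (α₁ * M) * n ^ (A₁ * M)) ∎))
    where
    open ≤-Reasoning
    pow₃ : ∀ a b c k → (a * (b * c)) ^ k ≡ a ^ k * (b ^ k * c ^ k)
    pow₃ a b c k = trans (^-*-distrib a (b * c) k) (cong (a ^ k *_) (^-*-distrib b c k))
    swap-^ : ∀ a i j → (a ^ i) ^ j ≡ a ^ (j * i)
    swap-^ a i j = trans (^-*-assoc a i j) (cong (a ^_) (*-comm i j))
    lem : ∀ a b c x y → a * (b * c) * (x * y) ≡ a * (b * x * (c * y))
    lem = solve-∀
    lem₂ : ∀ a b c x y → a * (b * c) * (x * y) ≡ a * (x * y) * (b * c)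
    lem₂ = solve-∀
    gather : ∀ c i j α A → (c ^ M * (e ^ i * n ^ j)) ^ q * (e ^ (α * M) * n ^ (A * M)) ≡
      c ^ (M * q) * (e ^ (q * i + α * M) * n ^ (q * j + A * M))
    gather c i j α A = trans (cong (_* (e ^ (α * M) * n ^ (A * M))) (trans (pow₃ (c ^ M) (e ^ i) (n ^ j) q)
        (cong₂ _*_ (^-*-assoc c M q) (cong₂ _*_ (swap-^ e i q) (swap-^ n j q)))))
      (trans (lem (c ^ (M * q)) (e ^ (q * i)) (n ^ (q * j)) (e ^ (α * M)) (n ^ (A * M)))
        (cong (c ^ (M * q) *_) (sym (cong₂ _*_ (^-distribˡ-+-* e (q * i) (α * M)) (^-distribˡ-+-* n (q * j) (A * M))))))
    split : ∀ c i j α A → (c ^ M * (e ^ i * n ^ j)) ^ q * (e ^ (α * M) * n ^ (A * M)) ≡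
      (c ^ q * (e ^ α * n ^ A)) ^ M * (e ^ (q * i) * n ^ (q * j))
    split c i j α A = trans (cong (_* (e ^ (α * M) * n ^ (A * M))) (trans (pow₃ (c ^ M) (e ^ i) (n ^ j) q)
        (cong₂ _*_ (trans (^-*-assoc c M q) (trans (cong (c ^_) (*-comm M q)) (sym (^-*-assoc c q M)))) (cong₂ _*_ (swap-^ e i q) (swap-^ n j q)))))
      (trans (lem₂ ((c ^ q) ^ M) (e ^ (q * i)) (n ^ (q * j)) (e ^ (α * M)) (n ^ (A * M)))
        (cong (_* (e ^ (q * i) * n ^ (q * j))) (sym (trans (pow₃ (c ^ q) (e ^ α) (n ^ A) M)
          (cong ((c ^ q) ^ M *_) (cong₂ _*_ (^-*-assoc e α M) (^-*-assoc n A M)))))))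

  -- The scales `D` and `S`, and the bounds (a) and (b) in terms of them

  threshold : ∀ (f : ℕ → ℕ) B M → f 0 ≤ B → B < f M → ∃[ s ] (f s ≤ B × B < f (suc s))
  threshold f B zero    h₀ h = contradiction h (≤⇒≯ h₀)
  threshold f B (suc M) h₀ h with f M ≤? B
  ... | yes p = M , p , h
  ... | no ¬p = threshold f B M h₀ (≰⇒> ¬p)

  a≤a^k : ∀ a k .{{_ : NonZero a}} .{{_ : NonZero k}} → a ≤ a ^ k
  a≤a^k a (suc k) = m≤m*n a (a ^ k) {{m^n≢0 a k}}

  nEdges-upper : ∀ {n} (G : Graph n) → nEdges G ≤ n * n
  nEdges-upper {n} G = ≤-trans (m≤m*n (nEdges G) 2) (begin
      nEdges G * 2 ≡⟨ cong (_* 2) (sym (trans (∑-const (allFin (nEdges G)) 1) (trans (*-identityʳ _) (length-allFin (nEdges G))))) ⟩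
      ∑F {nEdges G} (λ _ → ⟦ true ⟧) * 2 ≡⟨ sym (∑∑Adj (λ _ → true)) ⟩
      ∑F (λ x → ∑F (Adj (λ _ → true) x)) ≤⟨ ∑-mono (allFin n) (degree≤n (λ _ → true)) ⟩
      ∑F (λ (_ : V) → n) ≡⟨ trans (∑-const (allFin n) n) (cong (_* n) (length-allFin n)) ⟩
      n * n ∎)
    where
    open Incidence G
    open ≤-Reasoning

  -- The parameters D ≈ k n^(1/ℓ) and S with S² / D ≈ k^(ℓ/(ℓ-1)), where ℓ = r + 1.
  record Scales (r n e K : ℕ) : Set where
    field
      D S       : ℕ
      0<D       : 0 < D
      0<S       : 0 < S
      S≤D       : S ≤ D
      S-upper   : (S * S) ^ r * n ≤ D * (D * D) ^ r
      S-lower   : D * (D * D) ^ r ≤ 4 ^ r * (S * S) ^ r * n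
      K*D≤      : K * D ≤ 4 * (S * S)
      D-upper   : 4 * (n * D) ≤ e
      D-lower   : e ≤ 8 * n * D

  -- The first hypothesis is e ≥ 8K n^(1+1/ℓ), raised to the power ℓ. It yields D ≥ K n^(1/ℓ), the
  -- source of all lower bounds here.
  scales : ∀ r n e K .{{_ : NonZero r}} .{{_ : NonZero n}} .{{_ : NonZero K}} →
    (8 * K) ^ suc r * n ^ suc (suc r) ≤ e ^ suc r → e ≤ n * n → Scales r n e K
  scales r n e K density e≤n² = record
      { D = D ; S = S ; 0<D = 0<D ; 0<S = 0<S ; S≤D = S≤D ; S-upper = S-upper ; S-lower = S-lower
      ; K*D≤ = K*D≤ ; D-upper = D-upper ; D-lower = D-lower }
    where
    open ≤-Reasoning
    instance
      4n≢0 : NonZero (4 * n)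
      4n≢0 = m*n≢0 4 n
    -- The 4 leaves edges to spare for the saturated ones and for trimming. Rounding down at most
    -- halves the quotient, whence the 8 in `D-lower`.
    D = e / (4 * n)
    D-upper : 4 * (n * D) ≤ e
    D-upper = ≤-trans (≤-reflexive (lem n D)) (m/n*n≤m e (4 * n))
      where lem : ∀ n d → 4 * (n * d) ≡ d * (4 * n)
            lem = solve-∀
    8Kn≤e : 8 * K * n ≤ e
    8Kn≤e = ^-cancel-≤ (suc r) (begin
      (8 * K * n) ^ suc r ≡⟨ ^-*-distrib (8 * K) n (suc r) ⟩
      (8 * K) ^ suc r * n ^ suc r ≤⟨ *-monoʳ-≤ ((8 * K) ^ suc r) (m≤n*m (n ^ suc r) n) ⟩
      (8 * K) ^ suc r * n ^ suc (suc r) ≤⟨ density ⟩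
      e ^ suc r ∎)
    e< : e ≤ 4 * n + D * (4 * n)
    e< = ≤-trans (≤-reflexive (m≡m%n+[m/n]*n e (4 * n))) (+-monoˡ-≤ (D * (4 * n)) (<⇒≤ (m%n<n e (4 * n))))
    0<D : 0 < D
    0<D with D in eq
    ... | suc _ = z<s
    ... | zero = contradiction (begin-strict
        4 * n <⟨ m<m+n (4 * n) (>-nonZero⁻¹ (4 * n)) ⟩
        4 * n + 4 * n ≤⟨ ≤-reflexive (lem n) ⟩
        8 * 1 * n ≤⟨ *-monoˡ-≤ n (*-monoʳ-≤ 8 (>-nonZero⁻¹ K)) ⟩
        8 * K * n ≤⟨ 8Kn≤e ⟩
        e ≤⟨ e< ⟩
        4 * n + D * (4 * n) ≡⟨ cong (λ d → 4 * n + d * (4 * n)) eq ⟩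
        4 * n + 0 ≡⟨ +-identityʳ _ ⟩
        4 * n ∎) (<-irrefl refl)
      where lem : ∀ n → 4 * n + 4 * n ≡ 8 * 1 * n
            lem = solve-∀
    instance
      D≢0 : NonZero D
      D≢0 = >-nonZero 0<D
    D-lower : e ≤ 8 * n * D
    D-lower = begin
      e ≤⟨ e< ⟩
      4 * n + D * (4 * n) ≤⟨ +-monoˡ-≤ (D * (4 * n)) (m≤n*m (4 * n) D) ⟩
      D * (4 * n) + D * (4 * n) ≡⟨ lem n D ⟩
      8 * n * D ∎
      where lem : ∀ n d → d * (4 * n) + d * (4 * n) ≡ 8 * n * d
            lem = solve-∀
    D-power : K ^ suc r * n ≤ D ^ suc r
    D-power = *-cancelˡ-≤ ((8 * n) ^ suc r) {{m^n≢0 (8 * n) (suc r) {{m*n≢0 8 n}}}} (begin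
      (8 * n) ^ suc r * (K ^ suc r * n) ≡⟨ cong (_* (K ^ suc r * n)) (^-*-distrib 8 n (suc r)) ⟩
      8 ^ suc r * n ^ suc r * (K ^ suc r * n) ≡⟨ lem (8 ^ suc r) (n ^ suc r) (K ^ suc r) n ⟩
      8 ^ suc r * K ^ suc r * (n * n ^ suc r) ≡⟨ cong (_* (n * n ^ suc r)) (sym (^-*-distrib 8 K (suc r))) ⟩
      (8 * K) ^ suc r * n ^ suc (suc r) ≤⟨ density ⟩
      e ^ suc r ≤⟨ ^-monoˡ-≤ (suc r) D-lower ⟩
      (8 * n * D) ^ suc r ≡⟨ ^-*-distrib (8 * n) D (suc r) ⟩
      (8 * n) ^ suc r * D ^ suc r ∎)
      where lem : ∀ a b c n → a * b * (c * n) ≡ a * c * (n * b)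
            lem = solve-∀
    D≤n : D ≤ n
    D≤n = *-cancelˡ-≤ n (≤-trans (≤-trans (m≤n*m (n * D) 4) D-upper) e≤n²)
    B = D * (D * D) ^ r
    f : ℕ → ℕ
    f s = (s * s) ^ r * n
    B-split : D ^ suc r * D ^ r ≡ B
    B-split = trans (*-assoc D (D ^ r) (D ^ r)) (cong (D *_) (sym (^-*-distrib D D r)))
    f0 : f 0 ≤ B
    f0 = ≤-trans (≤-reflexive (cong (_* n) (0^ r))) z≤n
      where
      0^ : ∀ r .{{_ : NonZero r}} → 0 ^ r ≡ 0
      0^ (suc r) = refl
    f-large : B < f (suc B)
    f-large = begin
      suc B ≤⟨ m≤m*n (suc B) (suc B) ⟩
      suc B * suc B ≤⟨ a≤a^k (suc B * suc B) r ⟩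
      (suc B * suc B) ^ r ≤⟨ m≤m*n _ n ⟩
      (suc B * suc B) ^ r * n ∎
    -- `S` is the last value before S^(2r) n exceeds D^(2r+1). As `suc S ≤ 2 * S`, the rounding
    -- costs the factor `4 ^ r` of `S-lower`.
    found = threshold f B (suc B) f0 f-large
    S = proj₁ found
    S-upper : (S * S) ^ r * n ≤ B
    S-upper = proj₁ (proj₂ found)
    S-next : B < f (suc S)
    S-next = proj₂ (proj₂ found)
    n≤B : n ≤ B
    n≤B = begin
      n ≤⟨ m≤n*m n (K ^ suc r) {{m^n≢0 K (suc r)}} ⟩
      K ^ suc r * n ≤⟨ D-power ⟩
      D ^ suc r ≤⟨ m≤m*n (D ^ suc r) (D ^ r) {{m^n≢0 D r}} ⟩
      D ^ suc r * D ^ r ≡⟨ B-split ⟩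
      B ∎
    0<S : 0 < S
    0<S with S in eq
    ... | suc _ = z<s
    ... | zero = contradiction n≤B (<⇒≱ (<-≤-trans S-next (≤-reflexive
        (trans (cong (λ s → (suc s * suc s) ^ r * n) eq) (trans (cong (_* n) (^-zeroˡ r)) (*-identityˡ n))))))
    -- From `D ≤ n`: S^(2r) n ≤ D · D^(2r) ≤ n D^(2r).
    S≤D : S ≤ D
    S≤D = sq-cancel-≤ (^-cancel-≤ r (*-cancelʳ-≤ _ _ n (≤-trans S-upper (≤-trans (*-monoˡ-≤ ((D * D) ^ r) D≤n) (≤-reflexive (*-comm n _))))))
    S-lower : B ≤ 4 ^ r * (S * S) ^ r * n
    S-lower = begin
      B ≤⟨ <⇒≤ S-next ⟩
      (suc S * suc S) ^ r * n ≤⟨ *-monoˡ-≤ n (^-monoˡ-≤ r (*-mono-≤ S+1 S+1)) ⟩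
      ((S + S) * (S + S)) ^ r * n ≡⟨ cong (λ u → u ^ r * n) (lem S) ⟩
      (4 * (S * S)) ^ r * n ≡⟨ cong (_* n) (^-*-distrib 4 (S * S) r) ⟩
      4 ^ r * (S * S) ^ r * n ∎
      where
      S+1 : suc S ≤ S + S
      S+1 = +-monoˡ-≤ S 0<S
      lem : ∀ s → (s + s) * (s + s) ≡ 4 * (s * s)
      lem = solve-∀
    -- Here the density enters: S²/D is large, so that the coincidences, of relative weight D/S²,
    -- are rare.
    K*D≤ : K * D ≤ 4 * (S * S)
    K*D≤ = ^-cancel-≤ r (*-cancelʳ-≤ _ _ n (begin
      (K * D) ^ r * n ≡⟨ cong (_* n) (^-*-distrib K D r) ⟩
      K ^ r * D ^ r * n ≤⟨ *-monoˡ-≤ n (*-monoˡ-≤ (D ^ r) (m≤n*m (K ^ r) K)) ⟩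
      K ^ suc r * D ^ r * n ≡⟨ lem (K ^ suc r) (D ^ r) n ⟩
      K ^ suc r * n * D ^ r ≤⟨ *-monoˡ-≤ (D ^ r) D-power ⟩
      D ^ suc r * D ^ r ≡⟨ B-split ⟩
      B ≤⟨ S-lower ⟩
      4 ^ r * (S * S) ^ r * n ≡⟨ cong (_* n) (sym (^-*-distrib 4 (S * S) r)) ⟩
      (4 * (S * S)) ^ r * n ∎))
      where lem : ∀ a b n → a * b * n ≡ a * n * b
            lem = solve-∀

  -- The balance of the powers of `D` in `degree-bound`, where `i` is 2ℓ-2-|σ|. It is quadratic, so
  -- the relation between `i` and `j` is substituted several times.
  degree-exponent : ∀ r i j → i + suc j ≡ r + r → suc (r + r) * suc r + j * r ≡ suc (r + r) * suc j + suc (suc r * i)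
  degree-exponent r i j h = begin
    suc (r + r) * suc r + j * r ≡⟨ lem₁ r j ⟩
    (r + r) * r + (j * r + (r + r) + r + 1) ≡⟨ cong (λ a → a * r + (j * r + (r + r) + r + 1)) (sym h) ⟩
    (i + suc j) * r + (j * r + (r + r) + r + 1) ≡⟨ lem₂ r i j ⟩
    i * r + (suc (suc j) * (r + r) + 1) ≡⟨ cong (λ a → i * r + (suc (suc j) * a + 1)) (sym h) ⟩
    i * r + (suc (suc j) * (i + suc j) + 1) ≡⟨ lem₃ r i j ⟩
    suc (i + suc j) * suc j + suc (suc r * i) ≡⟨ cong (λ a → suc a * suc j + suc (suc r * i)) h ⟩
    suc (r + r) * suc j + suc (suc r * i) ∎
    where
    open ≡-Reasoning
    lem₁ : ∀ r j → suc (r + r) * suc r + j * r ≡ (r + r) * r + (j * r + (r + r) + r + 1)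
    lem₁ = solve-∀
    lem₂ : ∀ r i j → (i + suc j) * r + (j * r + (r + r) + r + 1) ≡ i * r + (suc (suc j) * (r + r) + 1)
    lem₂ = solve-∀
    lem₃ : ∀ r i j → i * r + (suc (suc j) * (i + suc j) + 1) ≡ suc (i + suc j) * suc j + suc (suc r * i)
    lem₃ = solve-∀

  module _ {r n e K} .{{_ : NonZero n}} (sc : Scales r n e K) where
    open Scales sc

    -- `S` is eliminated: after raising to the power `r` it occurs through S^(2r) only, which
    -- `S-lower` replaces on the left and `S-upper` on the right; then `D` gives way to e/n. The
    -- exponent `suc (suc r * i)` is ℓ-1 times that of k in (b).
    degree-bound : ∀ C d i j → i + suc j ≡ r + r → d * (S * S) ^ suc j ≤ C * ((S * S) ^ suc r * D ^ j) →
      d ^ r * n ^ (suc r + suc (suc r * i)) ≤ (C * 4 ^ suc j) ^ r * (n ^ suc j * e ^ suc (suc r * i))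
    degree-bound C d i j hi h = begin
        d ^ r * n ^ (suc r + α) ≡⟨ trans (cong (d ^ r *_) (^-distribˡ-+-* n (suc r) α)) (sym (*-assoc (d ^ r) _ _)) ⟩
        d ^ r * n ^ suc r * n ^ α ≤⟨ *-monoˡ-≤ (n ^ α) cancelled ⟩
        (C * 4 ^ s) ^ r * n ^ s * D ^ α * n ^ α ≡⟨ trans (*-assoc ((C * 4 ^ s) ^ r * n ^ s) _ _) (cong ((C * 4 ^ s) ^ r * n ^ s *_) (sym (^-*-distrib D n α))) ⟩
        (C * 4 ^ s) ^ r * n ^ s * (D * n) ^ α ≤⟨ *-monoʳ-≤ ((C * 4 ^ s) ^ r * n ^ s) (^-monoˡ-≤ α Dn≤e) ⟩
        (C * 4 ^ s) ^ r * n ^ s * e ^ α ≡⟨ *-assoc ((C * 4 ^ s) ^ r) _ _ ⟩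
        (C * 4 ^ s) ^ r * (n ^ s * e ^ α) ∎
      where
      open ≤-Reasoning
      instance
        _ = >-nonZero 0<D
      s = suc j
      α = suc (suc r * i)
      y = (S * S) ^ r
      B = D * (D * D) ^ r
      Dn≤e : D * n ≤ e
      Dn≤e = ≤-trans (≤-reflexive (*-comm D n)) (≤-trans (m≤n*m (n * D) 4) D-upper)
      swap-^ : ∀ a i j → (a ^ i) ^ j ≡ (a ^ j) ^ i
      swap-^ a i j = trans (^-*-assoc a i j) (trans (cong (a ^_) (*-comm i j)) (sym (^-*-assoc a j i)))
      raised : d ^ r * y ^ s ≤ C ^ r * (y ^ suc r * (D ^ j) ^ r)
      raised = subst₂ _≤_ (trans (^-*-distrib d ((S * S) ^ s) r) (cong (d ^ r *_) (swap-^ (S * S) s r)))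
        (trans (^-*-distrib C ((S * S) ^ suc r * D ^ j) r) (cong (C ^ r *_) (trans (^-*-distrib ((S * S) ^ suc r) (D ^ j) r) (cong (_* (D ^ j) ^ r) (swap-^ (S * S) (suc r) r)))))
        (^-monoˡ-≤ r h)
      B≡ : B ≡ D ^ suc (r + r)
      B≡ = cong (D *_) (trans (^-*-distrib D D r) (sym (^-distribˡ-+-* D r r)))
      collect : B ^ suc r * (D ^ j) ^ r ≡ B ^ s * D ^ α
      collect = begin-equality
        B ^ suc r * (D ^ j) ^ r ≡⟨ cong₂ _*_ (trans (cong (_^ suc r) B≡) (^-*-assoc D (suc (r + r)) (suc r))) (^-*-assoc D j r) ⟩
        D ^ (suc (r + r) * suc r) * D ^ (j * r) ≡⟨ sym (^-distribˡ-+-* D (suc (r + r) * suc r) (j * r)) ⟩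
        D ^ (suc (r + r) * suc r + j * r) ≡⟨ cong (D ^_) (degree-exponent r i j hi) ⟩
        D ^ (suc (r + r) * s + α) ≡⟨ ^-distribˡ-+-* D (suc (r + r) * s) α ⟩
        D ^ (suc (r + r) * s) * D ^ α ≡⟨ cong (_* D ^ α) (sym (trans (cong (_^ s) B≡) (^-*-assoc D (suc (r + r)) s))) ⟩
        B ^ s * D ^ α ∎
      lem₁ : ∀ d n q y m → d * n * (q * y * m) ≡ q * m * n * (d * y)
      lem₁ = solve-∀
      lem₂ : ∀ q m n c y x → q * m * n * (c * (y * x)) ≡ c * q * m * (y * n * x)
      lem₂ = solve-∀
      lem₃ : ∀ a b c → a * (b * c) ≡ a * c * b
      lem₃ = solve-∀
      const≡ : C ^ r * (4 ^ r) ^ s ≡ (C * 4 ^ s) ^ r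
      const≡ = trans (cong (C ^ r *_) (swap-^ 4 r s)) (sym (^-*-distrib C (4 ^ s) r))
      cancelled : d ^ r * n ^ suc r ≤ (C * 4 ^ s) ^ r * n ^ s * D ^ α
      cancelled = *-cancelʳ-≤ _ _ (B ^ s) {{m^n≢0 B s {{m*n≢0 D _ {{>-nonZero 0<D}} {{m^n≢0 (D * D) r {{m*n≢0 D D}}}}}}}} (begin
        d ^ r * n ^ suc r * B ^ s ≤⟨ *-monoʳ-≤ (d ^ r * n ^ suc r) (^-monoˡ-≤ s S-lower) ⟩
        d ^ r * n ^ suc r * (4 ^ r * y * n) ^ s ≡⟨ cong (d ^ r * n ^ suc r *_) (trans (^-*-distrib (4 ^ r * y) n s) (cong (_* n ^ s) (^-*-distrib (4 ^ r) y s))) ⟩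
        d ^ r * n ^ suc r * ((4 ^ r) ^ s * y ^ s * n ^ s) ≡⟨ lem₁ (d ^ r) (n ^ suc r) ((4 ^ r) ^ s) (y ^ s) (n ^ s) ⟩
        (4 ^ r) ^ s * n ^ s * n ^ suc r * (d ^ r * y ^ s) ≤⟨ *-monoʳ-≤ ((4 ^ r) ^ s * n ^ s * n ^ suc r) raised ⟩
        (4 ^ r) ^ s * n ^ s * n ^ suc r * (C ^ r * (y ^ suc r * (D ^ j) ^ r))
                                                                   ≡⟨ lem₂ ((4 ^ r) ^ s) (n ^ s) (n ^ suc r) (C ^ r) (y ^ suc r) ((D ^ j) ^ r) ⟩
        C ^ r * (4 ^ r) ^ s * n ^ s * (y ^ suc r * n ^ suc r * (D ^ j) ^ r)
                                                                   ≡⟨ cong₂ (λ u v → u * n ^ s * (v * (D ^ j) ^ r)) const≡ (sym (^-*-distrib y n (suc r))) ⟩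
        (C * 4 ^ s) ^ r * n ^ s * ((y * n) ^ suc r * (D ^ j) ^ r) ≤⟨ *-monoʳ-≤ ((C * 4 ^ s) ^ r * n ^ s) (*-monoˡ-≤ ((D ^ j) ^ r) (^-monoˡ-≤ (suc r) S-upper)) ⟩
        (C * 4 ^ s) ^ r * n ^ s * (B ^ suc r * (D ^ j) ^ r) ≡⟨ cong ((C * 4 ^ s) ^ r * n ^ s *_) collect ⟩
        (C * 4 ^ s) ^ r * n ^ s * (B ^ s * D ^ α) ≡⟨ lem₃ ((C * 4 ^ s) ^ r * n ^ s) (B ^ s) (D ^ α) ⟩
        (C * 4 ^ s) ^ r * n ^ s * D ^ α * B ^ s ∎)

    -- The further power ℓ makes `r * suc r` clear both denominators in (b), ℓ-1 and ℓ.
    degree-bound-scaled : ∀ C d i j Cf → i + suc j ≡ r + r → C * 4 ^ suc j ≤ Cf → d * (S * S) ^ suc j ≤ C * ((S * S) ^ suc r * D ^ j) →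
      d ^ (r * suc r) * (e ^ 0 * n ^ ((suc r + suc (suc r * i)) * suc r)) ≤
      Cf ^ (r * suc r) * (e ^ (suc (suc r * i) * suc r) * n ^ (suc j * suc r))
    degree-bound-scaled C d i j Cf hi hC h = subst₂ _≤_
        (trans (^-*-distrib (d ^ r) _ (suc r)) (cong₂ _*_ (^-*-assoc d r (suc r)) (trans (^-*-assoc n (suc r + α) (suc r)) (sym (*-identityˡ _)))))
        (trans (^-*-distrib (Cf ^ r) _ (suc r)) (cong₂ _*_ (^-*-assoc Cf r (suc r)) (trans (^-*-distrib (n ^ suc j) (e ^ α) (suc r))
          (trans (cong₂ _*_ (^-*-assoc n (suc j) (suc r)) (^-*-assoc e α (suc r))) (*-comm _ (e ^ (α * suc r)))))))
        (^-monoˡ-≤ (suc r) (≤-trans (degree-bound C d i j hi h) (*-monoˡ-≤ (n ^ suc j * e ^ α) (^-monoˡ-≤ r hC))))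
      where
      α = suc (suc r * i)

    many-hyperedges : ∀ Λ H → D ^ (suc r + suc r) < Λ * H → e ^ (2 * suc r) ≤ 8 ^ (suc r + suc r) * Λ * H * n ^ (2 * suc r)
    many-hyperedges Λ H h = begin
      e ^ (2 * suc r) ≡⟨ cong (e ^_) N≡ ⟩
      e ^ N ≤⟨ ^-monoˡ-≤ N D-lower ⟩
      (8 * n * D) ^ N ≡⟨ trans (^-*-distrib (8 * n) D N) (cong (_* D ^ N) (^-*-distrib 8 n N)) ⟩
      8 ^ N * n ^ N * D ^ N ≤⟨ *-monoʳ-≤ (8 ^ N * n ^ N) (<⇒≤ h) ⟩
      8 ^ N * n ^ N * (Λ * H) ≡⟨ lem (8 ^ N) (n ^ N) Λ H ⟩
      8 ^ N * Λ * H * n ^ N ≡⟨ cong (λ k → 8 ^ N * Λ * H * n ^ k) (sym N≡) ⟩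
      8 ^ N * Λ * H * n ^ (2 * suc r) ∎
      where
      open ≤-Reasoning
      N = suc r + suc r
      N≡ : 2 * suc r ≡ N
      N≡ = cong (suc r +_) (+-identityʳ (suc r))
      lem : ∀ a b c h → a * b * (c * h) ≡ a * c * h * b
      lem = solve-∀

  -- At |σ| = 2ℓ-1 the right side of (b) is C n²/e, and a degree of at most 1 stays below it because
  -- `e ≤ n * n`.
  degree-bound-top : ∀ d Cf e n q → d ≤ 1 → 0 < Cf → e ≤ n * n → d ^ q * (e ^ q * n ^ 0) ≤ Cf ^ q * (e ^ 0 * n ^ (q + q))
  degree-bound-top d Cf e n q d≤1 0<Cf e≤n² = *-mono-≤ (^-monoˡ-≤ q (≤-trans d≤1 0<Cf))
    (subst₂ _≤_ (sym (*-identityʳ _)) (trans (trans (^-*-distrib n n q) (sym (^-distribˡ-+-* n q q))) (sym (*-identityˡ _))) (^-monoˡ-≤ q e≤n²))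

-- Rational exponents: from `PowLe` to inequalities in ℕ and back

module Exponents where

  open import Data.Integer as ℤ using (ℤ; +_; -[1+_])
  import Data.Integer.Properties as ℤₚ
  import Data.Integer.Tactic.RingSolver as ℤ-Solver
  open import Data.List using (List; []; _∷_; _++_; map)
  open import Data.Nat as ℕ using (ℕ; zero; suc; NonZero)
  open import Data.Nat.Coprimality using (1-coprimeTo) renaming (sym to coprime-sym)
  open import Data.Nat.Divisibility using (_∣_; divides; m∣m*n; ∣n⇒∣m*n)
  import Data.Nat.Properties as ℕₚ
  open import Data.Nat.Tactic.RingSolver using (solve-∀)
  open import Data.Product using (_×_; _,_)
  import Data.Rational
  open import Data.Rational using (ℚ; mkℚ; _/_; _*_; _+_; _-_; -_; _≤_; 0ℚ; 1ℚ; ↥_; ↧ₙ_; *≤*; toℚᵘ)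
  open import Data.Rational.Properties using (fromℚᵘ-toℚᵘ; fromℚᵘ-cong; *-identityˡ; *-identityʳ; *-assoc; *-comm; *-distribʳ-+; ≤-reflexive; ≤-trans)
  import Data.Rational.Properties as ℚₚ
  open import Data.Rational.Solver using (module +-*-Solver)
  import Data.Rational.Unnormalised as ℚᵘ
  open import Data.Rational.Unnormalised using (mkℚᵘ; *≡*)
  import Data.Rational.Unnormalised.Properties as ℚᵘₚ
  open import Relation.Binary.PropositionalEquality
  open Counting using (^-*-distrib; ^-cancel-≤; power-compare)

  ι : ℤ → ℚ
  ι z = z / 1

  ι-mk : ∀ z → ι z ≡ mkℚ z 0 (coprime-sym (1-coprimeTo ℤ.∣ z ∣))
  ι-mk z = fromℚᵘ-toℚᵘ (mkℚ z 0 (coprime-sym (1-coprimeTo ℤ.∣ z ∣)))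

  ↥-ι : ∀ z → ↥ ι z ≡ z
  ↥-ι z = cong ↥_ (ι-mk z)

  ι-injective : ∀ {x y} → ι x ≡ ι y → x ≡ y
  ι-injective {x} {y} h = trans (sym (↥-ι x)) (trans (cong ↥_ h) (↥-ι y))

  ι-+ : ∀ x y → ι (x ℤ.+ y) ≡ ι x + ι y
  ι-+ x y = trans (cong ι (sym (cong₂ ℤ._+_ (ℤₚ.*-identityʳ x) (ℤₚ.*-identityʳ y)))) (sym (cong₂ _+_ (ι-mk x) (ι-mk y)))

  ι-* : ∀ x y → ι (x ℤ.* y) ≡ ι x * ι y
  ι-* x y = sym (cong₂ _*_ (ι-mk x) (ι-mk y))

  ι-neg : ∀ x → ι (ℤ.- x) ≡ - ι x
  ι-neg (+ zero)  = refl
  ι-neg (+ suc n) = refl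
  ι-neg -[1+ n ]  = solve 1 (λ x → x := :- (:- x)) refl (ι (+ suc n))
    where open +-*-Solver

  ι-- : ∀ x y → ι (x ℤ.- y) ≡ ι x - ι y
  ι-- x y = trans (ι-+ x (ℤ.- y)) (cong (λ u → ι x + u) (ι-neg y))

  ι-mono : ∀ {x y} → x ℤ.≤ y → ι x ≤ ι y
  ι-mono {x} {y} h = subst₂ _≤_ (sym (ι-mk x)) (sym (ι-mk y)) (*≤* (subst₂ ℤ._≤_ (sym (ℤₚ.*-identityʳ x)) (sym (ℤₚ.*-identityʳ y)) h))

  ι-cancel : ∀ {x y} → ι x ≤ ι y → x ℤ.≤ y
  ι-cancel {x} {y} h with subst₂ _≤_ (ι-mk x) (ι-mk y) h
  ... | *≤* p = subst₂ ℤ._≤_ (ℤₚ.*-identityʳ x) (ℤₚ.*-identityʳ y) p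

  ℕ→ℚ-* : ∀ a b → ℕ→ℚ (a ℕ.* b) ≡ ℕ→ℚ a * ℕ→ℚ b
  ℕ→ℚ-* a b = trans (cong ι (ℤₚ.pos-* a b)) (ι-* (+ a) (+ b))

  ℕ→ℚ-+ : ∀ a b → ℕ→ℚ (a ℕ.+ b) ≡ ℕ→ℚ a + ℕ→ℚ b
  ℕ→ℚ-+ a b = ι-+ (+ a) (+ b)

  ℕ→ℚ-^ : ∀ a k → ℕ→ℚ a ^ℚ k ≡ ℕ→ℚ (a ℕ.^ k)
  ℕ→ℚ-^ a zero    = refl
  ℕ→ℚ-^ a (suc k) = trans (cong (ℕ→ℚ a *_) (ℕ→ℚ-^ a k)) (sym (ℕ→ℚ-* a (a ℕ.^ k)))

  ℕ→ℚ-mono : ∀ {a b} → a ℕ.≤ b → ℕ→ℚ a ≤ ℕ→ℚ b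
  ℕ→ℚ-mono h = ι-mono (ℤ.+≤+ h)

  ℕ→ℚ-cancel : ∀ {a b} → ℕ→ℚ a ≤ ℕ→ℚ b → a ℕ.≤ b
  ℕ→ℚ-cancel h = ℤₚ.drop‿+≤+ (ι-cancel h)

  ratio-* : ∀ p d .{{_ : NonZero d}} → ℕ→ℚ d * ratio p d ≡ ℕ→ℚ p
  ratio-* p (suc d) = trans (*-comm (ℕ→ℚ (suc d)) _) (times-denominator (+ p) d)
    where
    times-denominator : ∀ z d → (z / suc d) * ℕ→ℚ (suc d) ≡ ι z
    times-denominator z d = ℚₚ.toℚᵘ-injective (begin-equality
        toℚᵘ ((z / suc d) * ℕ→ℚ (suc d))                ≃⟨ ℚₚ.toℚᵘ-homo-* (z / suc d) (ℕ→ℚ (suc d)) ⟩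
        toℚᵘ (z / suc d) ℚᵘ.* toℚᵘ (ℕ→ℚ (suc d))        ≃⟨ ℚᵘₚ.*-cong (ℚₚ.toℚᵘ-fromℚᵘ (mkℚᵘ z d)) (ℚₚ.toℚᵘ-fromℚᵘ (mkℚᵘ (+ suc d) 0)) ⟩
        mkℚᵘ z d ℚᵘ.* mkℚᵘ (+ suc d) 0                  ≃⟨ *≡* (lem z (+ suc d) (+ suc (d ℕ.* 1)) (cong (λ k → + suc k) (sym (ℕₚ.*-identityʳ d)))) ⟩
        mkℚᵘ z 0                                        ≃⟨ ℚᵘₚ.≃-sym (ℚₚ.toℚᵘ-fromℚᵘ (mkℚᵘ z 0)) ⟩
        toℚᵘ (ι z) ∎)
      where
      open ℚᵘₚ.≤-Reasoning
      lem : ∀ z a b → a ≡ b → z ℤ.* a ℤ.* + 1 ≡ z ℤ.* b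
      lem z a b refl = ℤₚ.*-identityʳ (z ℤ.* a)

  -- `scaledExp` reads off the numerator of a reduced fraction, which is the intended exponent when
  -- `M` is a multiple of the denominator.
  ι-scaledExp : ∀ r M → ↧ₙ r ∣ M → ι (scaledExp M r) ≡ r * ℕ→ℚ M
  ι-scaledExp r@(mkℚ a d c) M (divides q eq) = trans (cong (λ u → ι (↥ u)) int) (trans (cong ι (↥-ι (a ℤ.* + q))) (sym int))
    where
    lem : ∀ a q d → a ℤ.* (q ℤ.* d) ℤ.* + 1 ≡ a ℤ.* q ℤ.* d
    lem = ℤ-Solver.solve-∀
    int : r * ℕ→ℚ M ≡ ι (a ℤ.* + q)
    int = trans (cong (r *_) (ι-mk (+ M))) (fromℚᵘ-cong {mkℚᵘ (a ℤ.* + M) (d ℕ.* 1)} {mkℚᵘ (a ℤ.* + q) 0} (*≡* (begin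
        a ℤ.* + M ℤ.* + 1 ≡⟨ cong (λ u → a ℤ.* u ℤ.* + 1) (trans (cong +_ eq) (ℤₚ.pos-* q (suc d))) ⟩
        a ℤ.* (+ q ℤ.* + suc d) ℤ.* + 1 ≡⟨ lem a (+ q) (+ suc d) ⟩
        a ℤ.* + q ℤ.* + suc d ≡⟨ cong (λ k → a ℤ.* + q ℤ.* + suc k) (sym (ℕₚ.*-identityʳ d)) ⟩
        a ℤ.* + q ℤ.* + suc (d ℕ.* 1) ∎)))
      where open ≡-Reasoning

  scaledExp-1 : ∀ M → scaledExp M 1ℚ ≡ + M
  scaledExp-1 M = trans (cong ↥_ (*-identityˡ (ℕ→ℚ M))) (↥-ι (+ M))

  pos-neg-parts : ∀ z → z ≡ + posPart z ℤ.- + negPart z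
  pos-neg-parts (+ m)    = sym (ℤₚ.+-identityʳ (+ m))
  pos-neg-parts -[1+ m ] = refl

  parts-relation : ∀ q z α₁ α₂ → + q ℤ.* z ≡ + α₂ ℤ.- + α₁ → q ℕ.* posPart z ℕ.+ α₁ ≡ q ℕ.* negPart z ℕ.+ α₂
  parts-relation q z α₁ α₂ h = ℤₚ.+-injective (begin
      + (q ℕ.* posPart z ℕ.+ α₁) ≡⟨ cong (ℤ._+ + α₁) (ℤₚ.pos-* q (posPart z)) ⟩
      + q ℤ.* + posPart z ℤ.+ + α₁ ≡⟨ lem (+ q) (+ posPart z) (+ negPart z) (+ α₁) ⟩
      + q ℤ.* (+ posPart z ℤ.- + negPart z) ℤ.+ (+ q ℤ.* + negPart z ℤ.+ + α₁)
                                                              ≡⟨ cong (λ u → + q ℤ.* u ℤ.+ (+ q ℤ.* + negPart z ℤ.+ + α₁)) (sym (pos-neg-parts z)) ⟩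
      + q ℤ.* z ℤ.+ (+ q ℤ.* + negPart z ℤ.+ + α₁) ≡⟨ cong (ℤ._+ (+ q ℤ.* + negPart z ℤ.+ + α₁)) h ⟩
      + α₂ ℤ.- + α₁ ℤ.+ (+ q ℤ.* + negPart z ℤ.+ + α₁) ≡⟨ lem₂ (+ α₁) (+ α₂) (+ q ℤ.* + negPart z) ⟩
      + q ℤ.* + negPart z ℤ.+ + α₂ ≡⟨ cong (ℤ._+ + α₂) (sym (ℤₚ.pos-* q (negPart z))) ⟩
      + (q ℕ.* negPart z ℕ.+ α₂) ∎)
    where
    open ≡-Reasoning
    lem : ∀ q p m a → q ℤ.* p ℤ.+ a ≡ q ℤ.* (p ℤ.- m) ℤ.+ (q ℤ.* m ℤ.+ a)
    lem = ℤ-Solver.solve-∀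
    lem₂ : ∀ a b c → b ℤ.- a ℤ.+ (c ℤ.+ a) ≡ c ℤ.+ b
    lem₂ = ℤ-Solver.solve-∀

  scaled-difference : ∀ M q α₁ α₂ z (a : ℚ) → ι z ≡ a * ℕ→ℚ M → ℕ→ℚ q * a ≡ ℕ→ℚ α₂ - ℕ→ℚ α₁ →
    + q ℤ.* z ≡ + (α₂ ℕ.* M) ℤ.- + (α₁ ℕ.* M)
  scaled-difference M q α₁ α₂ z a hz h = ι-injective (begin
      ι (+ q ℤ.* z) ≡⟨ ι-* (+ q) z ⟩
      ℕ→ℚ q * ι z ≡⟨ cong (ℕ→ℚ q *_) hz ⟩
      ℕ→ℚ q * (a * ℕ→ℚ M) ≡⟨ sym (*-assoc (ℕ→ℚ q) a _) ⟩
      ℕ→ℚ q * a * ℕ→ℚ M ≡⟨ cong (_* ℕ→ℚ M) h ⟩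
      (ℕ→ℚ α₂ - ℕ→ℚ α₁) * ℕ→ℚ M ≡⟨ solve 3 (λ a b m → (b :- a) :* m := b :* m :- a :* m) refl (ℕ→ℚ α₁) (ℕ→ℚ α₂) (ℕ→ℚ M) ⟩
      ℕ→ℚ α₂ * ℕ→ℚ M - ℕ→ℚ α₁ * ℕ→ℚ M ≡⟨ sym (cong₂ _-_ (ℕ→ℚ-* α₂ M) (ℕ→ℚ-* α₁ M)) ⟩
      ℕ→ℚ (α₂ ℕ.* M) - ℕ→ℚ (α₁ ℕ.* M) ≡⟨ sym (ι-- (+ (α₂ ℕ.* M)) (+ (α₁ ℕ.* M))) ⟩
      ι (+ (α₂ ℕ.* M) ℤ.- + (α₁ ℕ.* M)) ∎)
    where
    open ≡-Reasoning
    open +-*-Solver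

  -- Supplies the relations that `power-compare` asks for from an identity between rational
  -- exponents.
  exponent-relation : ∀ M q α₁ α₂ a → ↧ₙ a ∣ M → ℕ→ℚ q * a ≡ ℕ→ℚ α₂ - ℕ→ℚ α₁ →
    q ℕ.* posPart (scaledExp M a) ℕ.+ α₁ ℕ.* M ≡ q ℕ.* negPart (scaledExp M a) ℕ.+ α₂ ℕ.* M
  exponent-relation M q α₁ α₂ a d h = parts-relation q (scaledExp M a) (α₁ ℕ.* M) (α₂ ℕ.* M)
    (scaled-difference M q α₁ α₂ (scaledExp M a) a (ι-scaledExp a M d) h)

  -- The base `n` occurs twice, once inside k and once on its own. Only the sum of the two exponents
  -- has a simple form, so the pair is treated together.
  exponent-relation₂ : ∀ M q α₁ α₂ a b → ↧ₙ a ∣ M → ↧ₙ b ∣ M → ℕ→ℚ q * (a + b) ≡ ℕ→ℚ α₂ - ℕ→ℚ α₁ →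
    q ℕ.* (posPart (scaledExp M a) ℕ.+ posPart (scaledExp M b)) ℕ.+ α₁ ℕ.* M ≡
    q ℕ.* (negPart (scaledExp M a) ℕ.+ negPart (scaledExp M b)) ℕ.+ α₂ ℕ.* M
  exponent-relation₂ M q α₁ α₂ a b da db h = ℤₚ.+-injective (begin
      + (q ℕ.* (pa ℕ.+ pb) ℕ.+ α₁ ℕ.* M)
        ≡⟨ cong (ℤ._+ + (α₁ ℕ.* M)) (ℤₚ.pos-* q (pa ℕ.+ pb)) ⟩
      + q ℤ.* (+ pa ℤ.+ + pb) ℤ.+ + (α₁ ℕ.* M)
        ≡⟨ lem (+ q) (+ pa) (+ pb) (+ na) (+ nb) (+ (α₁ ℕ.* M)) ⟩
      + q ℤ.* ((+ pa ℤ.- + na) ℤ.+ (+ pb ℤ.- + nb)) ℤ.+ (+ q ℤ.* (+ na ℤ.+ + nb) ℤ.+ + (α₁ ℕ.* M))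
        ≡⟨ cong₂ (λ x y → + q ℤ.* (x ℤ.+ y) ℤ.+ (+ q ℤ.* (+ na ℤ.+ + nb) ℤ.+ + (α₁ ℕ.* M))) (sym (pos-neg-parts sa)) (sym (pos-neg-parts sb)) ⟩
      + q ℤ.* (sa ℤ.+ sb) ℤ.+ (+ q ℤ.* (+ na ℤ.+ + nb) ℤ.+ + (α₁ ℕ.* M))
        ≡⟨ cong (ℤ._+ (+ q ℤ.* (+ na ℤ.+ + nb) ℤ.+ + (α₁ ℕ.* M))) (scaled-difference M q α₁ α₂ (sa ℤ.+ sb) (a + b)
             (trans (ι-+ sa sb) (trans (cong₂ _+_ (ι-scaledExp a M da) (ι-scaledExp b M db)) (sym (*-distribʳ-+ (ℕ→ℚ M) a b)))) h) ⟩
      + (α₂ ℕ.* M) ℤ.- + (α₁ ℕ.* M) ℤ.+ (+ q ℤ.* (+ na ℤ.+ + nb) ℤ.+ + (α₁ ℕ.* M))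
        ≡⟨ lem₂ (+ (α₁ ℕ.* M)) (+ (α₂ ℕ.* M)) (+ q ℤ.* (+ na ℤ.+ + nb)) ⟩
      + q ℤ.* (+ na ℤ.+ + nb) ℤ.+ + (α₂ ℕ.* M)
        ≡⟨ cong (ℤ._+ + (α₂ ℕ.* M)) (sym (ℤₚ.pos-* q (na ℕ.+ nb))) ⟩
      + (q ℕ.* (na ℕ.+ nb) ℕ.+ α₂ ℕ.* M) ∎)
    where
    open ≡-Reasoning
    sa = scaledExp M a
    sb = scaledExp M b
    pa = posPart sa
    na = negPart sa
    pb = posPart sb
    nb = negPart sb
    lem : ∀ q p p′ m m′ a → q ℤ.* (p ℤ.+ p′) ℤ.+ a ≡ q ℤ.* ((p ℤ.- m) ℤ.+ (p′ ℤ.- m′)) ℤ.+ (q ℤ.* (m ℤ.+ m′) ℤ.+ a)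
    lem = ℤ-Solver.solve-∀
    lem₂ : ∀ a b c → b ℤ.- a ℤ.+ (c ℤ.+ a) ≡ c ℤ.+ b
    lem₂ = ℤ-Solver.solve-∀

  cast : ℕ × ℚ → Factor
  cast (b , r) = ℕ→ℚ b , r

  natPow : (ℤ → ℕ) → ℕ → List (ℕ × ℚ) → ℕ
  natPow part M []             = 1
  natPow part M ((b , r) ∷ fs) = b ℕ.^ part (scaledExp M r) ℕ.* natPow part M fs

  prodℚ-pos : ∀ M fs → prodℚ (map (posPow M) (map cast fs)) ≡ ℕ→ℚ (natPow posPart M fs)
  prodℚ-pos M []             = refl
  prodℚ-pos M ((b , r) ∷ fs) = trans (cong₂ _*_ (ℕ→ℚ-^ b (posPart (scaledExp M r))) (prodℚ-pos M fs)) (sym (ℕ→ℚ-* (b ℕ.^ posPart (scaledExp M r)) _))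

  prodℚ-neg : ∀ M fs → prodℚ (map (negPow M) (map cast fs)) ≡ ℕ→ℚ (natPow negPart M fs)
  prodℚ-neg M []             = refl
  prodℚ-neg M ((b , r) ∷ fs) = trans (cong₂ _*_ (ℕ→ℚ-^ b (negPart (scaledExp M r))) (prodℚ-neg M fs)) (sym (ℕ→ℚ-* (b ℕ.^ negPart (scaledExp M r)) _))

  module _ (xs ys : List (ℕ × ℚ)) where
    private
      M = denomProd (map cast xs ++ map cast ys)

      lhs≡ : prodℚ (map (posPow M) (map cast xs)) * prodℚ (map (negPow M) (map cast ys)) ≡ ℕ→ℚ (natPow posPart M xs ℕ.* natPow negPart M ys)
      lhs≡ = trans (cong₂ _*_ (prodℚ-pos M xs) (prodℚ-neg M ys)) (sym (ℕ→ℚ-* (natPow posPart M xs) _))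

      rhs≡ : prodℚ (map (posPow M) (map cast ys)) * prodℚ (map (negPow M) (map cast xs)) ≡ ℕ→ℚ (natPow posPart M ys ℕ.* natPow negPart M xs)
      rhs≡ = trans (cong₂ _*_ (prodℚ-pos M ys) (prodℚ-neg M xs)) (sym (ℕ→ℚ-* (natPow posPart M ys) _))

    PowLe-elim : PowLe (map cast xs) (map cast ys) →
      natPow posPart M xs ℕ.* natPow negPart M ys ℕ.≤ natPow posPart M ys ℕ.* natPow negPart M xs
    PowLe-elim h = ℕ→ℚ-cancel (subst₂ _≤_ lhs≡ rhs≡ h)

    PowLe-intro : natPow posPart M xs ℕ.* natPow negPart M ys ℕ.≤ natPow posPart M ys ℕ.* natPow negPart M xs →
      PowLe (map cast xs) (map cast ys)
    PowLe-intro h = subst₂ _≤_ (sym lhs≡) (sym rhs≡) (ℕ→ℚ-mono h)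

    -- δ = 1/Λ is the one base outside ℕ. Scaling an inequality between naturals by (1/Λ)^M brings
    -- it in, because (1/Λ)^M cancels `Λ ^ M` on the right.
    PowLe-intro-reciprocal : ∀ Λ .{{_ : NonZero Λ}} → M ≡ denomProd ((+ 1 / Λ , 1ℚ) ∷ map cast xs ++ map cast ys) →
      natPow posPart M xs ℕ.* natPow negPart M ys ℕ.≤ Λ ℕ.^ M ℕ.* (natPow posPart M ys ℕ.* natPow negPart M xs) →
      PowLe ((+ 1 / Λ , 1ℚ) ∷ map cast xs) (map cast ys)
    PowLe-intro-reciprocal Λ eq h = subst (λ M′ →
        prodℚ (map (posPow M′) ((c , 1ℚ) ∷ map cast xs)) * prodℚ (map (negPow M′) (map cast ys)) ≤
        prodℚ (map (posPow M′) (map cast ys)) * prodℚ (map (negPow M′) ((c , 1ℚ) ∷ map cast xs))) eq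
      (subst₂ _≤_ left right (ℚₚ.*-monoˡ-≤-nonNeg (c ^ℚ M) {{c^M-nonNeg}} (ℕ→ℚ-mono h)))
      where
      c = + 1 / Λ
      c^-nonNeg : ∀ k → Data.Rational.NonNegative (c ^ℚ k)
      c^-nonNeg zero    = _
      c^-nonNeg (suc k) = Data.Rational.nonNegative (≤-trans (≤-reflexive (sym (ℚₚ.*-zeroʳ c)))
        (ℚₚ.*-monoˡ-≤-nonNeg c {{ℚₚ.normalize-nonNeg 1 Λ}} (ℚₚ.nonNegative⁻¹ (c ^ℚ k) {{c^-nonNeg k}})))
      c^M-nonNeg = c^-nonNeg M
      c*Λ : c * ℕ→ℚ Λ ≡ 1ℚ
      c*Λ = trans (*-comm c _) (trans (cong (ℕ→ℚ Λ *_) (sym (ratio-def Λ))) (ratio-* 1 Λ))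
        where
        ratio-def : ∀ Λ .{{_ : NonZero Λ}} → ratio 1 Λ ≡ + 1 / Λ
        ratio-def (suc _) = refl
      c^*Λ^ : ∀ k → c ^ℚ k * ℕ→ℚ (Λ ℕ.^ k) ≡ 1ℚ
      c^*Λ^ zero    = refl
      c^*Λ^ (suc k) = trans (cong (c * c ^ℚ k *_) (ℕ→ℚ-* Λ (Λ ℕ.^ k))) (trans
        (solve 4 (λ a b x y → (a :* b) :* (x :* y) := (a :* x) :* (b :* y)) refl c (c ^ℚ k) (ℕ→ℚ Λ) (ℕ→ℚ (Λ ℕ.^ k)))
        (cong₂ _*_ c*Λ (c^*Λ^ k)))
        where open +-*-Solver
      left : c ^ℚ M * ℕ→ℚ (natPow posPart M xs ℕ.* natPow negPart M ys) ≡
        c ^ℚ posPart (scaledExp M 1ℚ) * prodℚ (map (posPow M) (map cast xs)) * prodℚ (map (negPow M) (map cast ys))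
      left = trans (cong₂ (λ k u → c ^ℚ posPart k * u) (sym (scaledExp-1 M)) (sym lhs≡)) (sym (*-assoc (c ^ℚ posPart (scaledExp M 1ℚ)) _ _))
      right : c ^ℚ M * ℕ→ℚ (Λ ℕ.^ M ℕ.* (natPow posPart M ys ℕ.* natPow negPart M xs)) ≡
        prodℚ (map (posPow M) (map cast ys)) * (c ^ℚ negPart (scaledExp M 1ℚ) * prodℚ (map (negPow M) (map cast xs)))
      right = trans (cong (c ^ℚ M *_) (ℕ→ℚ-* (Λ ℕ.^ M) _)) (trans (sym (*-assoc (c ^ℚ M) _ _)) (trans (cong₂ _*_ (c^*Λ^ M) (sym rhs≡))
        (trans (*-identityˡ _) (cong (λ u → prodℚ (map (posPow M) (map cast ys)) * u)
          (trans (sym (*-identityˡ _)) (cong (λ k → c ^ℚ negPart k * prodℚ (map (negPow M) (map cast xs))) (sym (scaledExp-1 M))))))))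

  denom≢0 : ∀ q → NonZero (↧ₙ q)
  denom≢0 (mkℚ _ _ _) = _

  denomProd≢0 : ∀ fs → NonZero (denomProd fs)
  denomProd≢0 []             = _
  denomProd≢0 ((_ , r) ∷ fs) = ℕₚ.m*n≢0 (↧ₙ r) (denomProd fs) {{denom≢0 r}} {{denomProd≢0 fs}}

  posPart-1 : ∀ M → posPart (scaledExp M 1ℚ) ≡ M
  posPart-1 M = cong posPart (scaledExp-1 M)

  negPart-1 : ∀ M → negPart (scaledExp M 1ℚ) ≡ 0
  negPart-1 M = cong negPart (scaledExp-1 M)

  density-elim : ∀ ℓ n e k .{{_ : NonZero ℓ}} .{{_ : NonZero n}} →
    PowLe ((ℕ→ℚ k , 1ℚ) ∷ []) (kPow ℓ n e 1ℚ) → k ℕ.^ ℓ ℕ.* n ℕ.^ suc ℓ ℕ.≤ e ℕ.^ ℓ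
  density-elim ℓ n e k h = subst₂ ℕ._≤_ (cong (k ℕ.^ ℓ ℕ.*_) (trans (cong (ℕ._* n ℕ.^ suc ℓ) (ℕₚ.^-zeroˡ 0)) (ℕₚ.*-identityˡ _)))
      (trans (cong (e ℕ.^ ℓ ℕ.*_) (ℕₚ.*-identityʳ _)) (ℕₚ.*-identityʳ _))
      -- The comparison runs backwards, from the denominator `M` to ℓ. As `k` and `e` take the
      -- places of `d` and `C`, the base 1 fills the place of `e`.
      (power-compare k e 1 n M ℓ {0} {0} {nb} {pb} {0} {0} {0} {suc ℓ} hyp refl rel)
    where
    xs = (k , 1ℚ) ∷ []
    b = - ((1ℚ + ratio 1 ℓ) * 1ℚ)
    ys = (e , 1ℚ) ∷ (n , b) ∷ []
    M = denomProd (map cast xs ++ map cast ys)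
    pb = posPart (scaledExp M b)
    nb = negPart (scaledExp M b)
    instance
      M≢0 : NonZero M
      M≢0 = denomProd≢0 (map cast xs ++ map cast ys)
    simplify : ∀ k e n {p q : ℕ} → p ≡ M → q ≡ 0 → ∀ i j →
      k ℕ.^ p ℕ.* 1 ℕ.* (e ℕ.^ q ℕ.* (n ℕ.^ i ℕ.* 1)) ℕ.≤ e ℕ.^ p ℕ.* (n ℕ.^ j ℕ.* 1) ℕ.* (k ℕ.^ q ℕ.* 1) →
      k ℕ.^ M ℕ.* (1 ℕ.* n ℕ.^ i) ℕ.≤ e ℕ.^ M ℕ.* (1 ℕ.* n ℕ.^ j)
    simplify k e n refl refl i j = subst₂ ℕ._≤_ (lem (k ℕ.^ M) (n ℕ.^ i)) (lem₂ (e ℕ.^ M) (n ℕ.^ j))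
      where
      lem : ∀ a b → a ℕ.* 1 ℕ.* (1 ℕ.* (b ℕ.* 1)) ≡ a ℕ.* (1 ℕ.* b)
      lem = solve-∀
      lem₂ : ∀ a b → a ℕ.* (b ℕ.* 1) ℕ.* (1 ℕ.* 1) ≡ a ℕ.* (1 ℕ.* b)
      lem₂ = solve-∀
    hyp : k ℕ.^ M ℕ.* (1 ℕ.* n ℕ.^ nb) ℕ.≤ e ℕ.^ M ℕ.* (1 ℕ.* n ℕ.^ pb)
    hyp = simplify k e n (posPart-1 M) (negPart-1 M) nb pb (PowLe-elim xs ys h)
    b-eq : ℕ→ℚ ℓ * b ≡ ℕ→ℚ 0 - ℕ→ℚ (suc ℓ)
    b-eq = trans (solve 2 (λ l t → l :* (:- ((con 1ℚ :+ t) :* con 1ℚ)) := con 0ℚ :- (l :* t :+ l)) refl (ℕ→ℚ ℓ) (ratio 1 ℓ))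
      (cong (λ u → 0ℚ - u) (trans (cong (_+ ℕ→ℚ ℓ) (ratio-* 1 ℓ)) (sym (ℕ→ℚ-+ 1 ℓ))))
      where open +-*-Solver
    rel : M ℕ.* 0 ℕ.+ nb ℕ.* ℓ ≡ M ℕ.* suc ℓ ℕ.+ pb ℕ.* ℓ
    rel = trans (trans (cong (ℕ._+ nb ℕ.* ℓ) (ℕₚ.*-zeroʳ M)) (trans (ℕₚ.*-comm nb ℓ) (sym (ℕₚ.+-identityʳ _)))) (trans
      (sym (exponent-relation M ℓ (suc ℓ) 0 b (∣n⇒∣m*n (↧ₙ 1ℚ) (∣n⇒∣m*n (↧ₙ 1ℚ) (m∣m*n 1))) b-eq))
      (lem M ℓ pb))
      where lem : ∀ M l p → l ℕ.* p ℕ.+ suc l ℕ.* M ≡ M ℕ.* suc l ℕ.+ p ℕ.* l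
            lem = solve-∀

  -- The powers of n collapse, since 2 - 2ℓ(1 + 1/ℓ) = -2ℓ.
  many-edges-intro : ∀ ℓ n e H Λ .{{_ : NonZero ℓ}} .{{_ : NonZero n}} .{{_ : NonZero e}} .{{_ : NonZero Λ}} →
    e ℕ.^ (2 ℕ.* ℓ) ℕ.≤ Λ ℕ.* H ℕ.* n ℕ.^ (2 ℕ.* ℓ) →
    PowLe ((+ 1 / Λ , 1ℚ) ∷ kPow ℓ n e (ℕ→ℚ (2 ℕ.* ℓ)) ++ ((ℕ→ℚ n , ℕ→ℚ 2) ∷ [])) ((ℕ→ℚ H , 1ℚ) ∷ [])
  many-edges-intro ℓ n e H Λ h = PowLe-intro-reciprocal xs ys Λ (sym (ℕₚ.*-identityˡ M)) (final (posPart-1 M) (negPart-1 M))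
    where
    N = 2 ℕ.* ℓ
    b = - ((1ℚ + ratio 1 ℓ) * ℕ→ℚ N)
    xs = (e , ℕ→ℚ N) ∷ (n , b) ∷ (n , ℕ→ℚ 2) ∷ []
    ys = (H , 1ℚ) ∷ []
    M = denomProd (map cast xs ++ map cast ys)
    sa = scaledExp M (ℕ→ℚ N)
    sb = scaledExp M b
    sc = scaledExp M (ℕ→ℚ 2)
    a-eq : ℕ→ℚ ℓ * ℕ→ℚ N ≡ ℕ→ℚ (ℓ ℕ.* N) - ℕ→ℚ 0
    a-eq = trans (sym (ℕ→ℚ-* ℓ N)) (solve 1 (λ x → x := x :- con 0ℚ) refl (ℕ→ℚ (ℓ ℕ.* N)))
      where open +-*-Solver
    bc-eq : ℕ→ℚ ℓ * (b + ℕ→ℚ 2) ≡ ℕ→ℚ 0 - ℕ→ℚ (ℓ ℕ.* N)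
    bc-eq = trans (solve 4 (λ l t N two → l :* (:- ((con 1ℚ :+ t) :* N) :+ two) := l :* two :- (l :* t) :* N :- l :* N) refl (ℕ→ℚ ℓ) (ratio 1 ℓ) (ℕ→ℚ N) (ℕ→ℚ 2))
      (trans (cong₂ (λ u v → u - v * ℕ→ℚ N - ℕ→ℚ ℓ * ℕ→ℚ N) (trans (sym (ℕ→ℚ-* ℓ 2)) (cong ℕ→ℚ (ℕₚ.*-comm ℓ 2))) (ratio-* 1 ℓ))
        (trans (solve 2 (λ N x → N :- con 1ℚ :* N :- x := con 0ℚ :- x) refl (ℕ→ℚ N) (ℕ→ℚ ℓ * ℕ→ℚ N)) (cong (λ u → 0ℚ - u) (sym (ℕ→ℚ-* ℓ N)))))
      where open +-*-Solver
    da : ↧ₙ (ℕ→ℚ N) ∣ M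
    da = m∣m*n _
    db : ↧ₙ b ∣ M
    db = ∣n⇒∣m*n (↧ₙ (ℕ→ℚ N)) (m∣m*n _)
    dc : ↧ₙ (ℕ→ℚ 2) ∣ M
    dc = ∣n⇒∣m*n (↧ₙ (ℕ→ℚ N)) (∣n⇒∣m*n (↧ₙ b) (m∣m*n _))
    scaled : 1 ℕ.^ ℓ ℕ.* (e ℕ.^ (ℓ ℕ.* N) ℕ.* n ℕ.^ 0) ℕ.≤ (Λ ℕ.* H) ℕ.^ ℓ ℕ.* (e ℕ.^ 0 ℕ.* n ℕ.^ (ℓ ℕ.* N))
    scaled = subst₂ ℕ._≤_ (trans (trans (ℕₚ.^-*-assoc e N ℓ) (cong (e ℕ.^_) (ℕₚ.*-comm N ℓ))) (sym (trans (cong (ℕ._* (e ℕ.^ (ℓ ℕ.* N) ℕ.* 1)) (ℕₚ.^-zeroˡ ℓ)) (trans (ℕₚ.*-identityˡ _) (ℕₚ.*-identityʳ _)))))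
      (trans (^-*-distrib (Λ ℕ.* H) (n ℕ.^ N) ℓ) (cong ((Λ ℕ.* H) ℕ.^ ℓ ℕ.*_) (trans (trans (ℕₚ.^-*-assoc n N ℓ) (cong (n ℕ.^_) (ℕₚ.*-comm N ℓ))) (sym (ℕₚ.*-identityˡ _)))))
      (ℕₚ.^-monoˡ-≤ ℓ h)
    core : 1 ℕ.^ M ℕ.* (e ℕ.^ posPart sa ℕ.* n ℕ.^ (posPart sb ℕ.+ posPart sc)) ℕ.≤ (Λ ℕ.* H) ℕ.^ M ℕ.* (e ℕ.^ negPart sa ℕ.* n ℕ.^ (negPart sb ℕ.+ negPart sc))
    core = power-compare 1 (Λ ℕ.* H) e n ℓ M {ℓ ℕ.* N} {0} {0} {ℓ ℕ.* N} scaled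
      (sym (exponent-relation M ℓ 0 (ℓ ℕ.* N) (ℕ→ℚ N) da a-eq)) (sym (exponent-relation₂ M ℓ (ℓ ℕ.* N) 0 b (ℕ→ℚ 2) db dc bc-eq))
    final : ∀ {p q} → p ≡ M → q ≡ 0 →
      e ℕ.^ posPart sa ℕ.* (n ℕ.^ posPart sb ℕ.* (n ℕ.^ posPart sc ℕ.* 1)) ℕ.* (H ℕ.^ q ℕ.* 1) ℕ.≤
      Λ ℕ.^ M ℕ.* (H ℕ.^ p ℕ.* 1 ℕ.* (e ℕ.^ negPart sa ℕ.* (n ℕ.^ negPart sb ℕ.* (n ℕ.^ negPart sc ℕ.* 1))))
    final refl refl = subst₂ ℕ._≤_
      (trans (cong₂ (λ u v → u ℕ.* (e ℕ.^ posPart sa ℕ.* v)) (ℕₚ.^-zeroˡ M) (ℕₚ.^-distribˡ-+-* n (posPart sb) (posPart sc))) (lem (e ℕ.^ posPart sa) (n ℕ.^ posPart sb) (n ℕ.^ posPart sc)))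
      (trans (cong₂ (λ u v → u ℕ.* (e ℕ.^ negPart sa ℕ.* v)) (^-*-distrib Λ H M) (ℕₚ.^-distribˡ-+-* n (negPart sb) (negPart sc))) (lem₂ (Λ ℕ.^ M) (H ℕ.^ M) (e ℕ.^ negPart sa) (n ℕ.^ negPart sb) (n ℕ.^ negPart sc)))
      core
      where
      lem : ∀ a b c → 1 ℕ.* (a ℕ.* (b ℕ.* c)) ≡ a ℕ.* (b ℕ.* (c ℕ.* 1)) ℕ.* (1 ℕ.* 1)
      lem = solve-∀
      lem₂ : ∀ l h a b c → l ℕ.* h ℕ.* (a ℕ.* (b ℕ.* c)) ≡ l ℕ.* (h ℕ.* 1 ℕ.* (a ℕ.* (b ℕ.* (c ℕ.* 1))))
      lem₂ = solve-∀

  degree-intro : ∀ d C e n q a b c {α₁ α₂ A₁ A₂} .{{_ : NonZero q}} .{{_ : NonZero e}} .{{_ : NonZero n}} →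
    d ℕ.^ q ℕ.* (e ℕ.^ α₁ ℕ.* n ℕ.^ A₁) ℕ.≤ C ℕ.^ q ℕ.* (e ℕ.^ α₂ ℕ.* n ℕ.^ A₂) →
    ℕ→ℚ q * a ≡ ℕ→ℚ α₂ - ℕ→ℚ α₁ → ℕ→ℚ q * (b + c) ≡ ℕ→ℚ A₂ - ℕ→ℚ A₁ →
    PowLe ((ℕ→ℚ d , 1ℚ) ∷ []) ((ℕ→ℚ C , 1ℚ) ∷ (ℕ→ℚ e , a) ∷ (ℕ→ℚ n , b) ∷ (ℕ→ℚ n , c) ∷ [])
  degree-intro d C e n q a b c {α₁} {α₂} {A₁} {A₂} h a-eq bc-eq = PowLe-intro xs ys (final (posPart-1 M) (negPart-1 M))
    where
    xs = (d , 1ℚ) ∷ []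
    ys = (C , 1ℚ) ∷ (e , a) ∷ (n , b) ∷ (n , c) ∷ []
    M = denomProd (map cast xs ++ map cast ys)
    sa = scaledExp M a
    sb = scaledExp M b
    sc = scaledExp M c
    da : ↧ₙ a ∣ M
    da = ∣n⇒∣m*n (↧ₙ 1ℚ) (∣n⇒∣m*n (↧ₙ 1ℚ) (m∣m*n _))
    db : ↧ₙ b ∣ M
    db = ∣n⇒∣m*n (↧ₙ 1ℚ) (∣n⇒∣m*n (↧ₙ 1ℚ) (∣n⇒∣m*n (↧ₙ a) (m∣m*n _)))
    dc : ↧ₙ c ∣ M
    dc = ∣n⇒∣m*n (↧ₙ 1ℚ) (∣n⇒∣m*n (↧ₙ 1ℚ) (∣n⇒∣m*n (↧ₙ a) (∣n⇒∣m*n (↧ₙ b) (m∣m*n 1))))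
    core : d ℕ.^ M ℕ.* (e ℕ.^ negPart sa ℕ.* n ℕ.^ (negPart sb ℕ.+ negPart sc)) ℕ.≤ C ℕ.^ M ℕ.* (e ℕ.^ posPart sa ℕ.* n ℕ.^ (posPart sb ℕ.+ posPart sc))
    core = power-compare d C e n q M {α₁} {α₂} {A₁} {A₂} h (exponent-relation M q α₁ α₂ a da a-eq) (exponent-relation₂ M q A₁ A₂ b c db dc bc-eq)
    final : ∀ {p s} → p ≡ M → s ≡ 0 →
      d ℕ.^ p ℕ.* 1 ℕ.* (C ℕ.^ s ℕ.* (e ℕ.^ negPart sa ℕ.* (n ℕ.^ negPart sb ℕ.* (n ℕ.^ negPart sc ℕ.* 1)))) ℕ.≤
      C ℕ.^ p ℕ.* (e ℕ.^ posPart sa ℕ.* (n ℕ.^ posPart sb ℕ.* (n ℕ.^ posPart sc ℕ.* 1))) ℕ.* (d ℕ.^ s ℕ.* 1)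
    final refl refl = subst₂ ℕ._≤_
      (trans (cong (λ v → d ℕ.^ M ℕ.* (e ℕ.^ negPart sa ℕ.* v)) (ℕₚ.^-distribˡ-+-* n (negPart sb) (negPart sc))) (lem (d ℕ.^ M) (e ℕ.^ negPart sa) (n ℕ.^ negPart sb) (n ℕ.^ negPart sc)))
      (trans (cong (λ v → C ℕ.^ M ℕ.* (e ℕ.^ posPart sa ℕ.* v)) (ℕₚ.^-distribˡ-+-* n (posPart sb) (posPart sc))) (lem₂ (C ℕ.^ M) (e ℕ.^ posPart sa) (n ℕ.^ posPart sb) (n ℕ.^ posPart sc)))
      core
      where
      lem : ∀ d a b c → d ℕ.* (a ℕ.* (b ℕ.* c)) ≡ d ℕ.* 1 ℕ.* (1 ℕ.* (a ℕ.* (b ℕ.* (c ℕ.* 1))))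
      lem = solve-∀
      lem₂ : ∀ d a b c → d ℕ.* (a ℕ.* (b ℕ.* c)) ≡ d ℕ.* (a ℕ.* (b ℕ.* (c ℕ.* 1))) ℕ.* (1 ℕ.* 1)
      lem₂ = solve-∀

  module DegreeExponent (r j : ℕ) .{{_ : NonZero r}} where
    private
      ℓ = suc r
      s = suc j
      ρ = ratio j r
      τ = ratio 1 ℓ
      a = degExp ℓ s

    -- ℓ-1 times the exponent of k in (b).
    E₀ : ℤ
    E₀ = + r ℤ.* + (2 ℕ.* ℓ) ℤ.- + r ℤ.* + s ℤ.- + j

    private
      ra : ℕ→ℚ r * a ≡ ι E₀
      ra = trans (solve 4 (λ r x y z → r :* (x :- y :- z) := r :* x :- r :* y :- r :* z) refl (ℕ→ℚ r) (ℕ→ℚ (2 ℕ.* ℓ)) (ℕ→ℚ s) ρ)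
        (trans (cong₂ _-_ (cong₂ _-_ (sym (ι-* (+ r) (+ (2 ℕ.* ℓ)))) (sym (ι-* (+ r) (+ s)))) (ratio-* j r))
        (trans (cong (_- ι (+ j)) (sym (ι-- (+ r ℤ.* + (2 ℕ.* ℓ)) (+ r ℤ.* + s)))) (sym (ι-- (+ r ℤ.* + (2 ℕ.* ℓ) ℤ.- + r ℤ.* + s) (+ j)))))
        where open +-*-Solver

    edge-exponent : ℕ→ℚ (r ℕ.* ℓ) * a ≡ ι (+ ℓ ℤ.* E₀)
    edge-exponent = trans (cong (_* a) (ℕ→ℚ-* r ℓ)) (trans (solve 3 (λ r l a → (r :* l) :* a := l :* (r :* a)) refl (ℕ→ℚ r) (ℕ→ℚ ℓ) a)
      (trans (cong (ℕ→ℚ ℓ *_) ra) (sym (ι-* (+ ℓ) E₀))))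
      where open +-*-Solver

    vertex-exponent : ℕ→ℚ (r ℕ.* ℓ) * (- ((1ℚ + τ) * a) + (1ℚ - τ)) ≡ ι (+ r ℤ.* + r ℤ.- (+ ℓ ℤ.+ + 1) ℤ.* E₀)
    vertex-exponent = begin
      ℕ→ℚ (r ℕ.* ℓ) * (- ((1ℚ + τ) * a) + (1ℚ - τ))
        ≡⟨ cong (_* (- ((1ℚ + τ) * a) + (1ℚ - τ))) (ℕ→ℚ-* r ℓ) ⟩
      ℕ→ℚ r * ℕ→ℚ ℓ * (- ((1ℚ + τ) * a) + (1ℚ - τ))
        ≡⟨ solve 4 (λ r l t a → (r :* l) :* (:- ((con 1ℚ :+ t) :* a) :+ (con 1ℚ :- t)) := r :* (l :- l :* t) :- (l :+ l :* t) :* (r :* a)) refl (ℕ→ℚ r) (ℕ→ℚ ℓ) τ a ⟩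
      ℕ→ℚ r * (ℕ→ℚ ℓ - ℕ→ℚ ℓ * τ) - (ℕ→ℚ ℓ + ℕ→ℚ ℓ * τ) * (ℕ→ℚ r * a)
        ≡⟨ cong₂ (λ u v → ℕ→ℚ r * (ℕ→ℚ ℓ - u) - (ℕ→ℚ ℓ + u) * v) (ratio-* 1 ℓ) ra ⟩
      ℕ→ℚ r * (ℕ→ℚ ℓ - ℕ→ℚ 1) - (ℕ→ℚ ℓ + ℕ→ℚ 1) * ι E₀
        ≡⟨ cong₂ (λ u v → ℕ→ℚ r * u - v * ι E₀) (sym (ι-- (+ ℓ) (+ 1))) (sym (ι-+ (+ ℓ) (+ 1))) ⟩
      ι (+ r) * ι (+ ℓ ℤ.- + 1) - ι (+ ℓ ℤ.+ + 1) * ι E₀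
        ≡⟨ sym (cong₂ _-_ (ι-* (+ r) (+ ℓ ℤ.- + 1)) (ι-* (+ ℓ ℤ.+ + 1) E₀)) ⟩
      ι (+ r ℤ.* (+ ℓ ℤ.- + 1)) - ι ((+ ℓ ℤ.+ + 1) ℤ.* E₀)
        ≡⟨ sym (ι-- (+ r ℤ.* + r) ((+ ℓ ℤ.+ + 1) ℤ.* E₀)) ⟩
      ι (+ r ℤ.* + r ℤ.- (+ ℓ ℤ.+ + 1) ℤ.* E₀) ∎
      where
      open ≡-Reasoning
      open +-*-Solver

    private
      s≡ : ∀ i → i ℕ.+ s ≡ r ℕ.+ r → + s ≡ + r ℤ.+ + r ℤ.- + i
      s≡ i h = trans (lem (+ i) (+ s)) (cong (λ u → + u ℤ.- + i) h)
        where lem : ∀ i s → s ≡ (i ℤ.+ s) ℤ.- i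
              lem = ℤ-Solver.solve-∀

      E₀-form : ∀ i → i ℕ.+ s ≡ r ℕ.+ r → E₀ ≡ + (suc (ℓ ℕ.* i))
      E₀-form i h = trans (cong₂ (λ u v → + r ℤ.* (+ 1 ℤ.+ + r ℤ.+ (+ 1 ℤ.+ + r ℤ.+ + 0)) ℤ.- + r ℤ.* u ℤ.- v) (s≡ i h) j≡)
        (trans (lem (+ r) (+ i)) (cong (λ u → + 1 ℤ.+ u) (sym (ℤₚ.pos-* ℓ i))))
        where
        j≡ : + j ≡ + r ℤ.+ + r ℤ.- + i ℤ.- + 1
        j≡ = trans (lem₃ (+ j)) (cong (ℤ._- + 1) (s≡ i h))
          where lem₃ : ∀ j → j ≡ + 1 ℤ.+ j ℤ.- + 1
                lem₃ = ℤ-Solver.solve-∀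
        lem : ∀ r i → r ℤ.* (+ 1 ℤ.+ r ℤ.+ (+ 1 ℤ.+ r ℤ.+ + 0)) ℤ.- r ℤ.* (r ℤ.+ r ℤ.- i) ℤ.- (r ℤ.+ r ℤ.- i ℤ.- + 1) ≡ + 1 ℤ.+ (+ 1 ℤ.+ r) ℤ.* i
        lem = ℤ-Solver.solve-∀

    edge-exponent-mid : ∀ i → i ℕ.+ s ≡ r ℕ.+ r → ℕ→ℚ (r ℕ.* ℓ) * a ≡ ℕ→ℚ (suc (ℓ ℕ.* i) ℕ.* ℓ) - ℕ→ℚ 0
    edge-exponent-mid i h = trans edge-exponent (trans (cong (λ u → ι (+ ℓ ℤ.* u)) (E₀-form i h))
      (trans (cong ι (trans (sym (ℤₚ.pos-* ℓ (suc (ℓ ℕ.* i)))) (cong +_ (ℕₚ.*-comm ℓ _)))) (solve 1 (λ x → x := x :- con 0ℚ) refl (ℕ→ℚ (suc (ℓ ℕ.* i) ℕ.* ℓ)))))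
      where open +-*-Solver

    vertex-exponent-mid : ∀ i → i ℕ.+ s ≡ r ℕ.+ r →
      ℕ→ℚ (r ℕ.* ℓ) * (- ((1ℚ + τ) * a) + (1ℚ - τ)) ≡ ℕ→ℚ (s ℕ.* ℓ) - ℕ→ℚ ((ℓ ℕ.+ suc (ℓ ℕ.* i)) ℕ.* ℓ)
    vertex-exponent-mid i h = trans vertex-exponent (trans (cong ι (begin
        + r ℤ.* + r ℤ.- (+ ℓ ℤ.+ + 1) ℤ.* E₀
          ≡⟨ cong (λ u → + r ℤ.* + r ℤ.- (+ ℓ ℤ.+ + 1) ℤ.* u) (trans (E₀-form i h) (cong (λ u → + 1 ℤ.+ u) (ℤₚ.pos-* ℓ i))) ⟩
        + r ℤ.* + r ℤ.- (+ 1 ℤ.+ + r ℤ.+ + 1) ℤ.* (+ 1 ℤ.+ (+ 1 ℤ.+ + r) ℤ.* + i)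
          ≡⟨ lem (+ r) (+ i) ⟩
        (+ r ℤ.+ + r ℤ.- + i) ℤ.* + ℓ ℤ.- ((+ ℓ ℤ.+ (+ 1 ℤ.+ + ℓ ℤ.* + i)) ℤ.* + ℓ)
          ≡⟨ cong₂ (λ u v → u ℤ.* + ℓ ℤ.- ((+ ℓ ℤ.+ (+ 1 ℤ.+ v)) ℤ.* + ℓ)) (sym (s≡ i h)) (sym (ℤₚ.pos-* ℓ i)) ⟩
        + s ℤ.* + ℓ ℤ.- (+ (ℓ ℕ.+ suc (ℓ ℕ.* i)) ℤ.* + ℓ)
          ≡⟨ sym (cong₂ ℤ._-_ (ℤₚ.pos-* s ℓ) (ℤₚ.pos-* (ℓ ℕ.+ suc (ℓ ℕ.* i)) ℓ)) ⟩
        + (s ℕ.* ℓ) ℤ.- + ((ℓ ℕ.+ suc (ℓ ℕ.* i)) ℕ.* ℓ) ∎)) (ι-- (+ (s ℕ.* ℓ)) (+ ((ℓ ℕ.+ suc (ℓ ℕ.* i)) ℕ.* ℓ))))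
      where
      open ≡-Reasoning
      lem : ∀ r i → r ℤ.* r ℤ.- (+ 1 ℤ.+ r ℤ.+ + 1) ℤ.* (+ 1 ℤ.+ (+ 1 ℤ.+ r) ℤ.* i) ≡
        (r ℤ.+ r ℤ.- i) ℤ.* (+ 1 ℤ.+ r) ℤ.- (((+ 1 ℤ.+ r) ℤ.+ (+ 1 ℤ.+ (+ 1 ℤ.+ r) ℤ.* i)) ℤ.* (+ 1 ℤ.+ r))
      lem = ℤ-Solver.solve-∀

    private
      -- The exponent of k falls to -1 here, whereas it is positive for all smaller sets; so the
      -- powers of e change sides.
      E₀-top : j ≡ r ℕ.+ r → E₀ ≡ ℤ.- + r
      E₀-top refl = lem (+ r)
        where lem : ∀ r → r ℤ.* (+ 1 ℤ.+ r ℤ.+ (+ 1 ℤ.+ r ℤ.+ + 0)) ℤ.- r ℤ.* (+ 1 ℤ.+ (r ℤ.+ r)) ℤ.- (r ℤ.+ r) ≡ ℤ.- r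
              lem = ℤ-Solver.solve-∀

    edge-exponent-top : j ≡ r ℕ.+ r → ℕ→ℚ (r ℕ.* ℓ) * a ≡ ℕ→ℚ 0 - ℕ→ℚ (r ℕ.* ℓ)
    edge-exponent-top h = trans edge-exponent (trans (cong (λ u → ι (+ ℓ ℤ.* u)) (E₀-top h))
      (trans (cong ι (trans (lem (+ ℓ) (+ r)) (cong (λ u → + 0 ℤ.- u) (sym (ℤₚ.pos-* r ℓ))))) (ι-- (+ 0) (+ (r ℕ.* ℓ)))))
      where lem : ∀ l r → l ℤ.* (ℤ.- r) ≡ + 0 ℤ.- r ℤ.* l
            lem = ℤ-Solver.solve-∀

    vertex-exponent-top : j ≡ r ℕ.+ r →
      ℕ→ℚ (r ℕ.* ℓ) * (- ((1ℚ + τ) * a) + (1ℚ - τ)) ≡ ℕ→ℚ ((r ℕ.* ℓ) ℕ.+ (r ℕ.* ℓ)) - ℕ→ℚ 0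
    vertex-exponent-top h = trans vertex-exponent (trans (cong ι (trans (cong (λ u → + r ℤ.* + r ℤ.- (+ ℓ ℤ.+ + 1) ℤ.* u) (E₀-top h))
      (trans (lem (+ r)) (cong (λ u → u ℤ.+ u ℤ.- + 0) (sym (ℤₚ.pos-* r ℓ)))))) (ι-- (+ ((r ℕ.* ℓ) ℕ.+ (r ℕ.* ℓ))) (+ 0)))
      where lem : ∀ r → r ℤ.* r ℤ.- (+ 1 ℤ.+ r ℤ.+ + 1) ℤ.* (ℤ.- r) ≡ r ℤ.* (+ 1 ℤ.+ r) ℤ.+ r ℤ.* (+ 1 ℤ.+ r) ℤ.- + 0
            lem = ℤ-Solver.solve-∀

-- Choice of C, δ and k₀, and verification of (a) and (b)

open import Data.Nat using (ℕ; _≤_; _*_; _∸_)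
open import Data.Rational using (ℚ; _<_; _-_; 0ℚ; 1ℚ)
open import Data.Fin.Subset using (Subset; ∣_∣)
open import Data.List using (_∷_; []; _++_)
open import Data.List.Relation.Unary.All using (All)
open import Data.Product using (Σ; _×_; _,_; ∃-syntax)
import Data.List.Relation.Unary.All as All
import Data.Nat
import Data.Nat.Properties as ℕₚ
import Data.Vec
open import Data.Integer using (+_)
open import Data.List using (List; length; allFin)
open import Data.Nat using (zero; suc; z≤n; s≤s; NonZero; >-nonZero; _+_; _^_; _≤?_)
open import Data.Nat.Properties using (≤-trans; ≤-reflexive; m≤n*m; *-mono-≤; *-monoʳ-≤; ^-monoʳ-≤; m*n≢0; m^n≢0; +-identityʳ; *-identityʳ; m∸n+n≡m; ≤-antisym; ≰⇒>; *-comm)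
open import Data.Product using (proj₁; proj₂)
open import Data.Rational using (_/_; -_) renaming (_+_ to _+ℚ_; _*_ to _*ℚ_)
open import Data.Rational.Properties using (positive⁻¹; normalize-pos)
open import Relation.Binary.PropositionalEquality using (_≡_; refl; sym; trans; cong; subst)
open import Relation.Nullary using (Dec; yes; no)
open Counting
open Exponents

DegreeBound : ℕ → ℕ → ℕ → ℕ → ℕ → ℕ → Set
DegreeBound r n e C d s = PowLe ((ℕ→ℚ d , 1ℚ) ∷ [])
  ((ℕ→ℚ C , 1ℚ) ∷ kPow (suc r) n e (degExp (suc r) s) ++ ((ℕ→ℚ n , 1ℚ - ratio 1 (suc r)) ∷ []))

degreeBound-mid : ∀ r {n e K} .{{_ : NonZero r}} .{{_ : NonZero n}} .{{_ : NonZero e}} (sc : Scales r n e K) C Cf d j →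
  suc j ≤ r + r → C * 4 ^ suc j ≤ Cf →
  d * (Scales.S sc * Scales.S sc) ^ suc j ≤ C * ((Scales.S sc * Scales.S sc) ^ suc r * Scales.D sc ^ j) →
  DegreeBound r n e Cf d (suc j)
degreeBound-mid r {n} {e} sc C Cf d j j< hC h = degree-intro d Cf e n (r * suc r) (degExp (suc r) (suc j))
    (- ((1ℚ +ℚ ratio 1 (suc r)) *ℚ degExp (suc r) (suc j))) (1ℚ - ratio 1 (suc r))
    {0} {suc (suc r * i) * suc r} {(suc r + suc (suc r * i)) * suc r} {suc j * suc r} {{m*n≢0 r (suc r)}}
    (degree-bound-scaled sc C d i j Cf hi hC h) (edge-exponent-mid i hi) (vertex-exponent-mid i hi)
  where
  open DegreeExponent r j
  i = r + r ∸ suc j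
  hi : i + suc j ≡ r + r
  hi = m∸n+n≡m j<

degreeBound-top : ∀ r n e Cf d j .{{_ : NonZero r}} .{{_ : NonZero n}} .{{_ : NonZero e}} .{{_ : NonZero Cf}} →
  e ≤ n * n → j ≡ r + r → d ≤ 1 → DegreeBound r n e Cf d (suc j)
degreeBound-top r n e Cf d j e≤n² hj d≤1 = degree-intro d Cf e n (r * suc r) (degExp (suc r) (suc j))
    (- ((1ℚ +ℚ ratio 1 (suc r)) *ℚ degExp (suc r) (suc j))) (1ℚ - ratio 1 (suc r))
    {r * suc r} {0} {0} {r * suc r + r * suc r} {{m*n≢0 r (suc r)}}
    (degree-bound-top d Cf e n (r * suc r) d≤1 (Data.Nat.>-nonZero⁻¹ Cf) e≤n²) (edge-exponent-top hj) (vertex-exponent-top hj)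
  where open DegreeExponent r j

module Assembly (r : ℕ) .{{it : NonZero r}} where
  open Constants r

  0<r : 0 Data.Nat.< r
  0<r = Data.Nat.>-nonZero⁻¹ r

  instance
    K≢0 : NonZero K
    K≢0 = subst NonZero (sym K≡) (m*n≢0 (4 * 2 ^ N) 4 {{m*n≢0 4 (2 ^ N) {{_}} {{m^n≢0 2 N}}}})
    C≢0 : NonZero C
    C≢0 = subst NonZero (sym C≡) (m*n≢0 (4 * 2 ^ N) (2 * b₂) {{m*n≢0 4 (2 ^ N) {{_}} {{m^n≢0 2 N}}}}
      {{m*n≢0 2 b₂ {{_}} {{m*n≢0 β ((β * β) ^ N) {{_}} {{m^n≢0 (β * β) N}}}}}})

  abstract
    -- `4 ^ N` covers the `4 ^ |σ|` lost in `degree-bound`, and `8 ^ N` pays for `e ≤ 8 * n * D` in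
    -- `many-hyperedges`.
    Cf Λf : ℕ
    Cf = C * 4 ^ N
    Λf = 8 ^ N * Λ

    Cf≡ : Cf ≡ C * 4 ^ N
    Cf≡ = refl
    Λf≡ : Λf ≡ 8 ^ N * Λ
    Λf≡ = refl

  instance
    Cf≢0 : NonZero Cf
    Cf≢0 = subst NonZero (sym Cf≡) (m*n≢0 C (4 ^ N) {{C≢0}} {{m^n≢0 4 N}})
    Λf≢0 : NonZero Λf
    Λf≢0 = subst NonZero (sym Λf≡) (m*n≢0 (8 ^ N) Λ {{m^n≢0 8 N}} {{Λ≢0}})

  ℓ : ℕ
  ℓ = suc r

  2ℓ≡N : N ≡ 2 * ℓ
  2ℓ≡N = cong (λ k → ℓ + k) (sym (+-identityʳ ℓ))

  module _ {n} (G : Graph n) (1≤n : 1 ≤ n) (dense : PowLe ((ℕ→ℚ (8 * K) , 1ℚ) ∷ []) (kPow ℓ n (nEdges G) 1ℚ)) where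

    instance
      n≢0 : NonZero n
      n≢0 = >-nonZero 1≤n

    e : ℕ
    e = nEdges G

    sc : Scales r n e K
    sc = scales r n e K (density-elim ℓ n e (8 * K) dense) (nEdges-upper G)

    open Scales sc
    open Greedy G r 0<r D S 0<D 0<S 1≤n S≤D S-upper S-lower K*D≤ D-upper

    instance
      e≢0 : NonZero e
      e≢0 = >-nonZero (≤-trans (Data.Nat.>-nonZero⁻¹ (4 * (n * D)) {{m*n≢0 4 (n * D) {{_}} {{m*n≢0 n D {{n≢0}} {{>-nonZero 0<D}}}}}}) D-upper)

    Hs : List (Subset e)
    Hs = proj₁ balanced-family

    open Balanced (proj₁ (proj₂ balanced-family))

    H : Hypergraph e (2 * ℓ)
    H = record { hedges = Hs ; hdistinct = no-repeats ; uniform = All.map (λ p → trans p 2ℓ≡N) sizes }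

    H-cycles : All (IsCycleCopy G (2 * ℓ)) Hs
    H-cycles = subst (λ k → All (IsCycleCopy G k) Hs) 2ℓ≡N cycles

    H-many : PowLe ((+ 1 / Λf , 1ℚ) ∷ kPow ℓ n e (ℕ→ℚ (2 * ℓ)) ++ ((ℕ→ℚ n , ℕ→ℚ 2) ∷ [])) ((ℕ→ℚ (nHedges H) , 1ℚ) ∷ [])
    H-many = many-edges-intro ℓ n e (length Hs) Λf (subst (λ k → e ^ (2 * ℓ) ≤ k * length Hs * n ^ (2 * ℓ)) (sym Λf≡)
      (many-hyperedges sc Λ (length Hs) (proj₂ (proj₂ balanced-family))))

    private
      Bound : ℕ → ℕ → Set
      Bound = DegreeBound r n e Cf

      C*4^≤ : ∀ j → suc j ≤ r + r → C * 4 ^ suc j ≤ Cf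
      C*4^≤ j j< = ≤-trans (*-monoʳ-≤ C (^-monoʳ-≤ 4 (≤-trans j< (ℕₚ.+-mono-≤ (ℕₚ.n≤1+n r) (ℕₚ.n≤1+n r))))) (≤-reflexive (sym Cf≡))

      single : ∀ σ → ∣ σ ∣ ≡ 1 → deg Hs σ ≤ (S * S) ^ r
      single σ h = from-element (∑->0⇒∃ (allFin e) _ (≤-trans (≤-reflexive (sym h)) (≤-reflexive (∣∣≡∑ σ))))
        where
        from-element : ∃[ x ] (_ × 0 Data.Nat.< ⟦ Data.Vec.lookup σ x ⟧) → deg Hs σ ≤ (S * S) ^ r
        from-element (x , _ , p) = ≤-trans (deg≤deg₁ Hs σ x (⟦⟧>0 p)) (deg-edge x)

      low-degree : ∀ σ j → ∣ σ ∣ ≡ suc j → suc j ≤ r + r → deg Hs σ * (S * S) ^ suc j ≤ C * ((S * S) ^ suc r * D ^ j)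
      -- For a single edge, `(S * S) ^ r` is exactly the threshold without its constant `C`.
      low-degree σ zero hs p = ≤-trans (*-mono-≤ (single σ hs) (≤-reflexive (*-identityʳ (S * S))))
        (≤-trans (≤-reflexive (trans (*-comm ((S * S) ^ r) (S * S)) (sym (*-identityʳ _)))) (m≤n*m ((S * S) ^ suc r * 1) C))
      low-degree σ (suc j) hs p = subst (λ s → deg Hs σ * (S * S) ^ s ≤ C * ((S * S) ^ suc r * D ^ (s ∸ 1))) hs
        (deg-mid σ (subst (2 ≤_) (sym hs) (s≤s (s≤s z≤n))) (subst (λ s → 2 + s ≤ N) (sym hs) (≤-trans (s≤s (s≤s p)) (≤-reflexive (cong suc (sym (ℕₚ.+-suc r r)))))))

      bound : ∀ σ j → ∣ σ ∣ ≡ suc j → suc j ≤ r + ℓ → Dec (suc j ≤ r + r) → Bound (deg Hs σ) (suc j)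
      bound σ j hs s≤ (yes p) = degreeBound-mid r {n} {e} {K} {{it}} {{n≢0}} {{e≢0}} sc C Cf (deg Hs σ) j p (C*4^≤ j p) (low-degree σ j hs p)
      bound σ j hs s≤ (no ¬p) = degreeBound-top r n e Cf (deg Hs σ) j {{it}} {{n≢0}} {{e≢0}} {{Cf≢0}} (nEdges-upper G) j≡
          (deg-top σ (trans (cong suc (trans hs (cong suc j≡))) (cong suc (sym (ℕₚ.+-suc r r)))))
        where
        j≡ : j ≡ r + r
        j≡ = ≤-antisym (Data.Nat.s≤s⁻¹ (≤-trans s≤ (≤-reflexive (ℕₚ.+-suc r r)))) (Data.Nat.s≤s⁻¹ (≰⇒> ¬p))

      bound-any : ∀ σ s → ∣ σ ∣ ≡ s → 1 ≤ s → s ≤ r + ℓ → Bound (deg Hs σ) s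
      bound-any σ (suc j) hs _ s≤ = bound σ j hs s≤ (suc j ≤? r + r)

    H-degrees : ∀ σ → 1 ≤ ∣ σ ∣ → ∣ σ ∣ ≤ 2 * ℓ ∸ 1 → Bound (degree H σ) ∣ σ ∣
    H-degrees σ 1≤ ≤N = subst (λ d → Bound d ∣ σ ∣) (sym (length-filter-⊆ Hs σ))
      (bound-any σ ∣ σ ∣ refl 1≤ (≤-trans ≤N (≤-reflexive (cong (λ k → r + suc k) (+-identityʳ r)))))

theorem1p5 : (ℓ : ℕ) → 2 ≤ ℓ →
    ∃[ C ] ∃[ δ ] (0ℚ < C × 0ℚ < δ × ∃[ k₀ ] (
    (n : ℕ) (G : Graph n) → 1 ≤ n →
    PowLe ((ℕ→ℚ k₀ , 1ℚ) ∷ []) (kPow ℓ n (nEdges G) 1ℚ) →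
    Σ (Hypergraph (nEdges G) (2 * ℓ)) λ H →
    All (IsCycleCopy G (2 * ℓ)) (hedges H)
    × PowLe ((δ , 1ℚ) ∷ kPow ℓ n (nEdges G) (ℕ→ℚ (2 * ℓ)) ++ ((ℕ→ℚ n , ℕ→ℚ 2) ∷ []))
    ((ℕ→ℚ (nHedges H) , 1ℚ) ∷ [])
    × ((σ : Subset (nEdges G)) → 1 ≤ ∣ σ ∣ → ∣ σ ∣ ≤ 2 * ℓ ∸ 1 →
    PowLe ((ℕ→ℚ (degree H σ) , 1ℚ) ∷ [])
    ((C , 1ℚ) ∷ kPow ℓ n (nEdges G) (degExp ℓ ∣ σ ∣) ++ ((ℕ→ℚ n , 1ℚ - ratio 1 ℓ) ∷ [])))))
theorem1p5 (suc zero) (s≤s ())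
theorem1p5 (suc (suc r)) _ =
  ℕ→ℚ Cf , + 1 / Λf , positive⁻¹ (ℕ→ℚ Cf) {{normalize-pos Cf 1}} , positive⁻¹ (+ 1 / Λf) {{normalize-pos 1 Λf}} ,
  -- k₀ is `8 * K`: the 8 makes up for D ≥ e/(8n), so that D ≥ K n^(1/ℓ).
  8 * Constants.K (suc r) , λ n G 1≤n dense → H G 1≤n dense , H-cycles G 1≤n dense , H-many G 1≤n dense , H-degrees G 1≤n dense
  where open Assembly (suc r)
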